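{- Let $n,k,s$ be positive integers and let $\mathcal F\subset[n]^k$ with $|\mathcal F|=(s-1)n^{k-1}+1$. Let $\mathcal M$ be a uniformly random perfect matching of $[n]^k$, let $\xi_{\mathcal F}=|\mathcal F\cap\mathcal M|$, and put $p_{\mathcal F}=\mathbb P[\xi_{\mathcal F}\neq s-1]$. Call a hyperplane $\mathcal H_i(a)$ $\mathcal F$-fat if $|\mathcal H_i(a)\cap\mathcal F|\geq(1-2p_{\mathcal F})n^{k-1}$ and $\mathcal F$-thin if $|\mathcal H_i(a)\cap\mathcal F|\leq 2p_{\mathcal F}n^{k-1}$. <ol> <li>Suppose $n\geq 4$ and $p_{\mathcal F}<1/8$, and fix $i\in[k]$. Then one of the following holds: (a) for every $a\in[n]$, $|\mathcal H_i(a)\cap\mathcal F|\leq 2p_{\mathcal F}n^{k-1}+(s-1)n^{k-2}$; or (b) there is a partition $[n]=F\sqcup T$ such that $\mathcal H_i(a)$ is $\mathcal F$-fat for every $a\in F$ and $\mathcal H_i(a)$ is $\mathcal F$-thin for every $a\in T$.</li> <li>Suppose $n\geq 8$, $s\geq 3$ and $p_{\mathcal F}\leq\frac{1}{4n(s-1)}$. Then all $\mathcal F$-fat hyperplanes are parallel, i.e., there is a fixed $i\in[k]$ such that every $\mathcal F$-fat hyperplane is of the form $\mathcal H_i(a)$ for some $a\in[n]$.</li> <li>Suppose $n\geq 8$, $s\geq 3$ and $p_{\mathcal F}\leq\frac{1}{4n(s-1)}$. Then there are exactly $s-1$ $\mathcal F$-fat hyperplanes.</li> </ol>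
   Context: $[n]=\{1,\ldots,n\}$ and $[n]^k$ is the set of all $k$-tuples $\mathbf x=(x_1,\ldots,x_k)$ with $x_j\in[n]$. Two tuples $\mathbf x,\mathbf y$ are disjoint iff $x_j\neq y_j$ for all $j\in[k]$. A perfect matching of $[n]^k$ is a collection of $n$ pairwise disjoint tuples in $[n]^k$ (equivalently, viewing tuples as the sets $\{(j,x_j)\}\subset[k]\times[n]$, $n$ disjoint sets covering $[k]\times[n]$). For $i\in[k]$ and $a\in[n]$, the hyperplane $\mathcal H_i(a)$ is $\{\mathbf x\in[n]^k: x_i=a\}$. -}

module Defs where

open import Data.Nat using (ℕ; zero; suc; _+_; _*_; _∸_; _^_; _≤_; _≡ᵇ_)
open import Data.Nat.Properties using (_≤?_)
open import Data.Bool using (Bool; true; false; not; _∧_; if_then_else_)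
open import Data.Fin using (Fin)
open import Data.Fin.Properties using () renaming (_≟_ to _≟F_)
open import Data.Vec using (Vec; []; _∷_; lookup)
open import Data.List using (List; []; _∷_; [_]; map; concatMap; _++_; length; allFin; filter)
open import Data.Product using (_×_; _,_)
open import Relation.Nullary using (Dec; does)

Tuple : ℕ → ℕ → Set
Tuple n k = Vec (Fin n) k

allTuples : ∀ n k → List (Tuple n k)
allTuples n zero = [ [] ]
allTuples n (suc k) = concatMap (λ x → map (x ∷_) (allTuples n k)) (allFin n)

-- all subsets of a list (as sublists); each subset of a duplicate-free list appears once
subsets : ∀ {A : Set} → List A → List (List A)
subsets [] = [ [] ]
subsets (x ∷ xs) = map (x ∷_) (subsets xs) ++ subsets xs

count : ∀ {A : Set} → (A → Bool) → List A → ℕ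
count p [] = 0
count p (x ∷ xs) = if p x then suc (count p xs) else count p xs

disjointᵇ : ∀ {n k} → Tuple n k → Tuple n k → Bool
disjointᵇ [] [] = true
disjointᵇ (x ∷ xs) (y ∷ ys) = not (does (x ≟F y)) ∧ disjointᵇ xs ys

allᵇ : ∀ {A : Set} → (A → Bool) → List A → Bool
allᵇ p [] = true
allᵇ p (x ∷ xs) = p x ∧ allᵇ p xs

pairwiseDisjointᵇ : ∀ {n k} → List (Tuple n k) → Bool
pairwiseDisjointᵇ [] = true
pairwiseDisjointᵇ (x ∷ xs) = allᵇ (disjointᵇ x) xs ∧ pairwiseDisjointᵇ xs

isPerfectMatchingᵇ : ∀ n {k} → List (Tuple n k) → Bool
isPerfectMatchingᵇ n M = (length M ≡ᵇ n) ∧ pairwiseDisjointᵇ M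

Family : ℕ → ℕ → Set
Family n k = Tuple n k → Bool

size : ∀ {n k} → Family n k → ℕ
size {n} {k} F = count F (allTuples n k)

hyperCount : ∀ {n k} → Family n k → Fin k → Fin n → ℕ
hyperCount {n} {k} F i a = count (λ x → does (lookup x i ≟F a) ∧ F x) (allTuples n k)

numPM : ℕ → ℕ → ℕ
numPM n k = count (isPerfectMatchingᵇ n) (subsets (allTuples n k))

numBad : ∀ {n k} → Family n k → ℕ → ℕ
numBad {n} {k} F s =
  count (λ M → isPerfectMatchingᵇ n M ∧ not (count F M ≡ᵇ (s ∸ 1)))
        (subsets (allTuples n k))

-- p_F = numBad F s / numPM n k ; all conditions on p_F below are cleared of
-- the (positive) denominator N = numPM n k.

-- H_i(a) is F-fat : |H_i(a) ∩ F| ≥ (1 - 2 p_F) n^{k-1}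
--   ⇔ N n^{k-1} ≤ N |H_i(a) ∩ F| + 2 B n^{k-1}
Fat : ∀ {n k} → Family n k → ℕ → Fin k → Fin n → Set
Fat {n} {k} F s i a =
  numPM n k * n ^ (k ∸ 1) ≤ numPM n k * hyperCount F i a + 2 * numBad F s * n ^ (k ∸ 1)

Fat? : ∀ {n k} (F : Family n k) s i a → Dec (Fat F s i a)
Fat? {n} {k} F s i a = _ ≤? _

-- H_i(a) is F-thin : |H_i(a) ∩ F| ≤ 2 p_F n^{k-1}  ⇔  N |H_i(a) ∩ F| ≤ 2 B n^{k-1}
Thin : ∀ {n k} → Family n k → ℕ → Fin k → Fin n → Set
Thin {n} {k} F s i a = numPM n k * hyperCount F i a ≤ 2 * numBad F s * n ^ (k ∸ 1)

allHyperplanes : ∀ n k → List (Fin k × Fin n)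
allHyperplanes n k = concatMap (λ i → map (i ,_) (allFin n)) (allFin k)

-- number of F-fat hyperplanes (distinct (i,a) give distinct hyperplanes when n ≥ 2)
numFat : ∀ {n k} → Family n k → ℕ → ℕ
numFat {n} {k} F s = length (filter (λ ia → Fat? F s (Data.Product.proj₁ ia) (Data.Product.proj₂ ia)) (allHyperplanes n k))

{-# OPTIONS --safe #-}

-- Put p = p_F, t = s - 1.  Fix a direction and two layers f_a, f_b : [n]^(k-1) → {0,1} of F.  Exchanging
-- the tuples of a random matching in these layers shows that f_a - f_b takes the same value at the two
-- ends of a random disjoint pair with probability at least 1 - 2p; since the disjointness graph expands,
-- f_a - f_b is constant up to density 2p.  Hence either all layers are close to each other or each of
-- them is fat or thin.  In the second case counting F gives t fat layers, and they leave no room for a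
-- fat hyperplane in another direction.
--
-- It remains to exclude that the layers are close in all directions.  Then every coordinate has influence
-- at most 2p on F.  For a set S of coordinates and u ∈ [n]^S let D(u) be the distance from the density of
-- the fibre of F over u to {0,1}.  The dichotomy, applied to the fibres over a random matching of [n]^S,
-- shows that D is close on it either to 0 everywhere or to d/n everywhere, where d = min(t, n - t).
-- Adding the coordinates to S one by one, the mean of D moves in small steps from d/n (approximately)
-- to 0, so for some S it is about half of d/n.  Then {u : D(u) ≥ d/2n} has density bounded away from 0
-- and 1 although disjoint pairs rarely cross it, contradicting expansion.
module Submission where

open import Defs
open import Data.Nat using (ℕ; zero; suc; _+_; _*_; _∸_; _^_; _≤_; _<_; _≡ᵇ_; _⊓_; z≤n; s≤s; NonZero; >-nonZero; pred)
open import Data.Nat.Properties hiding (suc-injective)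
open import Data.Nat.Tactic.RingSolver using (solve-∀)
open import Data.Bool using (Bool; true; false; not; _∧_)
open import Data.Bool.Properties using (∧-assoc; ∧-zeroʳ; ∧-identityʳ; T-≡)
open import Data.Fin using (Fin; zero; suc; fromℕ<; punchOut)
open import Data.Fin.Properties using (all?; ¬∀⟶∃¬; suc-injective; punchIn-punchOut) renaming (_≟_ to _≟F_)
open import Data.Fin.Permutation.Components using (transpose; transpose-inverse)
open import Data.Vec using (Vec; []; _∷_; lookup; zipWith; tabulate; insertAt; replicate; toList; _[_]≔_)
import Data.Vec as Vec
open import Data.Vec.Properties using (lookup∘tabulate; tabulate∘lookup; tabulate-cong; lookup-map; lookup-zipWith; lookup-replicate; insertAt-lookup; insertAt-punchIn; ∷-injective)
open import Data.List using (List; []; _∷_; [_]; map; concatMap; _++_; length; allFin; filter; filterᵇ)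
open import Data.List.Properties using (length-map; length-tabulate; map-tabulate)
open import Data.List.Membership.Propositional using (_∈_)
open import Data.List.Membership.Propositional.Properties using (∈-∃++; ∈-allFin; ∈-map⁻; ∈-map⁺; ∈-++⁻; ∈-++⁺ˡ; ∈-++⁺ʳ)
open import Data.List.Relation.Unary.Any using (here; there)
open import Data.List.Relation.Unary.All using ([]; _∷_)
open import Data.List.Relation.Unary.AllPairs using ([]; _∷_)
open import Data.List.Relation.Unary.Unique.Propositional using (Unique)
open import Data.List.Relation.Unary.Unique.Propositional.Properties using (allFin⁺; Unique[x∷xs]⇒x∉xs) renaming (map⁺ to unique-map⁺; filter⁺ to unique-filter⁺; ++⁺ to unique-++⁺)
open import Data.List.Relation.Binary.Permutation.Propositional using (_↭_; prep; ↭-sym; ↭-trans; ↭-refl)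
import Data.List.Relation.Binary.Permutation.Propositional as Perm
open import Data.List.Relation.Binary.Permutation.Propositional.Properties using (shift; ↭-length; ∈-resp-↭)
open import Data.Product using (_×_; _,_; proj₁; proj₂; Σ; ∃)
open import Data.Sum using (_⊎_; inj₁; inj₂)
open import Data.Empty using (⊥; ⊥-elim)
open import Function using (_∘_; id; case_of_; Equivalence)
open import Relation.Nullary using (¬_; Dec; yes; no; does)
open import Relation.Nullary.Decidable using (dec-true; dec-false; _⊎-dec_)
open import Relation.Binary.PropositionalEquality using (_≡_; _≢_; refl; sym; trans; cong; cong₂; subst; subst₂; module ≡-Reasoning)

-- Finite sums

-- Closeness in every direction only says that every influence is at most 2p. With unboundedly many
-- coordinates this does not contradict the density of F, so an intermediate set S has to be found.
-- It is tractable because the columns of a numbered matching are independent permutations: a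
-- matching of [n]^(j+m) is a pair of matchings of [n]^j and [n]^m, p is unchanged when a coordinate
-- passes from one side to the other, and the dichotomy, proved for arbitrary n layers, applies to
-- the fibres over the n rows of the left matching. Constants: p ≤ 1/4nt and td ≥ 4 give p ≤ d/16n.
-- Moving a coordinate lowers the mean of D by at most 2p ≤ d/8n, so the descent cannot jump over
-- the window from 4/8 to 5/8 of d/n. In the window both sides of the cut are so large that the
-- product of their densities is at least 9/64, while the few crossing pairs allow only 8/64. All
-- inequalities are cleared of denominators: N counts matchings, B the bad ones, L is a power of n,
-- and `N * x ≤ 2 * B * L` says that the density x/L is at most 2p.

private variable
  𝒳 𝒴 : Set

𝟙 : Bool → ℕ
𝟙 true = 1
𝟙 false = 0

∑ : List 𝒳 → (𝒳 → ℕ) → ℕ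
∑ [] g = 0
∑ (x ∷ xs) g = g x + ∑ xs g

infix 5 ∑
syntax ∑ xs (λ x → e) = ∑[ x ∈ xs ] e

∑-cong : (xs : List 𝒳) {g h : 𝒳 → ℕ} → (∀ x → g x ≡ h x) → ∑ xs g ≡ ∑ xs h
∑-cong [] e = refl
∑-cong (x ∷ xs) e = cong₂ _+_ (e x) (∑-cong xs e)

∑-cong-∈ : (xs : List 𝒳) {g h : 𝒳 → ℕ} → (∀ x → x ∈ xs → g x ≡ h x) → ∑ xs g ≡ ∑ xs h
∑-cong-∈ [] e = refl
∑-cong-∈ (x ∷ xs) e = cong₂ _+_ (e x (here refl)) (∑-cong-∈ xs λ y y∈ → e y (there y∈))

∑-mono : (xs : List 𝒳) {g h : 𝒳 → ℕ} → (∀ x → g x ≤ h x) → ∑ xs g ≤ ∑ xs h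
∑-mono [] e = z≤n
∑-mono (x ∷ xs) e = +-mono-≤ (e x) (∑-mono xs e)

∑-0 : (xs : List 𝒳) → ∑[ _ ∈ xs ] 0 ≡ 0
∑-0 [] = refl
∑-0 (x ∷ xs) = ∑-0 xs

∑-+ : (xs : List 𝒳) (g h : 𝒳 → ℕ) → ∑[ x ∈ xs ] (g x + h x) ≡ ∑ xs g + ∑ xs h
∑-+ [] g h = refl
∑-+ (x ∷ xs) g h rewrite ∑-+ xs g h = interchange (g x) (h x) (∑ xs g) (∑ xs h)
  where
  interchange : ∀ a b c d → a + b + (c + d) ≡ a + c + (b + d)
  interchange = solve-∀

∑-*ˡ : (xs : List 𝒳) (c : ℕ) (g : 𝒳 → ℕ) → ∑[ x ∈ xs ] (c * g x) ≡ c * ∑ xs g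
∑-*ˡ [] c g = sym (*-zeroʳ c)
∑-*ˡ (x ∷ xs) c g rewrite ∑-*ˡ xs c g = sym (*-distribˡ-+ c (g x) (∑ xs g))

∑-*ʳ : (xs : List 𝒳) (g : 𝒳 → ℕ) (c : ℕ) → ∑[ x ∈ xs ] (g x * c) ≡ ∑ xs g * c
∑-*ʳ xs g c = trans (∑-cong xs λ x → *-comm (g x) c) (trans (∑-*ˡ xs c g) (*-comm c _))

∑-const : (xs : List 𝒳) (c : ℕ) → ∑[ _ ∈ xs ] c ≡ length xs * c
∑-const [] c = refl
∑-const (x ∷ xs) c = cong (c +_) (∑-const xs c)

∑-++ : (xs ys : List 𝒳) (g : 𝒳 → ℕ) → ∑ (xs ++ ys) g ≡ ∑ xs g + ∑ ys g
∑-++ [] ys g = refl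
∑-++ (x ∷ xs) ys g rewrite ∑-++ xs ys g = sym (+-assoc (g x) _ _)

∑-map : (f : 𝒳 → 𝒴) (xs : List 𝒳) (g : 𝒴 → ℕ) → ∑ (map f xs) g ≡ ∑[ x ∈ xs ] g (f x)
∑-map f [] g = refl
∑-map f (x ∷ xs) g = cong (g (f x) +_) (∑-map f xs g)

∑-concatMap : (f : 𝒳 → List 𝒴) (xs : List 𝒳) (g : 𝒴 → ℕ) →
  ∑ (concatMap f xs) g ≡ ∑[ x ∈ xs ] ∑ (f x) g
∑-concatMap f [] g = refl
∑-concatMap f (x ∷ xs) g = trans (∑-++ (f x) (concatMap f xs) g) (cong (∑ (f x) g +_) (∑-concatMap f xs g))

∑-swap : (xs : List 𝒳) (ys : List 𝒴) (g : 𝒳 → 𝒴 → ℕ) →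
  ∑[ x ∈ xs ] ∑[ y ∈ ys ] g x y ≡ ∑[ y ∈ ys ] ∑[ x ∈ xs ] g x y
∑-swap [] ys g = sym (∑-0 ys)
∑-swap (x ∷ xs) ys g = trans (cong (∑ ys (g x) +_) (∑-swap xs ys g)) (sym (∑-+ ys (g x) _))

∑-↭ : {xs ys : List 𝒳} → xs ↭ ys → (g : 𝒳 → ℕ) → ∑ xs g ≡ ∑ ys g
∑-↭ Perm.refl g = refl
∑-↭ (prep x p) g = cong (g x +_) (∑-↭ p g)
∑-↭ (Perm.swap x y p) g = trans (cong (λ z → g x + (g y + z)) (∑-↭ p g)) (exchange (g x) (g y) _)
  where
  exchange : ∀ a b c → a + (b + c) ≡ b + (a + c)
  exchange = solve-∀
∑-↭ (Perm.trans p q) g = trans (∑-↭ p g) (∑-↭ q g)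

∑-filterᵇ : (p : 𝒳 → Bool) (xs : List 𝒳) (g : 𝒳 → ℕ) → ∑ (filterᵇ p xs) g ≡ ∑[ x ∈ xs ] 𝟙 (p x) * g x
∑-filterᵇ p [] g = refl
∑-filterᵇ p (x ∷ xs) g with p x
... | true = cong₂ _+_ (sym (*-identityˡ (g x))) (∑-filterᵇ p xs g)
... | false = ∑-filterᵇ p xs g

∑-product : (xs : List 𝒳) (ys : List 𝒴) (g : 𝒳 → ℕ) (h : 𝒴 → ℕ) →
  ∑ xs g * ∑ ys h ≡ ∑[ x ∈ xs ] ∑[ y ∈ ys ] g x * h y
∑-product xs ys g h = sym (trans (∑-cong xs λ x → ∑-*ˡ ys (g x) h) (∑-*ʳ xs g (∑ ys h)))

count-∑ : (p : 𝒳 → Bool) (xs : List 𝒳) → count p xs ≡ ∑[ x ∈ xs ] 𝟙 (p x)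
count-∑ p [] = refl
count-∑ p (x ∷ xs) with p x
... | true = cong suc (count-∑ p xs)
... | false = count-∑ p xs

𝟙≤1 : ∀ b → 𝟙 b ≤ 1
𝟙≤1 true = ≤-refl
𝟙≤1 false = z≤n

𝟙-∧ : ∀ a b → 𝟙 (a ∧ b) ≡ 𝟙 a * 𝟙 b
𝟙-∧ true b = sym (+-identityʳ (𝟙 b))
𝟙-∧ false b = refl

𝟙-not : ∀ b → 𝟙 b + 𝟙 (not b) ≡ 1
𝟙-not true = refl
𝟙-not false = refl

∧-true⁻ : ∀ {a b} → a ∧ b ≡ true → a ≡ true × b ≡ true
∧-true⁻ {true} e = refl , e

-- Pigeonhole for lists: it upgrades an injective map of a finite set into itself to a reordering of
-- its elements.
unique-⊆⇒↭ : {ys xs : List 𝒳} → Unique ys → (∀ {y} → y ∈ ys → y ∈ xs) → length ys ≡ length xs → ys ↭ xs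
unique-⊆⇒↭ {ys = []} {[]} u s e = ↭-refl
unique-⊆⇒↭ {ys = y ∷ ys} {xs} (y∉ ∷ u) s e with ∈-∃++ (s (here refl))
... | as , bs , refl = ↭-trans (prep y rest) (↭-sym (shift y as bs))
  where
  drop-y : ∀ {z} → z ∈ ys → z ∈ as ++ bs
  drop-y {z} z∈ with ∈-resp-↭ (shift y as bs) (s (there z∈))
  ... | here refl = ⊥-elim (Unique[x∷xs]⇒x∉xs (y∉ ∷ u) z∈)
  ... | there z∈′ = z∈′
  rest : ys ↭ as ++ bs
  rest = unique-⊆⇒↭ u drop-y (cong pred (trans e (↭-length (shift y as bs))))

vec-ext : ∀ {m} {xs ys : Vec 𝒳 m} → (∀ i → lookup xs i ≡ lookup ys i) → xs ≡ ys
vec-ext {xs = xs} {ys} e = trans (sym (tabulate∘lookup xs)) (trans (tabulate-cong e) (tabulate∘lookup ys))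

-- Permutations of Fin n

ne : ∀ {n} → Fin n → Fin n → Bool
ne a b = not (does (a ≟F b))

ne-true⁻ : ∀ {n} {a b : Fin n} → ne a b ≡ true → a ≢ b
ne-true⁻ {a = a} {b} e with a ≟F b
... | no a≢b = a≢b

ne-true⁺ : ∀ {n} {a b : Fin n} → a ≢ b → ne a b ≡ true
ne-true⁺ {a = a} {b} a≢b rewrite dec-false (a ≟F b) a≢b = refl

ne-refl : ∀ {n} (a : Fin n) → ne a a ≡ false
ne-refl a rewrite dec-true (a ≟F a) refl = refl

ne-sym : ∀ {n} (a b : Fin n) → ne a b ≡ ne b a
ne-sym a b with a ≟F b
... | yes refl = sym (ne-refl a)
... | no a≢b = sym (ne-true⁺ (a≢b ∘ sym))

-- A record rather than an abbreviation of the function type, so that unification can recover `π`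
-- from `Inj π`.
record Inj {n r} (π : Vec (Fin n) r) : Set where
  constructor inj
  field injective : ∀ i j → lookup π i ≡ lookup π j → i ≡ j
open Inj

freshᵇ : ∀ {n r} → Fin n → Vec (Fin n) r → Bool
freshᵇ a [] = true
freshᵇ a (b ∷ bs) = ne a b ∧ freshᵇ a bs

distinctᵇ : ∀ {n r} → Vec (Fin n) r → Bool
distinctᵇ [] = true
distinctᵇ (a ∷ as) = freshᵇ a as ∧ distinctᵇ as

freshᵇ⁻ : ∀ {n r} (a : Fin n) (v : Vec (Fin n) r) → freshᵇ a v ≡ true → ∀ i → a ≢ lookup v i
freshᵇ⁻ a (b ∷ v) e zero = ne-true⁻ (proj₁ (∧-true⁻ e))
freshᵇ⁻ a (b ∷ v) e (suc i) = freshᵇ⁻ a v (proj₂ (∧-true⁻ {ne a b} e)) i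

freshᵇ⁺ : ∀ {n r} (a : Fin n) (v : Vec (Fin n) r) → (∀ i → a ≢ lookup v i) → freshᵇ a v ≡ true
freshᵇ⁺ a [] h = refl
freshᵇ⁺ a (b ∷ v) h rewrite ne-true⁺ (h zero) = freshᵇ⁺ a v (h ∘ suc)

distinctᵇ⁻ : ∀ {n r} (v : Vec (Fin n) r) → distinctᵇ v ≡ true → Inj v
distinctᵇ⁻ v e .injective = go v e
  where
  go : ∀ {r} (v : Vec _ r) → distinctᵇ v ≡ true → ∀ i j → lookup v i ≡ lookup v j → i ≡ j
  go (a ∷ v) e zero zero p = refl
  go (a ∷ v) e zero (suc j) p = ⊥-elim (freshᵇ⁻ a v (proj₁ (∧-true⁻ e)) j p)
  go (a ∷ v) e (suc i) zero p = ⊥-elim (freshᵇ⁻ a v (proj₁ (∧-true⁻ e)) i (sym p))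
  go (a ∷ v) e (suc i) (suc j) p = cong suc (go v (proj₂ (∧-true⁻ {freshᵇ a v} e)) i j p)

distinctᵇ⁺ : ∀ {n r} (v : Vec (Fin n) r) → Inj v → distinctᵇ v ≡ true
distinctᵇ⁺ [] h = refl
distinctᵇ⁺ (a ∷ v) h
  rewrite freshᵇ⁺ a v (λ i p → case injective h zero (suc i) p of λ ())
  = distinctᵇ⁺ v (inj λ i j p → suc-injective (injective h (suc i) (suc j) p))

allTuples-unique : ∀ n m → Unique (allTuples n m)
allTuples-unique n zero = [] ∷ []
allTuples-unique n (suc m) = go (allFin n) (allFin⁺ n)
  where
  go : ∀ (cs : List (Fin n)) → Unique cs → Unique (concatMap (λ c → map (c ∷_) (allTuples n m)) cs)
  go [] u = []
  go (c ∷ cs) (c∉ ∷ u) = unique-++⁺ (unique-map⁺ (proj₂ ∘ ∷-injective) (allTuples-unique n m)) (go cs u) disj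
    where
    head-∈ : ∀ ds {v} → v ∈ concatMap (λ d → map (d ∷_) (allTuples n m)) ds → lookup v zero ∈ ds
    head-∈ (d ∷ ds) v∈ with ∈-++⁻ (map (d ∷_) (allTuples n m)) v∈
    ... | inj₂ v∈′ = there (head-∈ ds v∈′)
    ... | inj₁ v∈′ with ∈-map⁻ (d ∷_) v∈′
    ... | _ , _ , refl = here refl
    disj : ∀ {v} → ¬ (v ∈ map (c ∷_) (allTuples n m) × v ∈ concatMap (λ d → map (d ∷_) (allTuples n m)) cs)
    disj (p , q) with ∈-map⁻ (c ∷_) p
    ... | _ , _ , refl = Unique[x∷xs]⇒x∉xs (c∉ ∷ u) (head-∈ cs q)

∈-allTuples : ∀ n m (v : Tuple n m) → v ∈ allTuples n m
∈-allTuples n zero [] = here refl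
∈-allTuples n (suc m) (c ∷ v) = go (allFin n) (∈-allFin c)
  where
  go : ∀ cs → c ∈ cs → (c ∷ v) ∈ concatMap (λ d → map (d ∷_) (allTuples n m)) cs
  go (d ∷ cs) (here refl) = ∈-++⁺ˡ (∈-map⁺ (d ∷_) (∈-allTuples n m v))
  go (d ∷ cs) (there c∈) = ∈-++⁺ʳ (map (d ∷_) (allTuples n m)) (go cs c∈)

∑-tuples : ∀ n m (g : Tuple n (suc m) → ℕ) →
  ∑ (allTuples n (suc m)) g ≡ ∑[ c ∈ allFin n ] ∑[ w ∈ allTuples n m ] g (c ∷ w)
∑-tuples n m g = trans (∑-concatMap _ (allFin n) g) (∑-cong (allFin n) λ c → ∑-map (c ∷_) (allTuples n m) g)

length-allFin : ∀ n → length (allFin n) ≡ n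
length-allFin n = length-tabulate id

∑-const-Fin : ∀ n c → ∑[ _ ∈ allFin n ] c ≡ n * c
∑-const-Fin n c = trans (∑-const (allFin n) c) (cong (_* c) (length-allFin n))

∑-const-tuples : ∀ n m c → ∑[ _ ∈ allTuples n m ] c ≡ n ^ m * c
∑-const-tuples n zero c = refl
∑-const-tuples n (suc m) c = trans (∑-tuples n m _) (trans (∑-cong (allFin n) λ _ → ∑-const-tuples n m c)
  (trans (∑-const-Fin n _) (sym (*-assoc n (n ^ m) c))))

perms : ∀ n → List (Vec (Fin n) n)
perms n = filterᵇ distinctᵇ (allTuples n n)

module _ {n : ℕ} where

  private
    filterᵇ-∈⁻ : ∀ {A : Set} (p : A → Bool) xs {x} → x ∈ filterᵇ p xs → p x ≡ true
    filterᵇ-∈⁻ p (y ∷ xs) x∈ with p y in eq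
    filterᵇ-∈⁻ p (y ∷ xs) (here refl) | true = eq
    filterᵇ-∈⁻ p (y ∷ xs) (there x∈) | true = filterᵇ-∈⁻ p xs x∈
    filterᵇ-∈⁻ p (y ∷ xs) x∈ | false = filterᵇ-∈⁻ p xs x∈

    filterᵇ-∈⁺ : ∀ {A : Set} (p : A → Bool) xs {x} → x ∈ xs → p x ≡ true → x ∈ filterᵇ p xs
    filterᵇ-∈⁺ p (y ∷ xs) (here refl) e rewrite e = here refl
    filterᵇ-∈⁺ p (y ∷ xs) (there x∈) e with p y
    ... | true = there (filterᵇ-∈⁺ p xs x∈ e)
    ... | false = filterᵇ-∈⁺ p xs x∈ e

  perms-Inj : ∀ {π : Vec (Fin n) n} → π ∈ perms n → Inj π
  perms-Inj {π} π∈ = distinctᵇ⁻ π (filterᵇ-∈⁻ distinctᵇ (allTuples n n) π∈)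

  Inj-perms : ∀ {π : Vec (Fin n) n} → Inj π → π ∈ perms n
  Inj-perms {π} h = filterᵇ-∈⁺ distinctᵇ (allTuples n n) (∈-allTuples n n π) (distinctᵇ⁺ π h)

  perms-unique : Unique (perms n)
  perms-unique = unique-filter⁺ _ (allTuples-unique n n)

  perm-↭ : ∀ {π : Vec (Fin n) n} → Inj π → map (lookup π) (allFin n) ↭ allFin n
  perm-↭ {π} h = unique-⊆⇒↭ (unique-map⁺ (λ {i} {j} → injective h i j) (allFin⁺ n)) (λ _ → ∈-allFin _) (length-map (lookup π) (allFin n))

  ∑-perm : ∀ {π : Vec (Fin n) n} → Inj π → (g : Fin n → ℕ) → ∑[ i ∈ allFin n ] g (lookup π i) ≡ ∑ (allFin n) g
  ∑-perm {π} h g = trans (sym (∑-map (lookup π) (allFin n) g)) (∑-↭ (perm-↭ h) g)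

  perm-surjective : ∀ {π : Vec (Fin n) n} → Inj π → ∀ b → ∃ λ a → lookup π a ≡ b
  perm-surjective {π} h b with ∈-map⁻ (lookup π) (∈-resp-↭ (↭-sym (perm-↭ h)) (∈-allFin b))
  ... | a , _ , refl = a , refl

  infixr 9 _∘ᵥ_
  _∘ᵥ_ : ∀ {A : Set} → Vec A n → Vec (Fin n) n → Vec A n
  π ∘ᵥ ρ = Vec.map (lookup π) ρ

  lookup-∘ᵥ : ∀ {A : Set} (π : Vec A n) (ρ : Vec (Fin n) n) i → lookup (π ∘ᵥ ρ) i ≡ lookup π (lookup ρ i)
  lookup-∘ᵥ π ρ i = lookup-map i (lookup π) ρ

  Inj-∘ᵥ : ∀ {π ρ : Vec (Fin n) n} → Inj π → Inj ρ → Inj (π ∘ᵥ ρ)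
  Inj-∘ᵥ {π} {ρ} p q = inj λ i j e → injective q i j (injective p _ _ (trans (sym (lookup-∘ᵥ π ρ i)) (trans e (lookup-∘ᵥ π ρ j))))

  -- Right composition with a permutation maps `perms n` injectively into itself and hence only
  -- reorders the list.
  ∑-perms-∘ᵥ : ∀ {ρ : Vec (Fin n) n} → Inj ρ → (g : Vec (Fin n) n → ℕ) → ∑[ π ∈ perms n ] g (π ∘ᵥ ρ) ≡ ∑ (perms n) g
  ∑-perms-∘ᵥ {ρ} h g = trans (sym (∑-map (_∘ᵥ ρ) (perms n) g)) (∑-↭ ↭ρ g)
    where
    cancel : ∀ {π σ : Vec (Fin n) n} → π ∘ᵥ ρ ≡ σ ∘ᵥ ρ → π ≡ σ
    cancel {π} {σ} e = vec-ext at
      where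
      at : ∀ i → lookup π i ≡ lookup σ i
      at i with perm-surjective h i
      ... | a , refl = trans (sym (lookup-∘ᵥ π ρ a)) (trans (cong (λ v → lookup v a) e) (lookup-∘ᵥ σ ρ a))
    inside : ∀ {σ} → σ ∈ map (_∘ᵥ ρ) (perms n) → σ ∈ perms n
    inside σ∈ with ∈-map⁻ (_∘ᵥ ρ) σ∈
    ... | π , π∈ , refl = Inj-perms (Inj-∘ᵥ (perms-Inj π∈) h)
    ↭ρ : map (_∘ᵥ ρ) (perms n) ↭ perms n
    ↭ρ = unique-⊆⇒↭ (unique-map⁺ cancel perms-unique) inside (length-map _ (perms n))

  transpose-i : ∀ (i j : Fin n) → transpose i j i ≡ j
  transpose-i i j rewrite dec-true (i ≟F i) refl = refl

  transpose-j : ∀ (i j : Fin n) → transpose i j j ≡ i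
  transpose-j i j with j ≟F i
  ... | yes j≡i = j≡i
  ... | no _ rewrite dec-true (j ≟F j) refl = refl

  transpose-≢ : ∀ (i j : Fin n) {k} → k ≢ i → k ≢ j → transpose i j k ≡ k
  transpose-≢ i j {k} p q rewrite dec-false (k ≟F i) p | dec-false (k ≟F j) q = refl

  transposition : Fin n → Fin n → Vec (Fin n) n
  transposition i j = tabulate (transpose i j)

  lookup-transposition : ∀ i j k → lookup (transposition i j) k ≡ transpose i j k
  lookup-transposition i j k = lookup∘tabulate (transpose i j) k

  transposition-Inj : ∀ i j → Inj (transposition i j)
  transposition-Inj i j = inj λ a b e →
    trans (sym (transpose-inverse j i)) (trans (cong (transpose j i)
      (trans (sym (lookup-transposition i j a)) (trans e (lookup-transposition i j b)))) (transpose-inverse j i))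

  lookup-transposition-i : ∀ i j → lookup (transposition i j) i ≡ j
  lookup-transposition-i i j = trans (lookup-transposition i j i) (transpose-i i j)

  lookup-transposition-j : ∀ i j → lookup (transposition i j) j ≡ i
  lookup-transposition-j i j = trans (lookup-transposition i j j) (transpose-j i j)

  lookup-transposition-≢ : ∀ i j {k} → k ≢ i → k ≢ j → lookup (transposition i j) k ≡ k
  lookup-transposition-≢ i j {k} p q = trans (lookup-transposition i j k) (transpose-≢ i j p q)

  -- Double transitivity of the symmetric group, from two transpositions: the second corrects the
  -- image of `i′` and leaves `k` alone.
  moving-pair : ∀ {i i′ k k′ : Fin n} → i ≢ i′ → k ≢ k′ →
    ∃ λ (ρ : Vec (Fin n) n) → Inj ρ × lookup ρ i ≡ k × lookup ρ i′ ≡ k′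
  moving-pair {i} {i′} {k} {k′} i≢ k≢ = σ ∘ᵥ τ , Inj-∘ᵥ (transposition-Inj i″ k′) (transposition-Inj i k) , at-i , at-i′
    where
    τ = transposition i k
    i″ = lookup τ i′
    σ = transposition i″ k′
    k≢i″ : k ≢ i″
    k≢i″ e = i≢ (injective (transposition-Inj i k) i i′ (trans (lookup-transposition-i i k) e))
    at-i : lookup (σ ∘ᵥ τ) i ≡ k
    at-i = trans (lookup-∘ᵥ σ τ i) (trans (cong (lookup σ) (lookup-transposition-i i k)) (lookup-transposition-≢ i″ k′ k≢i″ k≢))
    at-i′ : lookup (σ ∘ᵥ τ) i′ ≡ k′
    at-i′ = trans (lookup-∘ᵥ σ τ i′) (lookup-transposition-i i″ k′)

∑-≡ : ∀ {n} (xs : List (Fin n)) → Unique xs → ∀ {a} → a ∈ xs → (g : Fin n → ℕ) →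
  ∑[ b ∈ xs ] 𝟙 (does (a ≟F b)) * g b ≡ g a
∑-≡ {n} (x ∷ xs) (x∉ ∷ u) (here refl) g rewrite dec-true (x ≟F x) refl =
  trans (cong₂ _+_ (+-identityʳ (g x)) (trans (∑-cong-∈ xs λ b b∈ → cong (λ z → 𝟙 z * g b) (dec-false (x ≟F b) λ { refl → Unique[x∷xs]⇒x∉xs (x∉ ∷ u) b∈ })) (∑-0 xs)))
    (+-identityʳ (g x))
∑-≡ {n} (x ∷ xs) (x∉ ∷ u) {a} (there a∈) g
  rewrite dec-false (a ≟F x) (λ { refl → Unique[x∷xs]⇒x∉xs (x∉ ∷ u) a∈ }) = ∑-≡ xs u a∈ g

∑-Fin-≡ : ∀ {n} (a : Fin n) (g : Fin n → ℕ) → ∑[ b ∈ allFin n ] 𝟙 (does (a ≟F b)) * g b ≡ g a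
∑-Fin-≡ a g = ∑-≡ (allFin _) (allFin⁺ _) (∈-allFin a) g

∑-Fin-ne : ∀ {n} (a : Fin n) (g : Fin n → ℕ) → (∑[ b ∈ allFin n ] 𝟙 (ne a b) * g b) + g a ≡ ∑ (allFin n) g
∑-Fin-ne {n} a g = trans (cong ((∑[ b ∈ allFin n ] 𝟙 (ne a b) * g b) +_) (sym (∑-Fin-≡ a g)))
  (trans (sym (∑-+ (allFin n) _ _)) (∑-cong (allFin n) λ b → split (does (a ≟F b)) (g b)))
  where
  split : ∀ t x → 𝟙 (not t) * x + 𝟙 t * x ≡ x
  split true x = +-identityʳ x
  split false x = trans (+-identityʳ _) (+-identityʳ x)

∑-ne-const : ∀ {n} (a : Fin n) c → ∑[ b ∈ allFin n ] 𝟙 (ne a b) * c ≡ (n ∸ 1) * c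
∑-ne-const {suc n} a c = +-cancelʳ-≡ c _ _ (trans (∑-Fin-ne a (λ _ → c)) (trans (∑-const-Fin (suc n) c) (+-comm c (n * c))))

∑² : ∀ n → (Fin n → Fin n → ℕ) → ℕ
∑² n h = ∑[ a ∈ allFin n ] ∑[ b ∈ allFin n ] 𝟙 (ne a b) * h a b

∑²-const : ∀ n c → ∑² n (λ _ _ → c) ≡ n * (n ∸ 1) * c
∑²-const n c = trans (∑-cong (allFin n) λ a → ∑-ne-const a c) (trans (∑-const-Fin n _) (sym (*-assoc n (n ∸ 1) c)))

-- Double counting over all pairs of places. By double transitivity the sum is the same for each
-- pair, and for a single permutation summing over the places only relabels the pairs of values. So
-- two values of a random permutation form a uniform pair of distinct elements.
perms-pair : ∀ {n} {i i′ : Fin n} → i ≢ i′ → (h : Fin n → Fin n → ℕ) →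
  n * (n ∸ 1) * (∑[ π ∈ perms n ] h (lookup π i) (lookup π i′)) ≡ length (perms n) * ∑² n h
perms-pair {n} {i} {i′} i≢ h = begin
  n * (n ∸ 1) * S i i′ ≡⟨ sym (∑²-const n (S i i′)) ⟩
  ∑² n (λ _ _ → S i i′) ≡⟨ ∑-cong (allFin n) (λ k → ∑-cong (allFin n) λ k′ → S-const k k′) ⟩
  ∑² n S ≡⟨ ∑-cong (allFin n) (λ k → ∑-cong (allFin n) λ k′ → sym (∑-*ˡ (perms n) (𝟙 (ne k k′)) _)) ⟩
  (∑[ k ∈ allFin n ] ∑[ k′ ∈ allFin n ] ∑[ π ∈ perms n ] 𝟙 (ne k k′) * h (lookup π k) (lookup π k′))
    ≡⟨ ∑-cong (allFin n) (λ k → ∑-swap (allFin n) (perms n) _) ⟩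
  (∑[ k ∈ allFin n ] ∑[ π ∈ perms n ] ∑[ k′ ∈ allFin n ] 𝟙 (ne k k′) * h (lookup π k) (lookup π k′))
    ≡⟨ ∑-swap (allFin n) (perms n) _ ⟩
  (∑[ π ∈ perms n ] ∑² n (λ k k′ → h (lookup π k) (lookup π k′)))
    ≡⟨ ∑-cong-∈ (perms n) (λ π π∈ → relabel (perms-Inj π∈)) ⟩
  (∑[ _ ∈ perms n ] ∑² n h) ≡⟨ ∑-const (perms n) _ ⟩
  length (perms n) * ∑² n h ∎
  where
  open ≡-Reasoning
  S : Fin n → Fin n → ℕ
  S k k′ = ∑[ π ∈ perms n ] h (lookup π k) (lookup π k′)
  S-const : ∀ k k′ → 𝟙 (ne k k′) * S i i′ ≡ 𝟙 (ne k k′) * S k k′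
  S-const k k′ with k ≟F k′
  ... | yes _ = refl
  ... | no k≢ with moving-pair i≢ k≢
  ... | ρ , ρ-inj , refl , refl = cong (1 *_) (trans (sym (∑-perms-∘ᵥ ρ-inj _))
          (∑-cong (perms n) λ π → cong₂ h (lookup-∘ᵥ π ρ i) (lookup-∘ᵥ π ρ i′)))
  ne-Inj : ∀ {π : Vec (Fin n) n} → Inj π → ∀ k k′ → ne k k′ ≡ ne (lookup π k) (lookup π k′)
  ne-Inj {π} π-inj k k′ with k ≟F k′
  ... | yes refl = sym (ne-refl (lookup π k))
  ... | no k≢ = sym (ne-true⁺ (k≢ ∘ injective π-inj k k′))
  relabel : ∀ {π : Vec (Fin n) n} → Inj π → ∑² n (λ k k′ → h (lookup π k) (lookup π k′)) ≡ ∑² n h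
  relabel {π} π-inj = trans
    (∑-cong (allFin n) λ k → trans (∑-cong (allFin n) λ k′ → cong (λ b → 𝟙 b * h (lookup π k) (lookup π k′)) (ne-Inj π-inj k k′))
      (∑-perm π-inj (λ b → 𝟙 (ne (lookup π k) b) * h (lookup π k) b)))
    (∑-perm π-inj (λ a → ∑[ b ∈ allFin n ] 𝟙 (ne a b) * h a b))

perms-nonempty : ∀ n → 1 ≤ length (perms n)
perms-nonempty n = go (Inj-perms {n} {tabulate id} (inj λ i j e → trans (sym (lookup∘tabulate id i)) (trans e (lookup∘tabulate id j))))
  where
  go : ∀ {A : Set} {x : A} {xs} → x ∈ xs → 1 ≤ length xs
  go (here _) = s≤s z≤n
  go (there _) = s≤s z≤n

-- Ordered matchings

-- Perfect matchings of [n]^m with their tuples numbered, as matrices whose rows are the tuples and whose columns are permutations.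
matchings : ∀ n m → List (Vec (Tuple n m) n)
matchings n zero = [ replicate n [] ]
matchings n (suc m) = concatMap (λ π → map (zipWith Vec._∷_ π) (matchings n m)) (perms n)

#matchings : ℕ → ℕ → ℕ
#matchings n m = length (matchings n m)

∑-matchings : ∀ n m (g : Vec (Tuple n (suc m)) n → ℕ) →
  ∑ (matchings n (suc m)) g ≡ ∑[ π ∈ perms n ] ∑[ W ∈ matchings n m ] g (zipWith Vec._∷_ π W)
∑-matchings n m g = trans (∑-concatMap _ (perms n) g) (∑-cong (perms n) λ π → ∑-map (zipWith Vec._∷_ π) (matchings n m) g)

length-∑ : (xs : List 𝒳) → length xs ≡ ∑[ _ ∈ xs ] 1
length-∑ xs = sym (trans (∑-const xs 1) (*-identityʳ (length xs)))

#matchings-suc : ∀ n m → #matchings n (suc m) ≡ length (perms n) * #matchings n m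
#matchings-suc n m = trans (length-∑ (matchings n (suc m))) (trans (∑-matchings n m _)
  (trans (∑-cong (perms n) λ _ → sym (length-∑ (matchings n m))) (∑-const (perms n) _)))

#matchings-pos : ∀ n m → 1 ≤ #matchings n m
#matchings-pos n zero = ≤-refl
#matchings-pos n (suc m) rewrite #matchings-suc n m = *-mono-≤ (perms-nonempty n) (#matchings-pos n m)

lookup-zip∷ : ∀ {n m r} (π : Vec (Fin n) r) (W : Vec (Tuple n m) r) i →
  lookup (zipWith Vec._∷_ π W) i ≡ lookup π i ∷ lookup W i
lookup-zip∷ π W i = lookup-zipWith Vec._∷_ i π W

zip∷-∘ᵥ : ∀ {n m} (π : Vec (Fin n) n) (W : Vec (Tuple n m) n) ρ → zipWith Vec._∷_ π W ∘ᵥ ρ ≡ zipWith Vec._∷_ (π ∘ᵥ ρ) (W ∘ᵥ ρ)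
zip∷-∘ᵥ π W ρ = vec-ext λ i → begin
  lookup (zipWith Vec._∷_ π W ∘ᵥ ρ) i ≡⟨ lookup-∘ᵥ (zipWith Vec._∷_ π W) ρ i ⟩
  lookup (zipWith Vec._∷_ π W) (lookup ρ i) ≡⟨ lookup-zip∷ π W (lookup ρ i) ⟩
  lookup π (lookup ρ i) ∷ lookup W (lookup ρ i) ≡⟨ sym (cong₂ _∷_ (lookup-∘ᵥ π ρ i) (lookup-∘ᵥ W ρ i)) ⟩
  lookup (π ∘ᵥ ρ) i ∷ lookup (W ∘ᵥ ρ) i ≡⟨ sym (lookup-zip∷ (π ∘ᵥ ρ) (W ∘ᵥ ρ) i) ⟩
  lookup (zipWith Vec._∷_ (π ∘ᵥ ρ) (W ∘ᵥ ρ)) i ∎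
  where open ≡-Reasoning

-- Renumbering the tuples composes every column with the same permutation, and each column ranges
-- over all of `perms n`.
∑-matchings-∘ᵥ : ∀ {n} m {ρ : Vec (Fin n) n} → Inj ρ → (g : Vec (Tuple n m) n → ℕ) →
  ∑[ W ∈ matchings n m ] g (W ∘ᵥ ρ) ≡ ∑ (matchings n m) g
∑-matchings-∘ᵥ {n} zero {ρ} h g = cong (λ V → g V + 0) (vec-ext λ i → trans (lookup-∘ᵥ (replicate n []) ρ i)
  (trans (lookup-replicate (lookup ρ i) []) (sym (lookup-replicate i []))))
∑-matchings-∘ᵥ {n} (suc m) {ρ} h g = begin
  (∑[ W ∈ matchings n (suc m) ] g (W ∘ᵥ ρ)) ≡⟨ ∑-matchings n m _ ⟩
  (∑[ π ∈ perms n ] ∑[ W ∈ matchings n m ] g (zipWith Vec._∷_ π W ∘ᵥ ρ))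
    ≡⟨ ∑-cong (perms n) (λ π → trans (∑-cong (matchings n m) λ W → cong g (zip∷-∘ᵥ π W ρ)) (∑-matchings-∘ᵥ m h (λ W → g (zipWith Vec._∷_ (π ∘ᵥ ρ) W)))) ⟩
  (∑[ π ∈ perms n ] ∑[ W ∈ matchings n m ] g (zipWith Vec._∷_ (π ∘ᵥ ρ) W))
    ≡⟨ ∑-perms-∘ᵥ h (λ π → ∑[ W ∈ matchings n m ] g (zipWith Vec._∷_ π W)) ⟩
  (∑[ π ∈ perms n ] ∑[ W ∈ matchings n m ] g (zipWith Vec._∷_ π W)) ≡⟨ sym (∑-matchings n m g) ⟩
  ∑ (matchings n (suc m)) g ∎
  where open ≡-Reasoning

∑-tuples-insertAt : ∀ n m (i : Fin (suc m)) (g : Tuple n (suc m) → ℕ) →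
  ∑ (allTuples n (suc m)) g ≡ ∑[ a ∈ allFin n ] ∑[ w ∈ allTuples n m ] g (insertAt w i a)
∑-tuples-insertAt n m zero g = ∑-tuples n m g
∑-tuples-insertAt n (suc m) (suc i) g = begin
  ∑ (allTuples n (suc (suc m))) g ≡⟨ ∑-tuples n (suc m) g ⟩
  (∑[ c ∈ allFin n ] ∑[ v ∈ allTuples n (suc m) ] g (c ∷ v))
    ≡⟨ ∑-cong (allFin n) (λ c → ∑-tuples-insertAt n m i (g ∘ (c ∷_))) ⟩
  (∑[ c ∈ allFin n ] ∑[ a ∈ allFin n ] ∑[ w ∈ allTuples n m ] g (c ∷ insertAt w i a))
    ≡⟨ ∑-swap (allFin n) (allFin n) _ ⟩
  (∑[ a ∈ allFin n ] ∑[ c ∈ allFin n ] ∑[ w ∈ allTuples n m ] g (c ∷ insertAt w i a))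
    ≡⟨ ∑-cong (allFin n) (λ a → sym (∑-tuples n m _)) ⟩
  (∑[ a ∈ allFin n ] ∑[ w ∈ allTuples n (suc m) ] g (insertAt w (suc i) a)) ∎
  where open ≡-Reasoning

insertRow : ∀ {n m} → Fin (suc m) → Fin n → Tuple n m → Tuple n (suc m)
insertRow i a w = insertAt w i a

-- The columns are chosen independently, so any of them may be drawn first.
∑-matchings-insertAt : ∀ n m (i : Fin (suc m)) (g : Vec (Tuple n (suc m)) n → ℕ) →
  ∑ (matchings n (suc m)) g ≡ ∑[ π ∈ perms n ] ∑[ W ∈ matchings n m ] g (zipWith (insertRow i) π W)
∑-matchings-insertAt n m zero g = ∑-matchings n m g
∑-matchings-insertAt n (suc m) (suc i) g = begin
  ∑ (matchings n (suc (suc m))) g ≡⟨ ∑-matchings n (suc m) g ⟩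
  (∑[ σ ∈ perms n ] ∑[ V ∈ matchings n (suc m) ] g (zipWith Vec._∷_ σ V))
    ≡⟨ ∑-cong (perms n) (λ σ → ∑-matchings-insertAt n m i (g ∘ zipWith Vec._∷_ σ)) ⟩
  (∑[ σ ∈ perms n ] ∑[ π ∈ perms n ] ∑[ W ∈ matchings n m ] g (zipWith Vec._∷_ σ (zipWith (insertRow i) π W)))
    ≡⟨ ∑-swap (perms n) (perms n) _ ⟩
  (∑[ π ∈ perms n ] ∑[ σ ∈ perms n ] ∑[ W ∈ matchings n m ] g (zipWith Vec._∷_ σ (zipWith (insertRow i) π W)))
    ≡⟨ ∑-cong (perms n) (λ π → trans (∑-cong (perms n) λ σ → ∑-cong (matchings n m) λ W → cong g (rows π σ W)) (sym (∑-matchings n m _))) ⟩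
  (∑[ π ∈ perms n ] ∑[ W ∈ matchings n (suc m) ] g (zipWith (insertRow (suc i)) π W)) ∎
  where
  open ≡-Reasoning
  rows : ∀ {r} (π σ : Vec (Fin n) r) (W : Vec (Tuple n m) r) →
    zipWith Vec._∷_ σ (zipWith (insertRow i) π W) ≡ zipWith (insertRow (suc i)) π (zipWith Vec._∷_ σ W)
  rows [] [] [] = refl
  rows (p ∷ π) (s ∷ σ) (w ∷ W) = cong (_ ∷_) (rows π σ W)

-- The quadratic form of the disjointness graph. The recursion exhibits this graph on `[n]^m` as the
-- m-fold tensor power of the complete graph on n vertices.
∑ᵈ : ∀ n m → (Tuple n m → Tuple n m → ℕ) → ℕ
∑ᵈ n zero g = g [] []
∑ᵈ n (suc m) g = ∑² n λ a b → ∑ᵈ n m λ x y → g (a ∷ x) (b ∷ y)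

∑²-cong : ∀ n {g h : Fin n → Fin n → ℕ} → (∀ a b → g a b ≡ h a b) → ∑² n g ≡ ∑² n h
∑²-cong n e = ∑-cong (allFin n) λ a → ∑-cong (allFin n) λ b → cong (𝟙 (ne a b) *_) (e a b)

∑²-mono : ∀ n {g h : Fin n → Fin n → ℕ} → (∀ a b → g a b ≤ h a b) → ∑² n g ≤ ∑² n h
∑²-mono n e = ∑-mono (allFin n) λ a → ∑-mono (allFin n) λ b → *-monoʳ-≤ (𝟙 (ne a b)) (e a b)

∑²-+ : ∀ n (g h : Fin n → Fin n → ℕ) → ∑² n (λ a b → g a b + h a b) ≡ ∑² n g + ∑² n h
∑²-+ n g h = trans (∑-cong (allFin n) λ a → trans (∑-cong (allFin n) λ b → *-distribˡ-+ (𝟙 (ne a b)) (g a b) (h a b))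
  (∑-+ (allFin n) _ _)) (∑-+ (allFin n) _ _)

∑²-*ˡ : ∀ n c (g : Fin n → Fin n → ℕ) → ∑² n (λ a b → c * g a b) ≡ c * ∑² n g
∑²-*ˡ n c g = trans (∑-cong (allFin n) λ a → trans (∑-cong (allFin n) λ b → comm (𝟙 (ne a b)) c (g a b))
  (∑-*ˡ (allFin n) c _)) (∑-*ˡ (allFin n) c _)
  where
  comm : ∀ x y z → x * (y * z) ≡ y * (x * z)
  comm = solve-∀

∑²-sym : ∀ n (g : Fin n → Fin n → ℕ) → ∑² n g ≡ ∑² n (λ a b → g b a)
∑²-sym n g = trans (∑-swap (allFin n) (allFin n) _) (∑-cong (allFin n) λ b → ∑-cong (allFin n) λ a → cong (λ t → 𝟙 t * g a b) (ne-sym a b))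

∑²-∑ : ∀ n (xs : List 𝒳) (g : 𝒳 → Fin n → Fin n → ℕ) → ∑² n (λ a b → ∑[ x ∈ xs ] g x a b) ≡ ∑[ x ∈ xs ] ∑² n (g x)
∑²-∑ n xs g = trans (∑-cong (allFin n) λ a → trans (∑-cong (allFin n) λ b → sym (∑-*ˡ xs (𝟙 (ne a b)) _)) (∑-swap (allFin n) xs _))
  (∑-swap (allFin n) xs _)

∑ᵈ-cong : ∀ n m {g h : Tuple n m → Tuple n m → ℕ} → (∀ x y → g x y ≡ h x y) → ∑ᵈ n m g ≡ ∑ᵈ n m h
∑ᵈ-cong n zero e = e [] []
∑ᵈ-cong n (suc m) e = ∑²-cong n λ a b → ∑ᵈ-cong n m λ x y → e (a ∷ x) (b ∷ y)

∑ᵈ-mono : ∀ n m {g h : Tuple n m → Tuple n m → ℕ} → (∀ x y → g x y ≤ h x y) → ∑ᵈ n m g ≤ ∑ᵈ n m h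
∑ᵈ-mono n zero e = e [] []
∑ᵈ-mono n (suc m) e = ∑²-mono n λ a b → ∑ᵈ-mono n m λ x y → e (a ∷ x) (b ∷ y)

∑ᵈ-+ : ∀ n m (g h : Tuple n m → Tuple n m → ℕ) → ∑ᵈ n m (λ x y → g x y + h x y) ≡ ∑ᵈ n m g + ∑ᵈ n m h
∑ᵈ-+ n zero g h = refl
∑ᵈ-+ n (suc m) g h = trans (∑²-cong n λ a b → ∑ᵈ-+ n m _ _) (∑²-+ n _ _)

∑ᵈ-*ˡ : ∀ n m c (g : Tuple n m → Tuple n m → ℕ) → ∑ᵈ n m (λ x y → c * g x y) ≡ c * ∑ᵈ n m g
∑ᵈ-*ˡ n zero c g = refl
∑ᵈ-*ˡ n (suc m) c g = trans (∑²-cong n λ a b → ∑ᵈ-*ˡ n m c _) (∑²-*ˡ n c _)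

∑ᵈ-sym : ∀ n m (g : Tuple n m → Tuple n m → ℕ) → ∑ᵈ n m g ≡ ∑ᵈ n m (λ x y → g y x)
∑ᵈ-sym n zero g = refl
∑ᵈ-sym n (suc m) g = trans (∑²-cong n λ a b → ∑ᵈ-sym n m _) (∑²-sym n _)

∑ᵈ-∑ : ∀ n m (xs : List 𝒳) (g : 𝒳 → Tuple n m → Tuple n m → ℕ) → ∑ᵈ n m (λ x y → ∑[ c ∈ xs ] g c x y) ≡ ∑[ c ∈ xs ] ∑ᵈ n m (g c)
∑ᵈ-∑ n zero xs g = refl
∑ᵈ-∑ n (suc m) xs g = trans (∑²-cong n λ a b → ∑ᵈ-∑ n m xs _) (∑²-∑ n xs _)

-- Regularity of the disjointness graph: every tuple is disjoint from `(n ∸ 1) ^ m` others.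
∑ᵈ-left : ∀ n m (φ : Tuple n m → ℕ) → ∑ᵈ n m (λ x _ → φ x) ≡ (n ∸ 1) ^ m * ∑ (allTuples n m) φ
∑ᵈ-left n zero φ = sym (trans (+-identityʳ _) (+-identityʳ _))
∑ᵈ-left n (suc m) φ = begin
  ∑² n (λ a b → ∑ᵈ n m λ x _ → φ (a ∷ x)) ≡⟨ ∑-cong (allFin n) (λ a → ∑-ne-const a _) ⟩
  (∑[ a ∈ allFin n ] (n ∸ 1) * ∑ᵈ n m (λ x _ → φ (a ∷ x))) ≡⟨ ∑-*ˡ (allFin n) (n ∸ 1) _ ⟩
  (n ∸ 1) * (∑[ a ∈ allFin n ] ∑ᵈ n m (λ x _ → φ (a ∷ x)))
    ≡⟨ cong ((n ∸ 1) *_) (trans (∑-cong (allFin n) λ a → ∑ᵈ-left n m _) (∑-*ˡ (allFin n) ((n ∸ 1) ^ m) _)) ⟩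
  (n ∸ 1) * ((n ∸ 1) ^ m * (∑[ a ∈ allFin n ] ∑[ x ∈ allTuples n m ] φ (a ∷ x)))
    ≡⟨ sym (*-assoc (n ∸ 1) ((n ∸ 1) ^ m) _) ⟩
  (n ∸ 1) ^ suc m * (∑[ a ∈ allFin n ] ∑[ x ∈ allTuples n m ] φ (a ∷ x)) ≡⟨ cong ((n ∸ 1) ^ suc m *_) (sym (∑-tuples n m φ)) ⟩
  (n ∸ 1) ^ suc m * ∑ (allTuples n (suc m)) φ ∎
  where open ≡-Reasoning

-- By `perms-pair` in every column, and independence of the columns, two rows of a random matching
-- form a uniform disjoint pair. This links matchings to the disjointness graph.
matchings-pair : ∀ {n} m {i i′ : Fin n} → i ≢ i′ → (g : Tuple n m → Tuple n m → ℕ) →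
  n ^ m * (n ∸ 1) ^ m * (∑[ W ∈ matchings n m ] g (lookup W i) (lookup W i′)) ≡ #matchings n m * ∑ᵈ n m g
matchings-pair {n} zero {i} {i′} i≢ g rewrite lookup-replicate {n = n} i (Vec.[] {A = Fin n}) | lookup-replicate {n = n} i′ (Vec.[] {A = Fin n}) = cong (_+ 0) (+-identityʳ (g [] []))
matchings-pair {n} (suc m) {i} {i′} i≢ g = begin
  n ^ suc m * (n ∸ 1) ^ suc m * (∑[ V ∈ matchings n (suc m) ] g (lookup V i) (lookup V i′))
    ≡⟨ cong (n ^ suc m * (n ∸ 1) ^ suc m *_) (trans (∑-matchings n m _) (∑-cong (perms n) λ π → ∑-cong (matchings n m) λ W →
         cong₂ g (lookup-zip∷ π W i) (lookup-zip∷ π W i′))) ⟩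
  n * n ^ m * ((n ∸ 1) * (n ∸ 1) ^ m) * (∑[ π ∈ perms n ] S (lookup π i) (lookup π i′))
    ≡⟨ regroup n (n ^ m) (n ∸ 1) ((n ∸ 1) ^ m) _ ⟩
  n * (n ∸ 1) * (n ^ m * (n ∸ 1) ^ m * (∑[ π ∈ perms n ] S (lookup π i) (lookup π i′)))
    ≡⟨ cong (n * (n ∸ 1) *_) (trans (sym (∑-*ˡ (perms n) (n ^ m * (n ∸ 1) ^ m) (λ π → S (lookup π i) (lookup π i′)))) (∑-cong (perms n) λ π → matchings-pair m i≢ (λ x y → g (lookup π i ∷ x) (lookup π i′ ∷ y)))) ⟩
  n * (n ∸ 1) * (∑[ π ∈ perms n ] #matchings n m * D (lookup π i) (lookup π i′))
    ≡⟨ perms-pair i≢ (λ a b → #matchings n m * D a b) ⟩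
  length (perms n) * ∑² n (λ a b → #matchings n m * D a b)
    ≡⟨ cong (length (perms n) *_) (∑²-*ˡ n (#matchings n m) D) ⟩
  length (perms n) * (#matchings n m * ∑² n D)
    ≡⟨ trans (sym (*-assoc (length (perms n)) _ _)) (cong (_* ∑² n D) (sym (#matchings-suc n m))) ⟩
  #matchings n (suc m) * ∑ᵈ n (suc m) g ∎
  where
  open ≡-Reasoning
  S D : Fin n → Fin n → ℕ
  S a b = ∑[ W ∈ matchings n m ] g (a ∷ lookup W i) (b ∷ lookup W i′)
  D a b = ∑ᵈ n m λ x y → g (a ∷ x) (b ∷ y)
  regroup : ∀ a b c d e → a * b * (c * d) * e ≡ a * c * (b * d * e)
  regroup = solve-∀

another : ∀ {n} → 2 ≤ n → (i : Fin n) → ∃ λ j → i ≢ j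
another (s≤s (s≤s _)) zero = suc zero , λ ()
another (s≤s (s≤s _)) (suc i) = zero , λ ()

-- The marginal of `matchings-pair`, which is why a second row, hence `2 ≤ n`, is wanted.
matchings-single : ∀ {n} m → 2 ≤ n → (i : Fin n) (g : Tuple n m → ℕ) →
  n ^ m * (∑[ W ∈ matchings n m ] g (lookup W i)) ≡ #matchings n m * ∑ (allTuples n m) g
matchings-single {n@(suc (suc n′))} m 2≤n@(s≤s (s≤s _)) i g with another 2≤n i
... | j , i≢j = *-cancelˡ-≡ _ _ ((n ∸ 1) ^ m) {{m^n≢0 (n ∸ 1) m}} (begin
  (n ∸ 1) ^ m * (n ^ m * S) ≡⟨ regroup ((n ∸ 1) ^ m) (n ^ m) S ⟩
  n ^ m * (n ∸ 1) ^ m * S ≡⟨ matchings-pair m i≢j (λ x _ → g x) ⟩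
  #matchings n m * ∑ᵈ n m (λ x _ → g x) ≡⟨ cong (#matchings n m *_) (∑ᵈ-left n m g) ⟩
  #matchings n m * ((n ∸ 1) ^ m * ∑ (allTuples n m) g) ≡⟨ comm (#matchings n m) ((n ∸ 1) ^ m) _ ⟩
  (n ∸ 1) ^ m * (#matchings n m * ∑ (allTuples n m) g) ∎)
  where
  open ≡-Reasoning
  S = ∑[ W ∈ matchings n m ] g (lookup W i)
  regroup : ∀ a b c → a * (b * c) ≡ b * a * c
  regroup = solve-∀
  comm : ∀ x y z → x * (y * z) ≡ y * (x * z)
  comm = solve-∀

-- Expansion of the disjointness graph

2xy≤x²+y² : ∀ x y → 2 * (x * y) ≤ x * x + y * y
2xy≤x²+y² x y with ≤-total x y
... | inj₁ x≤y = subst (λ z → 2 * (x * z) ≤ x * x + z * z) (m+[n∸m]≡n x≤y) (ordered x (y ∸ x))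
  where
  expand : ∀ x d → 2 * (x * (x + d)) + d * d ≡ x * x + (x + d) * (x + d)
  expand = solve-∀
  ordered : ∀ x d → 2 * (x * (x + d)) ≤ x * x + (x + d) * (x + d)
  ordered x d = subst (2 * (x * (x + d)) ≤_) (expand x d) (m≤m+n _ (d * d))
... | inj₂ y≤x = subst (λ z → 2 * (z * y) ≤ z * z + y * y) (m+[n∸m]≡n y≤x) (ordered y (x ∸ y))
  where
  expand : ∀ y d → 2 * ((y + d) * y) + d * d ≡ (y + d) * (y + d) + y * y
  expand = solve-∀
  ordered : ∀ y d → 2 * ((y + d) * y) ≤ (y + d) * (y + d) + y * y
  ordered y d = subst (2 * ((y + d) * y) ≤_) (expand y d) (m≤m+n _ (d * d))

∑-cauchy-schwarz : (xs : List 𝒳) (t : 𝒳 → ℕ) → ∑ xs t * ∑ xs t ≤ length xs * (∑[ x ∈ xs ] t x * t x)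
∑-cauchy-schwarz xs t = *-cancelˡ-≤ 2 (begin
  2 * (∑ xs t * ∑ xs t) ≡⟨ cong (2 *_) (∑-product xs xs t t) ⟩
  2 * (∑[ x ∈ xs ] ∑[ y ∈ xs ] t x * t y) ≡⟨ sym (trans (∑-cong xs λ x → ∑-*ˡ xs 2 _) (∑-*ˡ xs 2 _)) ⟩
  (∑[ x ∈ xs ] ∑[ y ∈ xs ] 2 * (t x * t y)) ≤⟨ ∑-mono xs (λ x → ∑-mono xs λ y → 2xy≤x²+y² (t x) (t y)) ⟩
  (∑[ x ∈ xs ] ∑[ y ∈ xs ] (t x * t x + t y * t y))
    ≡⟨ ∑-cong xs (λ x → trans (∑-+ xs _ _) (cong (_+ S) (∑-const xs _))) ⟩
  (∑[ x ∈ xs ] (length xs * (t x * t x) + S)) ≡⟨ trans (∑-+ xs _ _) (cong₂ _+_ (∑-*ˡ xs (length xs) _) (∑-const xs S)) ⟩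
  length xs * S + length xs * S ≡⟨ double (length xs * S) ⟩
  2 * (length xs * S) ∎)
  where
  open ≤-Reasoning
  S = ∑[ x ∈ xs ] t x * t x
  double : ∀ a → a + a ≡ 2 * a
  double = solve-∀

-- Equivalently: the normalised adjacency operator of the disjointness graph on [n]^m has all eigenvalues
-- other than 1 at most 1/(n-1).
disjoint-form : ∀ {n} → 2 ≤ n → ∀ m (φ : Tuple n m → ℕ) → let Tm = allTuples n m in
  n ^ m * (n ∸ 1) * ∑ᵈ n m (λ x y → φ x * φ y) ≤ (n ∸ 1) ^ m * ((n ∸ 2) * (∑ Tm φ * ∑ Tm φ) + n ^ m * (∑[ x ∈ Tm ] φ x * φ x))
disjoint-form 2≤n zero φ = ≤-reflexive (base 2≤n (φ []))
  where
  base : ∀ {n} → 2 ≤ n → ∀ a → 1 * (n ∸ 1) * (a * a) ≡ 1 * ((n ∸ 2) * ((a + 0) * (a + 0)) + 1 * (a * a + 0))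
  base {suc (suc r)} (s≤s (s≤s _)) a = ring r a
    where
    ring : ∀ r a → 1 * (1 + r) * (a * a) ≡ 1 * (r * ((a + 0) * (a + 0)) + 1 * (a * a + 0))
    ring = solve-∀
disjoint-form {n} 2≤n (suc m) φ = subst₂≤ (combine 2≤n (n ^ m) E (∑ Tm s) (sumsq s) Φ diag (∑ᵈ n (suc m) (λ x y → φ x * φ y)) split convex (disjoint-form 2≤n m s))
  where
  Tm = allTuples n m
  Cs = allFin n
  E = (n ∸ 1) ^ m
  s : Tuple n m → ℕ
  s x = ∑[ c ∈ Cs ] φ (c ∷ x)
  Q : (Tuple n m → ℕ) → (Tuple n m → ℕ) → ℕ
  Q f g = ∑ᵈ n m λ x y → f x * g y
  φ′ : Fin n → Tuple n m → ℕ
  φ′ c x = φ (c ∷ x)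
  sumsq : (Tuple n m → ℕ) → ℕ
  sumsq f = ∑[ x ∈ Tm ] f x * f x
  diag = ∑[ c ∈ Cs ] Q (φ′ c) (φ′ c)
  Φ = ∑[ c ∈ Cs ] sumsq (φ′ c)

  -- In the first coordinate the adjacency matrix is all ones minus the identity. The all-ones part
  -- sees only the sums `s`; the identity contributes `diag` with a negative sign, so `diag` has to
  -- be bounded from below.
  split : ∑ᵈ n (suc m) (λ x y → φ x * φ y) + diag ≡ Q s s
  split = sym (begin
    Q s s ≡⟨ ∑ᵈ-cong n m (λ x y → ∑-product Cs Cs (λ c → φ (c ∷ x)) (λ c → φ (c ∷ y))) ⟩
    ∑ᵈ n m (λ x y → ∑[ c ∈ Cs ] ∑[ d ∈ Cs ] φ (c ∷ x) * φ (d ∷ y))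
      ≡⟨ trans (∑ᵈ-∑ n m Cs _) (∑-cong Cs λ c → ∑ᵈ-∑ n m Cs _) ⟩
    (∑[ c ∈ Cs ] ∑[ d ∈ Cs ] Q (φ′ c) (φ′ d)) ≡⟨ ∑-cong Cs (λ c → sym (∑-Fin-ne c (λ d → Q (φ′ c) (φ′ d)))) ⟩
    (∑[ c ∈ Cs ] ((∑[ d ∈ Cs ] 𝟙 (ne c d) * Q (φ′ c) (φ′ d)) + Q (φ′ c) (φ′ c))) ≡⟨ ∑-+ Cs _ _ ⟩
    ∑ᵈ n (suc m) (λ x y → φ x * φ y) + diag ∎)
    where open ≡-Reasoning

  square : ∀ (f : Tuple n m → ℕ) → ∑ᵈ n m (λ x y → (f x + f y) * (f x + f y)) ≡ 2 * (E * sumsq f + Q f f)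
  square f = begin
    ∑ᵈ n m (λ x y → (f x + f y) * (f x + f y)) ≡⟨ ∑ᵈ-cong n m (λ x y → expand (f x) (f y)) ⟩
    ∑ᵈ n m (λ x y → f x * f x + (f y * f y + 2 * (f x * f y)))
      ≡⟨ trans (∑ᵈ-+ n m _ _) (cong (∑ᵈ n m (λ x y → f x * f x) +_) (∑ᵈ-+ n m _ _)) ⟩
    ∑ᵈ n m (λ x y → f x * f x) + (∑ᵈ n m (λ x y → f y * f y) + ∑ᵈ n m (λ x y → 2 * (f x * f y)))
      ≡⟨ cong₂ _+_ left (cong₂ _+_ (trans (∑ᵈ-sym n m _) left) (∑ᵈ-*ˡ n m 2 _)) ⟩
    E * sumsq f + (E * sumsq f + 2 * Q f f) ≡⟨ collect (E * sumsq f) (Q f f) ⟩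
    2 * (E * sumsq f + Q f f) ∎
    where
    open ≡-Reasoning
    left : ∑ᵈ n m (λ x y → f x * f x) ≡ E * sumsq f
    left = ∑ᵈ-left n m (λ x → f x * f x)
    expand : ∀ a b → (a + b) * (a + b) ≡ a * a + (b * b + 2 * (a * b))
    expand = solve-∀
    collect : ∀ a b → a + (a + 2 * b) ≡ 2 * (a + b)
    collect = solve-∀

  -- By `square`, `E * sumsq f + Q f f` is half a sum of squares over disjoint pairs. Cauchy-Schwarz
  -- compares its value at `s`, a sum of n slices, with its values at the slices, and this is the
  -- lower bound for `diag`.
  convex : E * sumsq s + Q s s ≤ n * (E * Φ + diag)
  convex = *-cancelˡ-≤ 2 (begin
    2 * (E * sumsq s + Q s s) ≡⟨ sym (square s) ⟩
    ∑ᵈ n m (λ x y → (s x + s y) * (s x + s y))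
      ≤⟨ ∑ᵈ-mono n m (λ x y → subst₂ (λ a b → a * a ≤ b * ∑ Cs (λ c → (φ (c ∷ x) + φ (c ∷ y)) * (φ (c ∷ x) + φ (c ∷ y)))) (∑-+ Cs (λ c → φ (c ∷ x)) (λ c → φ (c ∷ y))) (length-allFin n)
           (∑-cauchy-schwarz Cs λ c → φ (c ∷ x) + φ (c ∷ y))) ⟩
    ∑ᵈ n m (λ x y → n * (∑[ c ∈ Cs ] (φ (c ∷ x) + φ (c ∷ y)) * (φ (c ∷ x) + φ (c ∷ y))))
      ≡⟨ trans (∑ᵈ-*ˡ n m n _) (cong (n *_) (∑ᵈ-∑ n m Cs _)) ⟩
    n * (∑[ c ∈ Cs ] ∑ᵈ n m (λ x y → (φ′ c x + φ′ c y) * (φ′ c x + φ′ c y)))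
      ≡⟨ cong (n *_) (∑-cong Cs λ c → square (φ′ c)) ⟩
    n * (∑[ c ∈ Cs ] 2 * (E * sumsq (φ′ c) + Q (φ′ c) (φ′ c)))
      ≡⟨ cong (n *_) (trans (∑-*ˡ Cs 2 _) (cong (2 *_) (trans (∑-+ Cs _ _) (cong (_+ diag) (∑-*ˡ Cs E _))))) ⟩
    n * (2 * (E * Φ + diag)) ≡⟨ comm n 2 _ ⟩
    2 * (n * (E * Φ + diag)) ∎)
    where
    open ≤-Reasoning
    comm : ∀ x y z → x * (y * z) ≡ y * (x * z)
    comm = solve-∀

  -- The terms in `S₂` coming from `convex` and from the induction hypothesis cancel exactly, so the
  -- constant does not deteriorate with `m`. The summands added on both sides replace subtraction.
  combine : ∀ {n} → 2 ≤ n → ∀ L E σ S₂ Φ D q′ {q} → q′ + D ≡ q → E * S₂ + q ≤ n * (E * Φ + D) →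
    L * (n ∸ 1) * q ≤ E * ((n ∸ 2) * (σ * σ) + L * S₂) →
    n * L * (n ∸ 1) * q′ ≤ (n ∸ 1) * E * ((n ∸ 2) * (σ * σ) + n * L * Φ)
  combine {suc (suc r)} (s≤s (s≤s _)) L E σ S₂ Φ D q′ refl conv ih = +-cancelʳ-≤ (L * (1 + r) * (E * S₂ + ((2 + r) * D + (q′ + D))) + (1 + r) * (L * (1 + r) * (q′ + D))) _ _ (begin
    (2 + r) * L * (1 + r) * q′ + (L * (1 + r) * (E * S₂ + ((2 + r) * D + (q′ + D))) + (1 + r) * (L * (1 + r) * (q′ + D)))
      ≡⟨ lhs r L E S₂ D q′ ⟩
    L * (1 + r) * (E * S₂ + (q′ + D)) + (1 + r) * (L * (1 + r) * (q′ + D)) + L * (1 + r) * ((2 + r) * (q′ + D))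
      ≤⟨ +-monoˡ-≤ _ (+-mono-≤ (*-monoʳ-≤ (L * (1 + r)) conv) (*-monoʳ-≤ (1 + r) ih)) ⟩
    L * (1 + r) * ((2 + r) * (E * Φ + D)) + (1 + r) * (E * (r * (σ * σ) + L * S₂)) + L * (1 + r) * ((2 + r) * (q′ + D))
      ≡⟨ rhs r L E σ S₂ Φ D q′ ⟩
    (1 + r) * E * (r * (σ * σ) + (2 + r) * L * Φ) + (L * (1 + r) * (E * S₂ + ((2 + r) * D + (q′ + D))) + (1 + r) * (L * (1 + r) * (q′ + D))) ∎)
    where
    open ≤-Reasoning
    lhs : ∀ r L E S₂ D q′ →
      (2 + r) * L * (1 + r) * q′ + (L * (1 + r) * (E * S₂ + ((2 + r) * D + (q′ + D))) + (1 + r) * (L * (1 + r) * (q′ + D)))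
      ≡ L * (1 + r) * (E * S₂ + (q′ + D)) + (1 + r) * (L * (1 + r) * (q′ + D)) + L * (1 + r) * ((2 + r) * (q′ + D))
    lhs = solve-∀
    rhs : ∀ r L E σ S₂ Φ D q′ →
      L * (1 + r) * ((2 + r) * (E * Φ + D)) + (1 + r) * (E * (r * (σ * σ) + L * S₂)) + L * (1 + r) * ((2 + r) * (q′ + D))
      ≡ (1 + r) * E * (r * (σ * σ) + (2 + r) * L * Φ) + (L * (1 + r) * (E * S₂ + ((2 + r) * D + (q′ + D))) + (1 + r) * (L * (1 + r) * (q′ + D)))
    rhs = solve-∀

  subst₂≤ : let q = ∑ᵈ n (suc m) (λ x y → φ x * φ y) in
    n * n ^ m * (n ∸ 1) * q ≤ (n ∸ 1) * E * ((n ∸ 2) * (∑ Tm s * ∑ Tm s) + n * n ^ m * Φ) →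
    n ^ suc m * (n ∸ 1) * q ≤ (n ∸ 1) ^ suc m * ((n ∸ 2) * (∑ (allTuples n (suc m)) φ * ∑ (allTuples n (suc m)) φ) + n ^ suc m * (∑[ x ∈ allTuples n (suc m) ] φ x * φ x))
  subst₂≤ h rewrite ∑-tuples n m φ | ∑-tuples n m (λ x → φ x * φ x) | ∑-swap Tm Cs (λ x c → φ (c ∷ x)) = h

-- `disjoint-form` for the indicator of one side bounds the pairs inside that side; by regularity
-- these and the pairs leaving it make up `E * α`.
disjoint-cut : ∀ {n} → 2 ≤ n → ∀ m (a : Tuple n m → Bool) → let Tm = allTuples n m in
  (n ∸ 2) * (n ∸ 1) ^ m * ((∑[ x ∈ Tm ] 𝟙 (a x)) * (∑[ x ∈ Tm ] 𝟙 (not (a x)))) ≤ n ^ m * (n ∸ 1) * ∑ᵈ n m (λ x y → 𝟙 (a x) * 𝟙 (not (a y)))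
disjoint-cut {n} 2≤n m a = combine 2≤n (n ^ m) E α β e Q total cut (subst (λ z → n ^ m * (n ∸ 1) * Q ≤ E * ((n ∸ 2) * (α * α) + n ^ m * z)) (∑-cong Tm λ x → idem (a x)) (disjoint-form 2≤n m (𝟙 ∘ a)))
  where
  Tm = allTuples n m
  E = (n ∸ 1) ^ m
  α = ∑[ x ∈ Tm ] 𝟙 (a x)
  β = ∑[ x ∈ Tm ] 𝟙 (not (a x))
  e = ∑ᵈ n m (λ x y → 𝟙 (a x) * 𝟙 (not (a y)))
  Q = ∑ᵈ n m (λ x y → 𝟙 (a x) * 𝟙 (a y))
  idem : ∀ b → 𝟙 b * 𝟙 b ≡ 𝟙 b
  idem true = refl
  idem false = refl
  total : α + β ≡ n ^ m
  total = trans (sym (∑-+ Tm _ _)) (trans (∑-cong Tm λ x → 𝟙-not (a x)) (trans (∑-const-tuples n m 1) (*-identityʳ (n ^ m))))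
  cut : Q + e ≡ E * α
  cut = trans (sym (∑ᵈ-+ n m _ _)) (trans (∑ᵈ-cong n m λ x y → trans (sym (*-distribˡ-+ (𝟙 (a x)) _ _)) (trans (cong (𝟙 (a x) *_) (𝟙-not (a y))) (*-identityʳ _))) (∑ᵈ-left n m (𝟙 ∘ a)))
  combine : ∀ {n} → 2 ≤ n → ∀ L E α β e Q → α + β ≡ L → Q + e ≡ E * α → L * (n ∸ 1) * Q ≤ E * ((n ∸ 2) * (α * α) + L * α) →
    (n ∸ 2) * E * (α * β) ≤ L * (n ∸ 1) * e
  combine {suc (suc r)} (s≤s (s≤s _)) L E α β e Q refl cut h = +-cancelʳ-≤ (E * (r * (α * α) + (α + β) * α)) _ _ (begin
    r * E * (α * β) + E * (r * (α * α) + (α + β) * α) ≡⟨ lhs r E α β ⟩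
    (α + β) * (1 + r) * (E * α) ≡⟨ cong ((α + β) * (1 + r) *_) (sym cut) ⟩
    (α + β) * (1 + r) * (Q + e) ≡⟨ *-distribˡ-+ ((α + β) * (1 + r)) Q e ⟩
    (α + β) * (1 + r) * Q + (α + β) * (1 + r) * e ≤⟨ +-monoˡ-≤ _ h ⟩
    E * (r * (α * α) + (α + β) * α) + (α + β) * (1 + r) * e ≡⟨ +-comm _ ((α + β) * (1 + r) * e) ⟩
    (α + β) * (1 + r) * e + E * (r * (α * α) + (α + β) * α) ∎)
    where
    open ≤-Reasoning
    lhs : ∀ r E α β → r * E * (α * β) + E * (r * (α * α) + (α + β) * α) ≡ (α + β) * (1 + r) * (E * α)
    lhs = solve-∀

-- Layers of a family in one direction

xor : Bool → Bool → Bool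
xor true b = not b
xor false b = b

private
  -- 2αβN ≤ 3L²B is α(1-α) ≤ 3p/2 for densities, whose solutions are α ≤ 2p and α ≥ 1-2p when p < 1/8.
  extreme-density : ∀ α β L N B → α + β ≡ L → 2 * (α * β * N) ≤ 3 * (L * L * B) → 8 * B < N →
    N * α ≤ 2 * B * L ⊎ N * β ≤ 2 * B * L
  extreme-density α β L N B total quad small with N * α ≤? 2 * B * L | N * β ≤? 2 * B * L
  ... | yes p | _ = inj₁ p
  ... | no _ | yes q = inj₂ q
  ... | no ¬p | no ¬q = ⊥-elim (<⇒≱ above weak)
    where
    open ≤-Reasoning
    ring₁ : ∀ N α β → 2 * (N * α * (N * β)) ≡ N * (2 * (α * β * N))
    ring₁ = solve-∀
    ring₂ : ∀ N L B → N * (3 * (L * L * B)) ≡ 3 * (B * L) * (N * L)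
    ring₂ = solve-∀
    b = B * L
    x = N * α ∸ suc (2 * B * L)
    y = N * β ∸ suc (2 * B * L)
    Nα : N * α ≡ suc (2 * b + x)
    Nα = trans (sym (m+[n∸m]≡n (≰⇒> ¬p))) (cong (λ z → suc (z + x)) (*-assoc 2 B L))
    Nβ : N * β ≡ suc (2 * b + y)
    Nβ = trans (sym (m+[n∸m]≡n (≰⇒> ¬q))) (cong (λ z → suc (z + y)) (*-assoc 2 B L))
    NL : suc (2 * b + x) + suc (2 * b + y) ≡ N * L
    NL = trans (cong₂ _+_ (sym Nα) (sym Nβ)) (trans (sym (*-distribˡ-+ N α β)) (cong (N *_) total))
    weak : 2 * (suc (2 * b + x) * suc (2 * b + y)) ≤ 3 * b * (suc (2 * b + x) + suc (2 * b + y))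
    weak = begin
      2 * (suc (2 * b + x) * suc (2 * b + y)) ≡⟨ cong (2 *_) (cong₂ _*_ (sym Nα) (sym Nβ)) ⟩
      2 * (N * α * (N * β)) ≡⟨ ring₁ N α β ⟩
      N * (2 * (α * β * N)) ≤⟨ *-monoʳ-≤ N quad ⟩
      N * (3 * (L * L * B)) ≡⟨ ring₂ N L B ⟩
      3 * (B * L) * (N * L) ≡⟨ cong (3 * b *_) (sym NL) ⟩
      3 * b * (suc (2 * b + x) + suc (2 * b + y)) ∎
    8b≤ : 8 * b ≤ suc (2 * b + x) + suc (2 * b + y)
    8b≤ = begin
      8 * (B * L) ≡⟨ sym (*-assoc 8 B L) ⟩
      8 * B * L ≤⟨ *-monoˡ-≤ L (<⇒≤ small) ⟩
      N * L ≡⟨ sym NL ⟩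
      suc (2 * b + x) + suc (2 * b + y) ∎
    -- Expand (Nα - 2b)(Nβ - 2b) > 0. The resulting term 8b² is absorbed through `8b≤`, that is,
    -- through p ≤ 1/8.
    above : 3 * b * (suc (2 * b + x) + suc (2 * b + y)) < 2 * (suc (2 * b + x) * suc (2 * b + y))
    above = +-cancelʳ-< (b * (8 * b)) _ _ (begin-strict
      3 * b * (suc (2 * b + x) + suc (2 * b + y)) + b * (8 * b) ≤⟨ +-monoʳ-≤ (3 * b * (suc (2 * b + x) + suc (2 * b + y))) (*-monoʳ-≤ b 8b≤) ⟩
      3 * b * (suc (2 * b + x) + suc (2 * b + y)) + b * (suc (2 * b + x) + suc (2 * b + y)) <⟨ m<m+n _ {2 * (suc x * suc y)} (s≤s z≤n) ⟩
      3 * b * (suc (2 * b + x) + suc (2 * b + y)) + b * (suc (2 * b + x) + suc (2 * b + y)) + 2 * (suc x * suc y)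
        ≡⟨ ring b x y ⟩
      2 * (suc (2 * b + x) * suc (2 * b + y)) + b * (8 * b) ∎)
      where
      ring : ∀ b x y → 3 * b * (1 + (2 * b + x) + (1 + (2 * b + y))) + b * (1 + (2 * b + x) + (1 + (2 * b + y))) + 2 * ((1 + x) * (1 + y))
        ≡ 2 * ((1 + (2 * b + x)) * (1 + (2 * b + y))) + b * (8 * b)
      ring = solve-∀

-- The `f i` need not be slices of one family: later they are also the fibres over the rows of a
-- matching. The tuple in row `i` is tested against `f i`, and the proportion of bad matchings is
-- B/N.
module Layers {n : ℕ} (4≤n : 4 ≤ n) (m : ℕ) (f : Fin n → Tuple n m → Bool) (t : ℕ) where

  Ms = matchings n m
  Ts = allTuples n m
  N L : ℕ
  N = #matchings n m
  L = n ^ m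

  2≤n : 2 ≤ n
  2≤n = ≤-trans (s≤s (s≤s z≤n)) 4≤n

  ξ : Vec (Tuple n m) n → ℕ
  ξ V = ∑[ i ∈ allFin n ] 𝟙 (f i (lookup V i))

  bad : Vec (Tuple n m) n → Bool
  bad V = not (ξ V ≡ᵇ t)

  B : ℕ
  B = ∑[ V ∈ Ms ] 𝟙 (bad V)

  q : Fin n → ℕ
  q i = ∑[ v ∈ Ts ] 𝟙 (f i v)

  L>0 : 0 < L
  L>0 = m^n>0 n {{>-nonZero (≤-trans (s≤s z≤n) 2≤n)}} m

  bad-false : ∀ V → bad V ≡ false → ξ V ≡ t
  bad-false V e with ξ V ≡ᵇ t in eq
  ... | true = ≡ᵇ⇒≡ (ξ V) t (Equivalence.from T-≡ eq)

  -- Linearity of expectation, each row being uniform on `[n]^m`.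
  ∑ξ : L * ∑ Ms ξ ≡ N * ∑ (allFin n) q
  ∑ξ = begin
    L * ∑ Ms ξ ≡⟨ cong (L *_) (∑-swap Ms (allFin n) _) ⟩
    L * (∑[ i ∈ allFin n ] ∑[ V ∈ Ms ] 𝟙 (f i (lookup V i))) ≡⟨ sym (∑-*ˡ (allFin n) L _) ⟩
    (∑[ i ∈ allFin n ] L * (∑[ V ∈ Ms ] 𝟙 (f i (lookup V i)))) ≡⟨ ∑-cong (allFin n) (λ i → matchings-single m 2≤n i (𝟙 ∘ f i)) ⟩
    (∑[ i ∈ allFin n ] N * q i) ≡⟨ ∑-*ˡ (allFin n) N q ⟩
    N * ∑ (allFin n) q ∎
    where open ≡-Reasoning

  ξ≤n : ∀ V → ξ V ≤ n
  ξ≤n V = begin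
    ξ V ≤⟨ ∑-mono (allFin n) (λ i → 𝟙≤1 (f i (lookup V i))) ⟩
    (∑[ _ ∈ allFin n ] 1) ≡⟨ trans (∑-const-Fin n 1) (*-identityʳ n) ⟩
    n ∎
    where open ≤-Reasoning

  private
    affine-sum : ∀ c → ∑[ V ∈ Ms ] (c + n * 𝟙 (bad V)) ≡ N * c + n * B
    affine-sum c = trans (∑-+ Ms _ _) (cong₂ _+_ (∑-const Ms c) (∑-*ˡ Ms n _))

  -- A good matching has `ξ` equal to `t`, and a bad one exceeds it by at most `n`; so the mean of
  -- `ξ` is at most t + np. The bound from below is its mirror image.
  ∑q-≤ : N * ∑ (allFin n) q ≤ N * (t * L) + n * (B * L)
  ∑q-≤ = begin
    N * ∑ (allFin n) q ≡⟨ sym ∑ξ ⟩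
    L * ∑ Ms ξ ≤⟨ *-monoʳ-≤ L (∑-mono Ms dev) ⟩
    L * (∑[ V ∈ Ms ] (t + n * 𝟙 (bad V))) ≡⟨ cong (L *_) (affine-sum t) ⟩
    L * (N * t + n * B) ≡⟨ ring L N t n B ⟩
    N * (t * L) + n * (B * L) ∎
    where
    open ≤-Reasoning
    ring : ∀ L N t n B → L * (N * t + n * B) ≡ N * (t * L) + n * (B * L)
    ring = solve-∀
    dev : ∀ V → ξ V ≤ t + n * 𝟙 (bad V)
    dev V with bad V in eq
    ... | true = ≤-trans (ξ≤n V) (≤-trans (≤-reflexive (sym (*-identityʳ n))) (m≤n+m _ t))
    ... | false = ≤-trans (≤-reflexive (bad-false V eq)) (m≤m+n t _)

  ∑q-≥ : t ≤ n → N * (t * L) ≤ N * ∑ (allFin n) q + n * (B * L)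
  ∑q-≥ t≤n = begin
    N * (t * L) ≡⟨ ring₁ N t L ⟩
    L * (N * t) ≡⟨ cong (L *_) (sym (∑-const Ms t)) ⟩
    L * (∑[ V ∈ Ms ] t) ≤⟨ *-monoʳ-≤ L (∑-mono Ms dev) ⟩
    L * (∑[ V ∈ Ms ] (ξ V + n * 𝟙 (bad V))) ≡⟨ cong (L *_) (trans (∑-+ Ms _ _) (cong (∑ Ms ξ +_) (∑-*ˡ Ms n _))) ⟩
    L * (∑ Ms ξ + n * B) ≡⟨ ring₂ L (∑ Ms ξ) n B ⟩
    L * ∑ Ms ξ + n * (B * L) ≡⟨ cong (_+ n * (B * L)) ∑ξ ⟩
    N * ∑ (allFin n) q + n * (B * L) ∎
    where
    open ≤-Reasoning
    ring₁ : ∀ N t L → N * (t * L) ≡ L * (N * t)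
    ring₁ = solve-∀
    ring₂ : ∀ L S n B → L * (S + n * B) ≡ L * S + n * (B * L)
    ring₂ = solve-∀
    dev : ∀ V → t ≤ ξ V + n * 𝟙 (bad V)
    dev V with bad V in eq
    ... | true = ≤-trans t≤n (≤-trans (≤-reflexive (sym (*-identityʳ n))) (m≤n+m _ (ξ V)))
    ... | false = ≤-trans (≤-reflexive (sym (bad-false V eq))) (m≤m+n (ξ V) _)

  private
    others : Fin n → Fin n → Vec (Tuple n m) n → ℕ
    others a b V = ∑[ i ∈ allFin n ] 𝟙 (ne b i) * (𝟙 (ne a i) * 𝟙 (f i (lookup V i)))

    ξ-split : ∀ {a b} → a ≢ b → ∀ V → ξ V ≡ others a b V + (𝟙 (f a (lookup V a)) + 𝟙 (f b (lookup V b)))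
    ξ-split {a} {b} a≢b V = begin
      ξ V ≡⟨ sym (∑-Fin-ne a (λ i → 𝟙 (f i (lookup V i)))) ⟩
      (∑[ i ∈ allFin n ] 𝟙 (ne a i) * 𝟙 (f i (lookup V i))) + 𝟙 (f a (lookup V a))
        ≡⟨ cong (_+ 𝟙 (f a (lookup V a))) (sym (∑-Fin-ne b (λ i → 𝟙 (ne a i) * 𝟙 (f i (lookup V i))))) ⟩
      others a b V + 𝟙 (ne a b) * 𝟙 (f b (lookup V b)) + 𝟙 (f a (lookup V a))
        ≡⟨ cong (λ z → others a b V + 𝟙 z * 𝟙 (f b (lookup V b)) + 𝟙 (f a (lookup V a))) (ne-true⁺ a≢b) ⟩
      others a b V + 1 * 𝟙 (f b (lookup V b)) + 𝟙 (f a (lookup V a))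
        ≡⟨ ring (others a b V) (𝟙 (f b (lookup V b))) (𝟙 (f a (lookup V a))) ⟩
      others a b V + (𝟙 (f a (lookup V a)) + 𝟙 (f b (lookup V b))) ∎
      where
      open ≡-Reasoning
      ring : ∀ o x y → o + 1 * x + y ≡ o + (y + x)
      ring = solve-∀

    others-swap : ∀ a b V → others a b (V ∘ᵥ transposition a b) ≡ others a b V
    others-swap a b V = ∑-cong (allFin n) eq
      where
      eq : ∀ i → 𝟙 (ne b i) * (𝟙 (ne a i) * 𝟙 (f i (lookup (V ∘ᵥ transposition a b) i))) ≡ 𝟙 (ne b i) * (𝟙 (ne a i) * 𝟙 (f i (lookup V i)))
      eq i with b ≟F i | a ≟F i
      ... | yes _ | _ = refl
      ... | no _ | yes _ = refl
      ... | no b≢i | no a≢i = cong (λ v → 1 * (1 * 𝟙 (f i v))) (trans (lookup-∘ᵥ V (transposition a b) i)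
              (cong (lookup V) (lookup-transposition-≢ a b (a≢i ∘ sym) (b≢i ∘ sym))))

  -- Swapping the tuples at a and b preserves ξ, unless the matching or its swap is bad.
  module Swap {a b : Fin n} (a≢b : a ≢ b) (C : Bool → Bool → Bool) (C-diag : C true true ≡ C false false) where

    A : Tuple n m → Bool
    A v = C (f a v) (f b v)

    private
      τ = transposition a b

      at-a : ∀ (V : Vec (Tuple n m) n) → lookup (V ∘ᵥ τ) a ≡ lookup V b
      at-a V = trans (lookup-∘ᵥ V τ a) (cong (lookup V) (lookup-transposition-i a b))

      at-b : ∀ (V : Vec (Tuple n m) n) → lookup (V ∘ᵥ τ) b ≡ lookup V a
      at-b V = trans (lookup-∘ᵥ V τ b) (cong (lookup V) (lookup-transposition-j a b))

      -- The hypothesis says that x - y = z - u, and `C-diag` makes `C` a function of this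
      -- difference.
      same-class : ∀ x y z u → 𝟙 x + 𝟙 u ≡ 𝟙 z + 𝟙 y → C x y ≡ C z u
      same-class true true true true e = refl
      same-class true true true false ()
      same-class true true false true ()
      same-class true true false false e = C-diag
      same-class true false true true ()
      same-class true false true false e = refl
      same-class true false false true ()
      same-class true false false false ()
      same-class false true true true ()
      same-class false true true false ()
      same-class false true false true e = refl
      same-class false true false false ()
      same-class false false true true e = sym C-diag
      same-class false false true false ()
      same-class false false false true ()
      same-class false false false false e = refl

      crossing : Tuple n m → Tuple n m → ℕ
      crossing v w = 𝟙 (A v) * 𝟙 (not (A w))

      crossing-≤1 : ∀ x y → 𝟙 x * 𝟙 (not y) + 𝟙 y * 𝟙 (not x) ≤ 1
      crossing-≤1 true true = z≤n
      crossing-≤1 true false = ≤-refl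
      crossing-≤1 false true = ≤-refl
      crossing-≤1 false false = z≤n

      crossing-refl : ∀ x → 𝟙 x * 𝟙 (not x) + 𝟙 x * 𝟙 (not x) ≡ 0
      crossing-refl true = refl
      crossing-refl false = refl

      pointwise : ∀ V → crossing (lookup V a) (lookup V b) + crossing (lookup V b) (lookup V a) ≤ 𝟙 (bad V) + 𝟙 (bad (V ∘ᵥ τ))
      pointwise V with bad V in eq | bad (V ∘ᵥ τ) in eq′
      ... | true | _ = ≤-trans (crossing-≤1 (A (lookup V a)) (A (lookup V b))) (s≤s z≤n)
      ... | false | true = crossing-≤1 (A (lookup V a)) (A (lookup V b))
      ... | false | false = ≤-reflexive (trans (cong (λ z → 𝟙 z * 𝟙 (not (A w)) + 𝟙 (A w) * 𝟙 (not z)) equal) (crossing-refl (A w)))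
        where
        v = lookup V a
        w = lookup V b
        balance : 𝟙 (f a v) + 𝟙 (f b w) ≡ 𝟙 (f a w) + 𝟙 (f b v)
        balance = +-cancelˡ-≡ (others a b V) _ _ (begin
          others a b V + (𝟙 (f a v) + 𝟙 (f b w)) ≡⟨ sym (ξ-split a≢b V) ⟩
          ξ V ≡⟨ trans (bad-false V eq) (sym (bad-false (V ∘ᵥ τ) eq′)) ⟩
          ξ (V ∘ᵥ τ) ≡⟨ ξ-split a≢b (V ∘ᵥ τ) ⟩
          others a b (V ∘ᵥ τ) + (𝟙 (f a (lookup (V ∘ᵥ τ) a)) + 𝟙 (f b (lookup (V ∘ᵥ τ) b)))
            ≡⟨ cong₂ _+_ (others-swap a b V) (cong₂ (λ x y → 𝟙 (f a x) + 𝟙 (f b y)) (at-a V) (at-b V)) ⟩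
          others a b V + (𝟙 (f a w) + 𝟙 (f b v)) ∎)
          where open ≡-Reasoning
        equal : A v ≡ A w
        equal = same-class (f a v) (f b v) (f a w) (f b w) balance

      S = ∑[ V ∈ Ms ] crossing (lookup V a) (lookup V b)

      -- A crossing of either orientation makes the matching or its swap bad. The swap is measure
      -- preserving, so both orientations have the same sum and the factor 2 cancels.
      S≤B : S ≤ B
      S≤B = *-cancelˡ-≤ 2 (begin
        2 * S ≡⟨ cong (S +_) (+-identityʳ S) ⟩
        S + S ≡⟨ cong (S +_) (sym (trans (∑-cong Ms λ V → cong₂ crossing (sym (at-a V)) (sym (at-b V)))
                   (∑-matchings-∘ᵥ m (transposition-Inj a b) (λ V → crossing (lookup V a) (lookup V b))))) ⟩
        S + (∑[ V ∈ Ms ] crossing (lookup V b) (lookup V a)) ≡⟨ sym (∑-+ Ms _ _) ⟩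
        (∑[ V ∈ Ms ] (crossing (lookup V a) (lookup V b) + crossing (lookup V b) (lookup V a))) ≤⟨ ∑-mono Ms pointwise ⟩
        (∑[ V ∈ Ms ] (𝟙 (bad V) + 𝟙 (bad (V ∘ᵥ τ)))) ≡⟨ ∑-+ Ms _ _ ⟩
        B + (∑[ V ∈ Ms ] 𝟙 (bad (V ∘ᵥ τ))) ≡⟨ cong (B +_) (∑-matchings-∘ᵥ m (transposition-Inj a b) (𝟙 ∘ bad)) ⟩
        B + B ≡⟨ cong (B +_) (sym (+-identityʳ B)) ⟩
        2 * B ∎)
        where open ≤-Reasoning

    α = ∑[ v ∈ Ts ] 𝟙 (A v)
    β = ∑[ v ∈ Ts ] 𝟙 (not (A v))

    private
      total : α + β ≡ L
      total = trans (sym (∑-+ Ts _ _)) (trans (∑-cong Ts λ v → 𝟙-not (A v)) (trans (∑-const-tuples n m 1) (*-identityʳ L)))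

      -- Expansion bounds the crossing probability from below, `S≤B` bounds it from above by p. The
      -- constant 3/2 is the bound for (n-1)/(n-2) when n ≥ 4.
      quadratic : 2 * (α * β * N) ≤ 3 * (L * L * B)
      quadratic = cancel 4≤n (begin
        (n ∸ 2) * (n ∸ 1) ^ m * (α * β * N) ≡⟨ sym (*-assoc ((n ∸ 2) * (n ∸ 1) ^ m) (α * β) N) ⟩
        (n ∸ 2) * (n ∸ 1) ^ m * (α * β) * N ≤⟨ *-monoˡ-≤ N (disjoint-cut 2≤n m A) ⟩
        L * (n ∸ 1) * e * N ≡⟨ ring₁ L (n ∸ 1) e N ⟩
        L * (n ∸ 1) * (N * e) ≡⟨ cong (L * (n ∸ 1) *_) (sym (matchings-pair m a≢b crossing)) ⟩
        L * (n ∸ 1) * (L * (n ∸ 1) ^ m * S) ≤⟨ *-monoʳ-≤ (L * (n ∸ 1)) (*-monoʳ-≤ (L * (n ∸ 1) ^ m) S≤B) ⟩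
        L * (n ∸ 1) * (L * (n ∸ 1) ^ m * B) ≡⟨ ring₂ L (n ∸ 1) ((n ∸ 1) ^ m) B ⟩
        (n ∸ 1) * (n ∸ 1) ^ m * (L * L * B) ∎)
        where
        open ≤-Reasoning
        e = ∑ᵈ n m crossing
        ring₁ : ∀ L p e N → L * p * e * N ≡ L * p * (N * e)
        ring₁ = solve-∀
        ring₂ : ∀ L p E B → L * p * (L * E * B) ≡ p * E * (L * L * B)
        ring₂ = solve-∀
        cancel : ∀ {n x y} → 4 ≤ n → (n ∸ 2) * (n ∸ 1) ^ m * x ≤ (n ∸ 1) * (n ∸ 1) ^ m * y → 2 * x ≤ 3 * y
        cancel {suc (suc (suc (suc r)))} {x} {y} (s≤s (s≤s (s≤s (s≤s z≤n)))) h =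
          *-cancelˡ-≤ ((2 + r) * (3 + r) ^ m) {{m*n≢0 (2 + r) ((3 + r) ^ m) {{_}} {{m^n≢0 (3 + r) m}}}} (begin
            (2 + r) * E * (2 * x) ≡⟨ ring₃ r E x ⟩
            2 * ((2 + r) * E * x) ≤⟨ *-monoʳ-≤ 2 h ⟩
            2 * ((3 + r) * E * y) ≤⟨ m≤m+n _ (r * E * y) ⟩
            2 * ((3 + r) * E * y) + r * E * y ≡⟨ ring₄ r E y ⟩
            (2 + r) * E * (3 * y) ∎)
          where
          E = (3 + r) ^ m
          ring₃ : ∀ r E x → (2 + r) * E * (2 * x) ≡ 2 * ((2 + r) * E * x)
          ring₃ = solve-∀
          ring₄ : ∀ r E y → 2 * ((3 + r) * E * y) + r * E * y ≡ (2 + r) * E * (3 * y)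
          ring₄ = solve-∀

    dichotomy : 8 * B < N → N * α ≤ 2 * B * L ⊎ N * β ≤ 2 * B * L
    dichotomy = extreme-density α β L N B total quadratic

  FatLayer ThinLayer : Fin n → Set
  FatLayer i = N * L ≤ N * q i + 2 * B * L
  ThinLayer i = N * q i ≤ 2 * B * L

  diff : Fin n → Fin n → ℕ
  diff a b = ∑[ v ∈ Ts ] 𝟙 (xor (f a v) (f b v))

  Close : Fin n → Fin n → Set
  Close a b = N * diff a b ≤ 2 * B * L

  close-q : ∀ {a b} → Close a b → N * q a ≤ N * q b + 2 * B * L
  close-q {a} {b} h = begin
    N * q a ≤⟨ *-monoʳ-≤ N (∑-mono Ts λ v → step (f a v) (f b v)) ⟩
    N * (∑[ v ∈ Ts ] (𝟙 (f b v) + 𝟙 (xor (f a v) (f b v)))) ≡⟨ trans (cong (N *_) (∑-+ Ts _ _)) (*-distribˡ-+ N _ _) ⟩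
    N * q b + N * diff a b ≤⟨ +-monoʳ-≤ (N * q b) h ⟩
    N * q b + 2 * B * L ∎
    where
    open ≤-Reasoning
    step : ∀ x y → 𝟙 x ≤ 𝟙 y + 𝟙 (xor x y)
    step true true = ≤-refl
    step true false = ≤-refl
    step false _ = z≤n

  close-sym : ∀ {a b} → Close a b → Close b a
  close-sym {a} {b} h = ≤-trans (≤-reflexive (cong (N *_) (∑-cong Ts λ v → cong 𝟙 (xor-sym (f b v) (f a v))))) h
    where
    xor-sym : ∀ x y → xor x y ≡ xor y x
    xor-sym true true = refl
    xor-sym true false = refl
    xor-sym false true = refl
    xor-sym false false = refl

  module _ (small : 8 * B < N) where

    not-8b : ∀ {c} → c ≤ 8 → ¬ (N * L ≤ c * (B * L))
    not-8b {c} c≤8 h = <⇒≱ small (*-cancelʳ-≤ N (8 * B) L {{>-nonZero L>0}}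
      (≤-trans h (≤-trans (*-monoˡ-≤ (B * L) c≤8) (≤-reflexive (sym (*-assoc 8 B L))))))

    private
      only-a only-b agree : Bool → Bool → Bool
      only-a x y = x ∧ not y
      only-b x y = y ∧ not x
      agree x y = not (xor x y)

    -- f a - f b takes three values, and the level set of one of them is almost everything.
    layers-pair : ∀ {a b} → a ≢ b → FatLayer a × ThinLayer b ⊎ ThinLayer a × FatLayer b ⊎ Close a b
    layers-pair {a} {b} a≢b = resolve (Oa.dichotomy small) (Ob.dichotomy small) (Ag.dichotomy small)
     where
     module Oa = Swap a≢b only-a refl
     module Ob = Swap a≢b only-b refl
     module Ag = Swap a≢b agree refl
     resolve : N * Oa.α ≤ 2 * B * L ⊎ N * Oa.β ≤ 2 * B * L → N * Ob.α ≤ 2 * B * L ⊎ N * Ob.β ≤ 2 * B * L →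
       N * Ag.α ≤ 2 * B * L ⊎ N * Ag.β ≤ 2 * B * L → FatLayer a × ThinLayer b ⊎ ThinLayer a × FatLayer b ⊎ Close a b
     resolve (inj₂ h) _ _ = inj₁ (fat , thin)
      where
      open Oa using (β)
      fat : FatLayer a
      fat = begin
        N * L ≡⟨ cong (N *_) (sym (trans (∑-const-tuples n m 1) (*-identityʳ L))) ⟩
        N * (∑[ v ∈ Ts ] 1) ≤⟨ *-monoʳ-≤ N (∑-mono Ts λ v → step (f a v) (f b v)) ⟩
        N * (∑[ v ∈ Ts ] (𝟙 (f a v) + 𝟙 (not (only-a (f a v) (f b v))))) ≡⟨ trans (cong (N *_) (∑-+ Ts _ _)) (*-distribˡ-+ N _ _) ⟩
        N * q a + N * β ≤⟨ +-monoʳ-≤ (N * q a) h ⟩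
        N * q a + 2 * B * L ∎
        where
        open ≤-Reasoning
        step : ∀ x y → 1 ≤ 𝟙 x + 𝟙 (not (only-a x y))
        step true y = s≤s z≤n
        step false y = ≤-refl
      thin : ThinLayer b
      thin = ≤-trans (*-monoʳ-≤ N (∑-mono Ts λ v → step (f a v) (f b v))) h
        where
        step : ∀ x y → 𝟙 y ≤ 𝟙 (not (only-a x y))
        step true true = ≤-refl
        step true false = z≤n
        step false y = 𝟙≤1 y
     resolve (inj₁ _) (inj₂ h) _ = inj₂ (inj₁ (thin , fat))
      where
      open Ob using (β)
      fat : FatLayer b
      fat = begin
        N * L ≡⟨ cong (N *_) (sym (trans (∑-const-tuples n m 1) (*-identityʳ L))) ⟩
        N * (∑[ v ∈ Ts ] 1) ≤⟨ *-monoʳ-≤ N (∑-mono Ts λ v → step (f a v) (f b v)) ⟩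
        N * (∑[ v ∈ Ts ] (𝟙 (f b v) + 𝟙 (not (only-b (f a v) (f b v))))) ≡⟨ trans (cong (N *_) (∑-+ Ts _ _)) (*-distribˡ-+ N _ _) ⟩
        N * q b + N * β ≤⟨ +-monoʳ-≤ (N * q b) h ⟩
        N * q b + 2 * B * L ∎
        where
        open ≤-Reasoning
        step : ∀ x y → 1 ≤ 𝟙 y + 𝟙 (not (only-b x y))
        step x true = s≤s z≤n
        step x false = ≤-refl
      thin : ThinLayer a
      thin = ≤-trans (*-monoʳ-≤ N (∑-mono Ts λ v → step (f a v) (f b v))) h
        where
        step : ∀ x y → 𝟙 x ≤ 𝟙 (not (only-b x y))
        step true true = ≤-refl
        step true false = ≤-refl
        step false y = z≤n
     resolve (inj₁ _) (inj₁ _) (inj₂ h) = inj₂ (inj₂ (≤-trans (≤-reflexive (cong (N *_) (∑-cong Ts λ v → not-not (xor (f a v) (f b v))))) h))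
      where
      not-not : ∀ x → 𝟙 x ≡ 𝟙 (not (not x))
      not-not true = refl
      not-not false = refl
     resolve (inj₁ h₁) (inj₁ h₂) (inj₁ h₃) = ⊥-elim (not-8b {6} (s≤s (s≤s (s≤s (s≤s (s≤s (s≤s z≤n)))))) (begin
      N * L ≡⟨ cong (N *_) (sym (trans (∑-const-tuples n m 1) (*-identityʳ L))) ⟩
      N * (∑[ v ∈ Ts ] 1) ≡⟨ cong (N *_) (∑-cong Ts λ v → cover (f a v) (f b v)) ⟩
      N * (∑[ v ∈ Ts ] (𝟙 (only-a (f a v) (f b v)) + (𝟙 (only-b (f a v) (f b v)) + 𝟙 (agree (f a v) (f b v)))))
        ≡⟨ cong (N *_) (trans (∑-+ Ts _ _) (cong (α₁ +_) (∑-+ Ts _ _))) ⟩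
      N * (α₁ + (α₂ + α₃)) ≡⟨ trans (*-distribˡ-+ N _ _) (cong (N * α₁ +_) (*-distribˡ-+ N _ _)) ⟩
      N * α₁ + (N * α₂ + N * α₃) ≤⟨ +-mono-≤ h₁ (+-mono-≤ h₂ h₃) ⟩
      2 * B * L + (2 * B * L + 2 * B * L) ≡⟨ ring B L ⟩
      6 * (B * L) ∎))
      where
      open ≤-Reasoning
      α₁ = Oa.α
      α₂ = Ob.α
      α₃ = Ag.α
      cover : ∀ x y → 1 ≡ 𝟙 (only-a x y) + (𝟙 (only-b x y) + 𝟙 (agree x y))
      cover true true = refl
      cover true false = refl
      cover false true = refl
      cover false false = refl
      ring : ∀ B L → 2 * B * L + (2 * B * L + 2 * B * L) ≡ 6 * (B * L)
      ring = solve-∀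

    private
      -- Passing from density at least 1 - 2p to density at most 2p through one layer close to both
      -- would bridge the whole interval with four errors of 2p, impossible for 8p < 1.
      separated : ∀ {a b d} → FatLayer a → ThinLayer b → Close a d → Close d b → ⊥
      separated {a} {b} {d} fat thin a~d d~b = not-8b {8} ≤-refl (begin
        N * L ≤⟨ fat ⟩
        N * q a + 2 * B * L ≤⟨ +-monoˡ-≤ _ (close-q a~d) ⟩
        N * q d + 2 * B * L + 2 * B * L ≤⟨ +-monoˡ-≤ _ (+-monoˡ-≤ _ (close-q d~b)) ⟩
        N * q b + 2 * B * L + 2 * B * L + 2 * B * L ≤⟨ +-monoˡ-≤ _ (+-monoˡ-≤ _ (+-monoˡ-≤ _ thin)) ⟩
        2 * B * L + 2 * B * L + 2 * B * L + 2 * B * L ≡⟨ ring B L ⟩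
        8 * (B * L) ∎)
        where
        open ≤-Reasoning
        ring : ∀ B L → 2 * B * L + 2 * B * L + 2 * B * L + 2 * B * L ≡ 8 * (B * L)
        ring = solve-∀

    -- If some layer `d` is neither fat nor thin, `layers-pair` makes the others close to `d`. By
    -- `separated` a fat and a thin layer cannot both be close to `d`, so only the third case of
    -- `layers-pair` remains for every pair.
    layers-dichotomy : (∀ a b → Close a b) ⊎ (∀ a → FatLayer a ⊎ ThinLayer a)
    layers-dichotomy with all? (λ a → (_ ≤? _) ⊎-dec (N * q a ≤? 2 * B * L))
    ... | yes h = inj₂ h
    ... | no ¬h with ¬∀⟶∃¬ n _ (λ a → (_ ≤? _) ⊎-dec (N * q a ≤? 2 * B * L)) ¬h
    ... | d , ¬d = inj₁ close
      where
      near-d : ∀ {a} → FatLayer a ⊎ ThinLayer a → Close a d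
      near-d {a} h = resolve (layers-pair λ { refl → ¬d h })
        where
        resolve : FatLayer a × ThinLayer d ⊎ ThinLayer a × FatLayer d ⊎ Close a d → Close a d
        resolve (inj₁ (_ , thin)) = ⊥-elim (¬d (inj₂ thin))
        resolve (inj₂ (inj₁ (_ , fat))) = ⊥-elim (¬d (inj₁ fat))
        resolve (inj₂ (inj₂ c)) = c
      xor-refl : ∀ x → 𝟙 (xor x x) ≡ 0
      xor-refl true = refl
      xor-refl false = refl
      close-refl : ∀ a → Close a a
      close-refl a = ≤-trans (≤-reflexive (trans (cong (N *_) (trans (∑-cong Ts λ v → xor-refl (f a v)) (∑-0 Ts))) (*-zeroʳ N))) z≤n
      resolve : ∀ {a b} → FatLayer a × ThinLayer b ⊎ ThinLayer a × FatLayer b ⊎ Close a b → Close a b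
      resolve (inj₁ (fat , thin)) = ⊥-elim (separated fat thin (near-d (inj₁ fat)) (close-sym (near-d (inj₂ thin))))
      resolve (inj₂ (inj₁ (thin , fat))) = ⊥-elim (separated fat thin (near-d (inj₁ fat)) (close-sym (near-d (inj₂ thin))))
      resolve (inj₂ (inj₂ c)) = c
      close : ∀ a b → Close a b
      close a b = case a ≟F b of λ { (yes refl) → close-refl a ; (no a≢b) → resolve (layers-pair a≢b) }

-- Counting perfect matchings

∑-subsets-∷ : (x : 𝒳) (xs : List 𝒳) (g : List 𝒳 → ℕ) →
  ∑ (subsets (x ∷ xs)) g ≡ (∑[ M ∈ subsets xs ] g (x ∷ M)) + ∑ (subsets xs) g
∑-subsets-∷ x xs g = trans (∑-++ (map (x ∷_) (subsets xs)) (subsets xs) g) (cong (_+ ∑ (subsets xs) g) (∑-map (x ∷_) (subsets xs) g))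

∑-subsets-++ : (xs ys : List 𝒳) (g : List 𝒳 → ℕ) →
  ∑ (subsets (xs ++ ys)) g ≡ ∑[ M ∈ subsets xs ] ∑[ M′ ∈ subsets ys ] g (M ++ M′)
∑-subsets-++ [] ys g = sym (+-identityʳ _)
∑-subsets-++ (x ∷ xs) ys g = trans (∑-subsets-∷ x (xs ++ ys) g)
  (trans (cong₂ _+_ (∑-subsets-++ xs ys (g ∘ (x ∷_))) (∑-subsets-++ xs ys g)) (sym (∑-subsets-∷ x xs _)))

∑-subsets-empty : (xs : List 𝒳) (g : List 𝒳 → ℕ) → (∀ x M → x ∈ xs → g (x ∷ M) ≡ 0) → ∑ (subsets xs) g ≡ g []
∑-subsets-empty [] g h = +-identityʳ (g [])
∑-subsets-empty (x ∷ xs) g h = trans (∑-subsets-∷ x xs g)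
  (cong₂ _+_ (trans (∑-cong (subsets xs) λ M → h x M (here refl)) (∑-0 (subsets xs))) (∑-subsets-empty xs g λ y M y∈ → h y M (there y∈)))

∑-subsets-≤1 : (xs : List 𝒳) (g : List 𝒳 → ℕ) → (∀ x y M → x ∈ xs → y ∈ xs → g (x ∷ y ∷ M) ≡ 0) →
  ∑ (subsets xs) g ≡ g [] + (∑[ x ∈ xs ] g [ x ])
∑-subsets-≤1 [] g h = refl
∑-subsets-≤1 (x ∷ xs) g h = begin
  ∑ (subsets (x ∷ xs)) g ≡⟨ ∑-subsets-∷ x xs g ⟩
  (∑[ M ∈ subsets xs ] g (x ∷ M)) + ∑ (subsets xs) g
    ≡⟨ cong₂ _+_ (∑-subsets-empty xs (g ∘ (x ∷_)) λ y M y∈ → h x y M (here refl) (there y∈))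
         (∑-subsets-≤1 xs g λ y z M y∈ z∈ → h y z M (there y∈) (there z∈)) ⟩
  g [ x ] + (g [] + (∑[ y ∈ xs ] g [ y ])) ≡⟨ exchange (g [ x ]) (g []) _ ⟩
  g [] + (∑[ y ∈ x ∷ xs ] g [ y ]) ∎
  where
  open ≡-Reasoning
  exchange : ∀ a b c → a + (b + c) ≡ b + (a + c)
  exchange = solve-∀

∑rows : ∀ {n} m r → (Vec (Tuple n m) r → ℕ) → ℕ
∑rows m zero g = g []
∑rows {n} m (suc r) g = ∑[ w ∈ allTuples n m ] ∑rows m r λ W → g (w ∷ W)

∑rows-cong : ∀ {n} m r {g h : Vec (Tuple n m) r → ℕ} → (∀ W → g W ≡ h W) → ∑rows m r g ≡ ∑rows m r h
∑rows-cong m zero e = e []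
∑rows-cong {n} m (suc r) e = ∑-cong (allTuples n m) λ w → ∑rows-cong m r λ W → e (w ∷ W)

∑rows-*ˡ : ∀ {n} m r c (g : Vec (Tuple n m) r → ℕ) → ∑rows m r (λ W → c * g W) ≡ c * ∑rows m r g
∑rows-*ˡ m zero c g = refl
∑rows-*ˡ {n} m (suc r) c g = trans (∑-cong (allTuples n m) λ w → ∑rows-*ˡ m r c _) (∑-*ˡ (allTuples n m) c _)

-- Subsets list matchings by rows, `matchings` builds them by columns; this exchange reconciles the
-- two.
∑rows-columns : ∀ {n} m r (g : Vec (Tuple n (suc m)) r → ℕ) →
  ∑rows (suc m) r g ≡ ∑[ col ∈ allTuples n r ] ∑rows m r λ W → g (zipWith Vec._∷_ col W)
∑rows-columns m zero g = sym (+-identityʳ (g []))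
∑rows-columns {n} m (suc r) g = begin
  (∑[ v ∈ allTuples n (suc m) ] ∑rows (suc m) r λ W → g (v ∷ W)) ≡⟨ ∑-tuples n m _ ⟩
  (∑[ a ∈ allFin n ] ∑[ w ∈ allTuples n m ] ∑rows (suc m) r λ W → g ((a ∷ w) ∷ W))
    ≡⟨ ∑-cong (allFin n) (λ a → ∑-cong (allTuples n m) λ w → ∑rows-columns m r _) ⟩
  (∑[ a ∈ allFin n ] ∑[ w ∈ allTuples n m ] ∑[ col ∈ allTuples n r ] ∑rows m r λ W → g ((a ∷ w) ∷ zipWith Vec._∷_ col W))
    ≡⟨ ∑-cong (allFin n) (λ a → ∑-swap (allTuples n m) (allTuples n r) _) ⟩
  (∑[ a ∈ allFin n ] ∑[ col ∈ allTuples n r ] ∑[ w ∈ allTuples n m ] ∑rows m r λ W → g ((a ∷ w) ∷ zipWith Vec._∷_ col W))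
    ≡⟨ sym (∑-tuples n r _) ⟩
  (∑[ col ∈ allTuples n (suc r) ] ∑rows m (suc r) λ W → g (zipWith Vec._∷_ col W)) ∎
  where open ≡-Reasoning

∑rows-zero : ∀ {n} r (g : Vec (Tuple n 0) r → ℕ) → ∑rows 0 r g ≡ g (replicate r [])
∑rows-zero zero g = refl
∑rows-zero (suc r) g = trans (+-identityʳ _) (∑rows-zero r (λ W → g ([] ∷ W)))

∧-interchange : ∀ a b c d → (a ∧ b) ∧ (c ∧ d) ≡ (a ∧ c) ∧ (b ∧ d)
∧-interchange false b c d = refl
∧-interchange true false false d = refl
∧-interchange true false true d = refl
∧-interchange true true c d = refl

disjoint-from-rows : ∀ {n m r} (a : Fin n) (x : Tuple n m) (col : Vec (Fin n) r) W →
  allᵇ (disjointᵇ (a ∷ x)) (toList (zipWith Vec._∷_ col W)) ≡ freshᵇ a col ∧ allᵇ (disjointᵇ x) (toList W)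
disjoint-from-rows a x [] [] = refl
disjoint-from-rows a x (b ∷ col) (y ∷ W) rewrite disjoint-from-rows a x col W =
  ∧-interchange (ne a b) (disjointᵇ x y) (freshᵇ a col) (allᵇ (disjointᵇ x) (toList W))

-- Disjointness is imposed on each coordinate separately, hence factors over the columns.
pairwiseDisjoint-rows : ∀ {n m r} (col : Vec (Fin n) r) (W : Vec (Tuple n m) r) →
  pairwiseDisjointᵇ (toList (zipWith Vec._∷_ col W)) ≡ distinctᵇ col ∧ pairwiseDisjointᵇ (toList W)
pairwiseDisjoint-rows [] [] = refl
pairwiseDisjoint-rows (a ∷ col) (x ∷ W) rewrite disjoint-from-rows a x col W | pairwiseDisjoint-rows col W =
  ∧-interchange (freshᵇ a col) (allᵇ (disjointᵇ x) (toList W)) (distinctᵇ col) (pairwiseDisjointᵇ (toList W))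

∑rows-matchings : ∀ n m (g : Vec (Tuple n m) n → ℕ) →
  ∑rows m n (λ W → 𝟙 (pairwiseDisjointᵇ (toList W)) * g W) ≡ ∑ (matchings n m) g
∑rows-matchings n zero g = trans (∑rows-zero n _) (cong (λ b → 𝟙 b * g (replicate n [])) (trivial n))
  where
  all-empty : ∀ r → allᵇ (disjointᵇ {n} []) (toList (replicate r [])) ≡ true
  all-empty zero = refl
  all-empty (suc r) = all-empty r
  trivial : ∀ r → pairwiseDisjointᵇ {n} (toList (replicate r [])) ≡ true
  trivial zero = refl
  trivial (suc r) rewrite all-empty r = trivial r
∑rows-matchings n (suc m) g = begin
  ∑rows (suc m) n (λ W → 𝟙 (pairwiseDisjointᵇ (toList W)) * g W) ≡⟨ ∑rows-columns m n _ ⟩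
  (∑[ col ∈ allTuples n n ] ∑rows m n λ W → 𝟙 (pairwiseDisjointᵇ (toList (zipWith Vec._∷_ col W))) * g (zipWith Vec._∷_ col W))
    ≡⟨ ∑-cong (allTuples n n) (λ col → trans (∑rows-cong m n λ W → split col W) (trans (∑rows-*ˡ m n (𝟙 (distinctᵇ col)) _)
         (cong (𝟙 (distinctᵇ col) *_) (∑rows-matchings n m _)))) ⟩
  (∑[ col ∈ allTuples n n ] 𝟙 (distinctᵇ col) * (∑[ W ∈ matchings n m ] g (zipWith Vec._∷_ col W)))
    ≡⟨ sym (∑-filterᵇ distinctᵇ (allTuples n n) _) ⟩
  (∑[ π ∈ perms n ] ∑[ W ∈ matchings n m ] g (zipWith Vec._∷_ π W)) ≡⟨ sym (∑-matchings n m g) ⟩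
  ∑ (matchings n (suc m)) g ∎
  where
  open ≡-Reasoning
  split : ∀ col (W : Vec (Tuple n m) n) → 𝟙 (pairwiseDisjointᵇ (toList (zipWith Vec._∷_ col W))) * g (zipWith Vec._∷_ col W) ≡
    𝟙 (distinctᵇ col) * (𝟙 (pairwiseDisjointᵇ (toList W)) * g (zipWith Vec._∷_ col W))
  split col W rewrite pairwiseDisjoint-rows col W | 𝟙-∧ (distinctᵇ col) (pairwiseDisjointᵇ (toList W)) = *-assoc (𝟙 (distinctᵇ col)) _ _

-- A set of l disjoint tuples contains at most one tuple from each layer {x : x₁ = c}, hence exactly one
-- from each of the given layers if l is their number.
module _ {n m : ℕ} where

  layerTuples : ∀ {r} → Vec (Fin n) r → List (Tuple n (suc m))
  layerTuples [] = []
  layerTuples (c ∷ cs) = map (c ∷_) (allTuples n m) ++ layerTuples cs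

  disjointSubsets : ∀ {r} → Vec (Fin n) r → ℕ → (List (Tuple n (suc m)) → Bool) → ℕ
  disjointSubsets cs l p = ∑[ M ∈ subsets (layerTuples cs) ] 𝟙 ((length M ≡ᵇ l) ∧ (pairwiseDisjointᵇ M ∧ p M))

  private
    rearrange : ∀ x a b c → 𝟙 (x ∧ ((a ∧ b) ∧ c)) ≡ 𝟙 (x ∧ (b ∧ (a ∧ c)))
    rearrange false _ _ _ = refl
    rearrange true true b c = refl
    rearrange true false true c = refl
    rearrange true false false c = refl

  disjointSubsets-∷ : ∀ {r} c (cs : Vec (Fin n) r) l p →
    disjointSubsets (c ∷ cs) (suc l) p ≡ disjointSubsets cs (suc l) p +
      (∑[ w ∈ allTuples n m ] disjointSubsets cs l (λ M → allᵇ (disjointᵇ (c ∷ w)) M ∧ p ((c ∷ w) ∷ M)))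
  disjointSubsets-∷ c cs l p = begin
    disjointSubsets (c ∷ cs) (suc l) p ≡⟨ ∑-subsets-++ layer (layerTuples cs) _ ⟩
    ∑ (subsets layer) h ≡⟨ ∑-subsets-≤1 layer h two ⟩
    h [] + (∑[ v ∈ layer ] h [ v ]) ≡⟨ cong (h [] +_) (∑-map (c ∷_) (allTuples n m) _) ⟩
    h [] + (∑[ w ∈ allTuples n m ] h [ c ∷ w ])
      ≡⟨ cong (h [] +_) (∑-cong (allTuples n m) λ w → ∑-cong (subsets (layerTuples cs)) λ M →
           rearrange (length M ≡ᵇ l) (allᵇ (disjointᵇ (c ∷ w)) M) (pairwiseDisjointᵇ M) (p ((c ∷ w) ∷ M))) ⟩
    disjointSubsets cs (suc l) p + (∑[ w ∈ allTuples n m ] disjointSubsets cs l (λ M → allᵇ (disjointᵇ (c ∷ w)) M ∧ p ((c ∷ w) ∷ M))) ∎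
    where
    open ≡-Reasoning
    layer = map (c ∷_) (allTuples n m)
    h : List (Tuple n (suc m)) → ℕ
    h M = ∑[ M′ ∈ subsets (layerTuples cs) ] 𝟙 ((length (M ++ M′) ≡ᵇ suc l) ∧ (pairwiseDisjointᵇ (M ++ M′) ∧ p (M ++ M′)))
    two : ∀ x y M → x ∈ layer → y ∈ layer → h (x ∷ y ∷ M) ≡ 0
    two x y M x∈ y∈ with ∈-map⁻ (c ∷_) x∈ | ∈-map⁻ (c ∷_) y∈
    ... | v , _ , refl | w , _ , refl = trans (∑-cong (subsets (layerTuples cs)) λ M′ → vanish M′) (∑-0 (subsets (layerTuples cs)))
      where
      vanish : ∀ M′ → 𝟙 ((length ((c ∷ v) ∷ (c ∷ w) ∷ M ++ M′) ≡ᵇ suc l) ∧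
        (pairwiseDisjointᵇ ((c ∷ v) ∷ (c ∷ w) ∷ M ++ M′) ∧ p ((c ∷ v) ∷ (c ∷ w) ∷ M ++ M′))) ≡ 0
      vanish M′ rewrite dec-true (c ≟F c) refl = cong 𝟙 (∧-zeroʳ (length ((c ∷ v) ∷ (c ∷ w) ∷ M ++ M′) ≡ᵇ suc l))

  disjointSubsets-> : ∀ {r} (cs : Vec (Fin n) r) l p → r < l → disjointSubsets cs l p ≡ 0
  disjointSubsets-> [] (suc l) p _ = refl
  disjointSubsets-> (c ∷ cs) (suc l) p (s≤s r<l) = trans (disjointSubsets-∷ c cs l p)
    (cong₂ _+_ (disjointSubsets-> cs (suc l) p (m<n⇒m<1+n r<l))
      (trans (∑-cong (allTuples n m) λ w → disjointSubsets-> cs l _ r<l) (∑-0 (allTuples n m))))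

  disjointSubsets-rows : ∀ {r} (cs : Vec (Fin n) r) p →
    disjointSubsets cs r p ≡ ∑rows m r λ W → 𝟙 (pairwiseDisjointᵇ (toList (zipWith Vec._∷_ cs W)) ∧ p (toList (zipWith Vec._∷_ cs W)))
  disjointSubsets-rows [] p = +-identityʳ _
  disjointSubsets-rows {suc r} (c ∷ cs) p = trans (disjointSubsets-∷ c cs r p)
    (cong₂ _+_ (disjointSubsets-> cs (suc r) p ≤-refl) (∑-cong (allTuples n m) λ w → trans (disjointSubsets-rows cs (λ M → allᵇ (disjointᵇ (c ∷ w)) M ∧ p ((c ∷ w) ∷ M)))
      (∑rows-cong m r λ W → sym (rearrange true (allᵇ (disjointᵇ (c ∷ w)) (toList (zipWith Vec._∷_ cs W))) _ _))))

toList-tabulate : ∀ {r} (g : Fin r → 𝒳) → toList (tabulate g) ≡ Data.List.tabulate g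
toList-tabulate {r = zero} g = refl
toList-tabulate {r = suc r} g = cong (g zero ∷_) (toList-tabulate (g ∘ suc))

∑-toList : ∀ {r} (U : Vec 𝒳 r) (g : 𝒳 → ℕ) → ∑ (toList U) g ≡ ∑[ i ∈ allFin r ] g (lookup U i)
∑-toList {r = r} U g = trans (cong (λ xs → ∑ xs g) (trans (cong toList (sym (tabulate∘lookup U)))
  (trans (toList-tabulate (lookup U)) (sym (map-tabulate id (lookup U)))))) (∑-map (lookup U) (allFin r) g)

indices : ∀ n → Vec (Fin n) n
indices n = tabulate id

indices-Inj : ∀ n → Inj (indices n)
indices-Inj n = inj λ i j e → trans (sym (lookup∘tabulate id i)) (trans e (lookup∘tabulate id j))

layerTuples-all : ∀ n m → layerTuples {n} {m} (indices n) ≡ allTuples n (suc m)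
layerTuples-all n m = trans (go (indices n)) (cong (concatMap (λ c → map (c ∷_) (allTuples n m))) (toList-tabulate id))
  where
  go : ∀ {r} (cs : Vec (Fin n) r) → layerTuples cs ≡ concatMap (λ c → map (c ∷_) (allTuples n m)) (toList cs)
  go [] = refl
  go (c ∷ cs) = cong (map (c ∷_) (allTuples n m) ++_) (go cs)

-- The bridge from unordered to numbered matchings: an unordered one has a unique numbering whose
-- first column is in order, and only the other `m` columns remain free.
count-perfectMatchings : ∀ n m (p : List (Tuple n (suc m)) → Bool) →
  count (λ M → isPerfectMatchingᵇ n M ∧ p M) (subsets (allTuples n (suc m))) ≡
  ∑[ W ∈ matchings n m ] 𝟙 (p (toList (zipWith Vec._∷_ (indices n) W)))
count-perfectMatchings n m p = begin
  count (λ M → isPerfectMatchingᵇ n M ∧ p M) (subsets (allTuples n (suc m))) ≡⟨ count-∑ _ (subsets (allTuples n (suc m))) ⟩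
  (∑[ M ∈ subsets (allTuples n (suc m)) ] 𝟙 (isPerfectMatchingᵇ n M ∧ p M))
    ≡⟨ ∑-cong (subsets (allTuples n (suc m))) (λ M → cong 𝟙 (∧-assoc (length M ≡ᵇ n) (pairwiseDisjointᵇ M) (p M))) ⟩
  (∑[ M ∈ subsets (allTuples n (suc m)) ] 𝟙 ((length M ≡ᵇ n) ∧ (pairwiseDisjointᵇ M ∧ p M)))
    ≡⟨ cong (λ xs → ∑[ M ∈ subsets xs ] 𝟙 ((length M ≡ᵇ n) ∧ (pairwiseDisjointᵇ M ∧ p M))) (sym (layerTuples-all n m)) ⟩
  disjointSubsets (indices n) n p ≡⟨ disjointSubsets-rows (indices n) p ⟩
  ∑rows m n (λ W → 𝟙 (pairwiseDisjointᵇ (toList (zipWith Vec._∷_ (indices n) W)) ∧ p (toList (zipWith Vec._∷_ (indices n) W))))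
    ≡⟨ ∑rows-cong m n split ⟩
  ∑rows m n (λ W → 𝟙 (pairwiseDisjointᵇ (toList W)) * 𝟙 (p (toList (zipWith Vec._∷_ (indices n) W)))) ≡⟨ ∑rows-matchings n m _ ⟩
  (∑[ W ∈ matchings n m ] 𝟙 (p (toList (zipWith Vec._∷_ (indices n) W)))) ∎
  where
  open ≡-Reasoning
  split : ∀ (W : Vec (Tuple n m) n) → 𝟙 (pairwiseDisjointᵇ (toList (zipWith Vec._∷_ (indices n) W)) ∧ p (toList (zipWith Vec._∷_ (indices n) W))) ≡
    𝟙 (pairwiseDisjointᵇ (toList W)) * 𝟙 (p (toList (zipWith Vec._∷_ (indices n) W)))
  split W = trans (𝟙-∧ (pairwiseDisjointᵇ (toList (zipWith Vec._∷_ (indices n) W))) _) (cong (λ b → 𝟙 b * 𝟙 (p (toList (zipWith Vec._∷_ (indices n) W))))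
    (trans (pairwiseDisjoint-rows (indices n) W) (cong (_∧ pairwiseDisjointᵇ (toList W)) (distinctᵇ⁺ (indices n) (indices-Inj n)))))

numPM-matchings : ∀ n m → numPM n (suc m) ≡ #matchings n m
numPM-matchings n m = trans (count-∑ _ (subsets (allTuples n (suc m)))) (trans (∑-cong (subsets (allTuples n (suc m))) λ M → cong 𝟙 (sym (∧-identityʳ (isPerfectMatchingᵇ n M))))
  (trans (sym (count-∑ _ (subsets (allTuples n (suc m))))) (trans (count-perfectMatchings n m (λ _ → true)) (sym (length-∑ (matchings n m))))))

-- |F ∩ M| for the ordered matching M of [n]^(m+1) whose i-th coordinates are in order and whose other coordinates form W.
hits : ∀ {n m} → Family n (suc m) → Fin (suc m) → Vec (Tuple n m) n → ℕ
hits {n} F i W = ∑[ a ∈ allFin n ] 𝟙 (F (insertAt (lookup W a) i a))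

numBad-matchings : ∀ {n m} (F : Family n (suc m)) s →
  numBad F s ≡ ∑[ W ∈ matchings n m ] 𝟙 (not (hits F zero W ≡ᵇ (s ∸ 1)))
numBad-matchings {n} {m} F s = trans (count-perfectMatchings n m (λ M → not (count F M ≡ᵇ (s ∸ 1))))
  (∑-cong (matchings n m) λ W → cong (λ z → 𝟙 (not (z ≡ᵇ (s ∸ 1)))) (count-hits W))
  where
  count-hits : ∀ W → count F (toList (zipWith Vec._∷_ (indices n) W)) ≡ hits F zero W
  count-hits W = trans (count-∑ F (toList (zipWith Vec._∷_ (indices n) W))) (trans (∑-toList (zipWith Vec._∷_ (indices n) W) (𝟙 ∘ F))
    (∑-cong (allFin n) λ a → cong (𝟙 ∘ F) (trans (lookup-zip∷ (indices n) W a) (cong (_∷ lookup W a) (lookup∘tabulate id a)))))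

-- Splitting the coordinates

does-true⁻ : {P : Set} (P? : Dec P) → does P? ≡ true → P
does-true⁻ (yes p) _ = p

does-false⁻ : {P : Set} (P? : Dec P) → does P? ≡ false → ¬ P
does-false⁻ (no ¬p) _ = ¬p

module Chain {n : ℕ} (8≤n : 8 ≤ n) (t d : ℕ) (t≤n : t ≤ n) (0<d : 0 < d) (d≤t : d ≤ t) (d≤n∸t : d ≤ n ∸ t)
  (d-min : d ≡ t ⊎ d ≡ n ∸ t) where

  4≤n : 4 ≤ n
  4≤n = ≤-trans (s≤s (s≤s (s≤s (s≤s z≤n)))) 8≤n

  2d≤n : 2 * d ≤ n
  2d≤n = begin
    2 * d ≡⟨ cong (d +_) (+-identityʳ d) ⟩
    d + d ≤⟨ +-mono-≤ d≤t d≤n∸t ⟩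
    t + (n ∸ t) ≡⟨ m+[n∸m]≡n t≤n ⟩
    n ∎
    where open ≤-Reasoning

  2≤n : 2 ≤ n
  2≤n = ≤-trans (s≤s (s≤s z≤n)) 4≤n

  i₀ : Fin n
  i₀ = fromℕ< (≤-trans (s≤s z≤n) 8≤n)

  n≢0 : NonZero n
  n≢0 = >-nonZero (≤-trans (s≤s z≤n) 8≤n)

  -- X, Y and b stand for n D N, d L N and n B L; the bounds compare the density D / L with τ d / n up to multiples of B / N.
  record Profile (X Y b : ℕ) (τ : Bool) : Set where
    field
      upper : X ≤ Y * 𝟙 τ + 4 * b
      lower : Y * 𝟙 τ ≤ X + 3 * b

  -- `G` is the family with `j` coordinates split off. A matching `U` of the split-off part and one
  -- of the rest together form a matching of everything; `badAt U` counts the bad completions of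
  -- `U`. Taking the minimum with the complement in `D` gives fat and thin fibres the same value,
  -- nearly 0.
  module Split {j m : ℕ} (G : Tuple n j → Tuple n m → Bool) where

    q q̄ D : Tuple n j → ℕ
    q u = ∑[ v ∈ allTuples n m ] 𝟙 (G u v)
    q̄ u = ∑[ v ∈ allTuples n m ] 𝟙 (not (G u v))
    D u = q u ⊓ q̄ u

    Dsum : ℕ
    Dsum = ∑ (allTuples n j) D

    L W Nᵐ Nʲ K : ℕ
    L = n ^ m
    W = n ^ j
    Nᵐ = #matchings n m
    Nʲ = #matchings n j
    K = W * L

    badAt : Vec (Tuple n j) n → ℕ
    badAt U = ∑[ V ∈ matchings n m ] 𝟙 (not ((∑[ i ∈ allFin n ] 𝟙 (G (lookup U i) (lookup V i))) ≡ᵇ t))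

    bads : ℕ
    bads = ∑ (matchings n j) badAt

    τ : Tuple n j → Bool
    τ u = does (d * L ≤? 2 * (n * D u))

    τ-true : ∀ u → τ u ≡ true → d * L ≤ 2 * (n * D u)
    τ-true u = does-true⁻ (_ ≤? _)

    τ-false : ∀ u → τ u ≡ false → 2 * (n * D u) ≤ d * L
    τ-false u e = <⇒≤ (≰⇒> (does-false⁻ (_ ≤? _) e))

    q+q̄ : ∀ u → q u + q̄ u ≡ L
    q+q̄ u = trans (sym (∑-+ (allTuples n m) _ _)) (trans (∑-cong (allTuples n m) λ v → 𝟙-not (G u v)) (trans (∑-const-tuples n m 1) (*-identityʳ L)))

    2D≤L : ∀ u → 2 * D u ≤ L
    2D≤L u = begin
      2 * D u ≡⟨ cong (D u +_) (+-identityʳ (D u)) ⟩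
      D u + D u ≤⟨ +-mono-≤ (m⊓n≤m (q u) (q̄ u)) (m⊓n≤n (q u) (q̄ u)) ⟩
      q u + q̄ u ≡⟨ q+q̄ u ⟩
      L ∎
      where open ≤-Reasoning

    L>0 : 0 < L
    L>0 = m^n>0 n {{n≢0}} m

    W>0 : 0 < W
    W>0 = m^n>0 n {{n≢0}} j

    module At (U : Vec (Tuple n j) n) where

      open Layers 4≤n m (λ i → G (lookup U i)) t using (Close; FatLayer; ThinLayer; layers-dichotomy; ∑q-≤; ∑q-≥; close-q)

      B = badAt U
      u : Fin n → Tuple n j
      u = lookup U
      Y b : ℕ
      Y = d * (Nᵐ * L)
      b = n * (B * L)
      X : Fin n → ℕ
      X i = n * (Nᵐ * D (u i))

      -- The first half compares `D` with the cut `τ` and serves to relate their means. The second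
      -- says that a matching with rows on both sides of the cut has at least the proportion d/6n of
      -- bad completions; this makes crossing pairs rare.
      Good : Set
      Good = (∀ i → Profile (X i) Y b (τ (u i))) × (∀ i i′ → τ (u i) ≡ true → τ (u i′) ≡ false → Y ≤ 6 * b)

      τ-Y : ∀ i → τ (u i) ≡ true → Y ≤ 2 * X i
      τ-Y i e = begin
        d * (Nᵐ * L) ≡⟨ ring₁ d Nᵐ L ⟩
        Nᵐ * (d * L) ≤⟨ *-monoʳ-≤ Nᵐ (τ-true (u i) e) ⟩
        Nᵐ * (2 * (n * D (u i))) ≡⟨ ring₂ Nᵐ n (D (u i)) ⟩
        2 * (n * (Nᵐ * D (u i))) ∎
        where
        open ≤-Reasoning
        ring₁ : ∀ a b c → a * (b * c) ≡ b * (a * c)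
        ring₁ = solve-∀
        ring₂ : ∀ a b c → a * (2 * (b * c)) ≡ 2 * (b * (a * c))
        ring₂ = solve-∀

      ¬τ-Y : ∀ i → τ (u i) ≡ false → 2 * X i ≤ Y
      ¬τ-Y i e = begin
        2 * (n * (Nᵐ * D (u i))) ≡⟨ ring₂ n Nᵐ (D (u i)) ⟩
        Nᵐ * (2 * (n * D (u i))) ≤⟨ *-monoʳ-≤ Nᵐ (τ-false (u i) e) ⟩
        Nᵐ * (d * L) ≡⟨ ring₁ Nᵐ d L ⟩
        d * (Nᵐ * L) ∎
        where
        open ≤-Reasoning
        ring₁ : ∀ a b c → a * (b * c) ≡ b * (a * c)
        ring₁ = solve-∀
        ring₂ : ∀ a b c → 2 * (a * (b * c)) ≡ b * (2 * (a * c))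
        ring₂ = solve-∀

      private
        double : ∀ x → 2 * x ≡ x + x
        double x = cong (x +_) (+-identityʳ x)

        -- A row outside the cut has `2 * X i ≤ Y` and `Y ≤ X i + 3 * b`, so `X i ≤ 3 * b` and then
        -- `Y ≤ 6 * b`: it occurs only when `Y` itself is of the size of the error.
        balanced : (∀ i → X i ≤ Y + 3 * b) → (∀ i → Y ≤ X i + 3 * b) → Good
        balanced h₁ h₂ = profile , mixed
          where
          X≤3b : ∀ i → τ (u i) ≡ false → X i ≤ 3 * b
          X≤3b i e = +-cancelˡ-≤ (X i) _ _ (≤-trans (≤-reflexive (sym (double (X i)))) (≤-trans (¬τ-Y i e) (h₂ i)))
          profile : ∀ i → Profile (X i) Y b (τ (u i))
          profile i with τ (u i) in e
          ... | true = record
            { upper = ≤-trans (h₁ i) (+-mono-≤ (≤-reflexive (sym (*-identityʳ Y))) (*-monoˡ-≤ b {3} {4} (n≤1+n 3)))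
            ; lower = ≤-trans (≤-reflexive (*-identityʳ Y)) (h₂ i) }
          ... | false = record
            { upper = ≤-trans (X≤3b i e) (≤-trans (*-monoˡ-≤ b {3} {4} (n≤1+n 3)) (m≤n+m _ (Y * 0)))
            ; lower = ≤-trans (≤-reflexive (*-zeroʳ Y)) z≤n }
          ring : ∀ b → 3 * b + 3 * b ≡ 6 * b
          ring = solve-∀
          mixed : ∀ i i′ → τ (u i) ≡ true → τ (u i′) ≡ false → Y ≤ 6 * b
          mixed i i′ _ e = ≤-trans (h₂ i′) (≤-trans (+-monoˡ-≤ (3 * b) (X≤3b i′ e)) (≤-reflexive (ring b)))

        -- The opposite case: now a row inside the cut is the exceptional one, since it gives
        -- `Y ≤ 2 * X i ≤ 4 * b`.
        extreme : (∀ i → X i ≤ 2 * b) → Good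
        extreme h = profile , mixed
          where
          profile : ∀ i → Profile (X i) Y b (τ (u i))
          profile i with τ (u i) in e
          ... | true = record
            { upper = ≤-trans (h i) (≤-trans (*-monoˡ-≤ b {2} {4} (s≤s (s≤s z≤n))) (m≤n+m _ (Y * 1)))
            ; lower = ≤-trans (≤-reflexive (*-identityʳ Y)) (≤-trans (τ-Y i e) (≤-trans (≤-reflexive (double (X i)))
                        (+-monoʳ-≤ (X i) (≤-trans (h i) (*-monoˡ-≤ b {2} {3} (n≤1+n 2)))))) }
          ... | false = record
            { upper = ≤-trans (h i) (≤-trans (*-monoˡ-≤ b {2} {4} (s≤s (s≤s z≤n))) (m≤n+m _ (Y * 0)))
            ; lower = ≤-trans (≤-reflexive (*-zeroʳ Y)) z≤n }
          ring : ∀ b → 2 * (2 * b) + 2 * b ≡ 6 * b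
          ring = solve-∀
          mixed : ∀ i i′ → τ (u i) ≡ true → τ (u i′) ≡ false → Y ≤ 6 * b
          mixed i i′ e _ = ≤-trans (τ-Y i e) (≤-trans (*-monoʳ-≤ 2 (h i)) (≤-trans (m≤m+n _ (2 * b)) (≤-reflexive (ring b))))

        many-bad : Y ≤ 4 * b → (∀ i → X i ≤ 4 * b) → Good
        many-bad h h′ = profile , λ _ _ _ _ → ≤-trans h (*-monoˡ-≤ b {4} {6} (s≤s (s≤s (s≤s (s≤s z≤n)))))
          where
          ring : ∀ x b → 2 * x + 4 * b ≡ 2 * (x + 2 * b)
          ring = solve-∀
          profile : ∀ i → Profile (X i) Y b (τ (u i))
          profile i with τ (u i) in e
          ... | true = record
            { upper = ≤-trans (h′ i) (m≤n+m _ (Y * 1))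
            ; lower = ≤-trans (≤-reflexive (*-identityʳ Y)) (≤-trans (*-cancelˡ-≤ 2 (≤-trans (≤-reflexive (double Y))
                        (≤-trans (+-mono-≤ (τ-Y i e) h) (≤-reflexive (ring (X i) b)))))
                        (+-monoʳ-≤ (X i) (*-monoˡ-≤ b {2} {3} (n≤1+n 2)))) }
          ... | false = record
            { upper = ≤-trans (h′ i) (m≤n+m _ (Y * 0))
            ; lower = ≤-trans (≤-reflexive (*-zeroʳ Y)) z≤n }

        -- Each fibre density is within 2p of the mean of all, which is within p of t/n; hence the 3
        -- in `3 * b`. The same holds for the complements with n - t, and the minimum of the two is
        -- near d/n.
        all-close : (∀ i i′ → Close i i′) → Good
        all-close close = balanced above below
          where
          open ≤-Reasoning
          Q = ∑ (allFin n) (q ∘ u)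
          q-≤ : ∀ i → n * (Nᵐ * q (u i)) ≤ Nᵐ * (t * L) + 3 * b
          q-≤ i = begin
            n * (Nᵐ * q (u i)) ≡⟨ sym (∑-const-Fin n _) ⟩
            (∑[ _ ∈ allFin n ] Nᵐ * q (u i)) ≤⟨ ∑-mono (allFin n) (λ i′ → close-q (close i i′)) ⟩
            (∑[ i′ ∈ allFin n ] (Nᵐ * q (u i′) + 2 * B * L)) ≡⟨ trans (∑-+ (allFin n) _ _) (cong₂ _+_ (∑-*ˡ (allFin n) Nᵐ (q ∘ u)) (∑-const-Fin n (2 * B * L))) ⟩
            Nᵐ * Q + n * (2 * B * L) ≤⟨ +-monoˡ-≤ _ ∑q-≤ ⟩
            Nᵐ * (t * L) + n * (B * L) + n * (2 * B * L) ≡⟨ ring (Nᵐ * (t * L)) n B L ⟩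
            Nᵐ * (t * L) + 3 * (n * (B * L)) ∎
            where
            ring : ∀ z n B L → z + n * (B * L) + n * (2 * B * L) ≡ z + 3 * (n * (B * L))
            ring = solve-∀
          q-≥ : ∀ i → Nᵐ * (t * L) ≤ n * (Nᵐ * q (u i)) + 3 * b
          q-≥ i = begin
            Nᵐ * (t * L) ≤⟨ ∑q-≥ t≤n ⟩
            Nᵐ * Q + n * (B * L) ≡⟨ cong (_+ n * (B * L)) (sym (∑-*ˡ (allFin n) Nᵐ (q ∘ u))) ⟩
            (∑[ i′ ∈ allFin n ] Nᵐ * q (u i′)) + n * (B * L) ≤⟨ +-monoˡ-≤ _ (∑-mono (allFin n) (λ i′ → close-q (close i′ i))) ⟩
            (∑[ _ ∈ allFin n ] (Nᵐ * q (u i) + 2 * B * L)) + n * (B * L) ≡⟨ cong (_+ n * (B * L)) (∑-const-Fin n _) ⟩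
            n * (Nᵐ * q (u i) + 2 * B * L) + n * (B * L) ≡⟨ ring n (Nᵐ * q (u i)) B L ⟩
            n * (Nᵐ * q (u i)) + 3 * (n * (B * L)) ∎
            where
            ring : ∀ n z B L → n * (z + 2 * B * L) + n * (B * L) ≡ n * z + 3 * (n * (B * L))
            ring = solve-∀
          whole : ∀ i → n * (Nᵐ * q (u i)) + n * (Nᵐ * q̄ (u i)) ≡ Nᵐ * (t * L) + Nᵐ * ((n ∸ t) * L)
          whole i = begin-equality
            n * (Nᵐ * q (u i)) + n * (Nᵐ * q̄ (u i)) ≡⟨ ring n Nᵐ (q (u i)) (q̄ (u i)) ⟩
            n * (Nᵐ * (q (u i) + q̄ (u i))) ≡⟨ cong₂ (λ x y → x * (Nᵐ * y)) (sym (m+[n∸m]≡n t≤n)) (q+q̄ (u i)) ⟩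
            (t + (n ∸ t)) * (Nᵐ * L) ≡⟨ ring′ t (n ∸ t) Nᵐ L ⟩
            Nᵐ * (t * L) + Nᵐ * ((n ∸ t) * L) ∎
            where
            ring : ∀ n N x y → n * (N * x) + n * (N * y) ≡ n * (N * (x + y))
            ring = solve-∀
            ring′ : ∀ t r N L → (t + r) * (N * L) ≡ N * (t * L) + N * (r * L)
            ring′ = solve-∀
          complement : ∀ {x y z w} c → x + y ≡ z + w → z ≤ x + c → y ≤ w + c
          complement {x} {y} {z} {w} c e h = +-cancelˡ-≤ z _ _ (begin
            z + y ≤⟨ +-monoˡ-≤ y h ⟩
            x + c + y ≡⟨ ring x c y ⟩
            x + y + c ≡⟨ cong (_+ c) e ⟩
            z + w + c ≡⟨ +-assoc z w c ⟩
            z + (w + c) ∎)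
            where
            ring : ∀ x c y → x + c + y ≡ x + y + c
            ring = solve-∀
          q̄-≤ : ∀ i → n * (Nᵐ * q̄ (u i)) ≤ Nᵐ * ((n ∸ t) * L) + 3 * b
          q̄-≤ i = complement (3 * b) (whole i) (q-≥ i)
          q̄-≥ : ∀ i → Nᵐ * ((n ∸ t) * L) ≤ n * (Nᵐ * q̄ (u i)) + 3 * b
          q̄-≥ i = complement (3 * b) (sym (whole i)) (q-≤ i)
          scale : ∀ c → Nᵐ * (c * L) ≡ c * (Nᵐ * L)
          scale c = comm Nᵐ c L
            where
            comm : ∀ x y z → x * (y * z) ≡ y * (x * z)
            comm = solve-∀
          nN-mono : ∀ {x y} → x ≤ y → n * (Nᵐ * x) ≤ n * (Nᵐ * y)
          nN-mono h = *-monoʳ-≤ n (*-monoʳ-≤ Nᵐ h)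
          above : ∀ i → X i ≤ Y + 3 * b
          above i = case d-min of λ
            { (inj₁ d≡t) → ≤-trans (nN-mono (m⊓n≤m (q (u i)) _)) (≤-trans (q-≤ i) (≤-reflexive (to-Y d≡t)))
            ; (inj₂ d≡n∸t) → ≤-trans (nN-mono (m⊓n≤n (q (u i)) _)) (≤-trans (q̄-≤ i) (≤-reflexive (to-Y d≡n∸t))) }
            where
            to-Y : ∀ {c} → d ≡ c → Nᵐ * (c * L) + 3 * b ≡ Y + 3 * b
            to-Y refl = cong (_+ 3 * b) (scale d)
          below : ∀ i → Y ≤ X i + 3 * b
          below i with ≤-total (q (u i)) (q̄ (u i))
          ... | inj₁ h rewrite m≤n⇒m⊓n≡m h = ≤-trans (*-monoˡ-≤ (Nᵐ * L) d≤t) (≤-trans (≤-reflexive (sym (scale t))) (q-≥ i))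
          ... | inj₂ h rewrite m≥n⇒m⊓n≡n h = ≤-trans (*-monoˡ-≤ (Nᵐ * L) d≤n∸t) (≤-trans (≤-reflexive (sym (scale (n ∸ t)))) (q̄-≥ i))

        all-extreme : (∀ i → FatLayer i ⊎ ThinLayer i) → Good
        all-extreme fat-or-thin = extreme λ i → begin
          n * (Nᵐ * D (u i)) ≤⟨ *-monoʳ-≤ n (small i (fat-or-thin i)) ⟩
          n * (2 * B * L) ≡⟨ ring n B L ⟩
          2 * (n * (B * L)) ∎
          where
          open ≤-Reasoning
          ring : ∀ n B L → n * (2 * B * L) ≡ 2 * (n * (B * L))
          ring = solve-∀
          small : ∀ i → FatLayer i ⊎ ThinLayer i → Nᵐ * D (u i) ≤ 2 * B * L
          small i (inj₂ thin) = ≤-trans (*-monoʳ-≤ Nᵐ (m⊓n≤m (q (u i)) _)) thin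
          small i (inj₁ fat) = ≤-trans (*-monoʳ-≤ Nᵐ (m⊓n≤n (q (u i)) _)) (+-cancelˡ-≤ (Nᵐ * q (u i)) _ _ (begin
            Nᵐ * q (u i) + Nᵐ * q̄ (u i) ≡⟨ sym (*-distribˡ-+ Nᵐ _ _) ⟩
            Nᵐ * (q (u i) + q̄ (u i)) ≡⟨ cong (Nᵐ *_) (q+q̄ (u i)) ⟩
            Nᵐ * L ≤⟨ fat ⟩
            Nᵐ * q (u i) + 2 * B * L ∎))

        half : ∀ {x y z} → 2 * x ≤ y → n * (Nᵐ * L) ≡ z → z ≤ 2 * (4 * b) → y ≤ n * (Nᵐ * L) → x ≤ 4 * b
        half h refl h′ h″ = *-cancelˡ-≤ 2 (≤-trans h (≤-trans h″ h′))

        few-good : Nᵐ ≤ 8 * B → Good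
        few-good h = many-bad (half {z = n * (Nᵐ * L)} (≤-reflexive (sym (*-assoc 2 d (Nᵐ * L)))) refl total (*-monoˡ-≤ (Nᵐ * L) 2d≤n))
          λ i → half {z = n * (Nᵐ * L)} ≤-refl refl total (≤-trans (≤-reflexive (ring₁ n Nᵐ (D (u i)))) (*-monoʳ-≤ n (*-monoʳ-≤ Nᵐ (2D≤L (u i)))))
          where
          open ≤-Reasoning
          ring₁ : ∀ n N D → 2 * (n * (N * D)) ≡ n * (N * (2 * D))
          ring₁ = solve-∀
          ring₂ : ∀ n B L → n * (8 * B * L) ≡ 2 * (4 * (n * (B * L)))
          ring₂ = solve-∀
          total : n * (Nᵐ * L) ≤ 2 * (4 * b)
          total = begin
            n * (Nᵐ * L) ≤⟨ *-monoʳ-≤ n (*-monoˡ-≤ L h) ⟩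
            n * (8 * B * L) ≡⟨ ring₂ n B L ⟩
            2 * (4 * (n * (B * L))) ∎

      good : Good
      good = case Nᵐ ≤? 8 * B of λ
        { (yes h) → few-good h
        ; (no h) → case layers-dichotomy (≰⇒> h) of λ
          { (inj₁ c) → all-close c
          ; (inj₂ e) → all-extreme e } }

    N ν ν̄ : ℕ
    N = Nʲ * Nᵐ
    ν = ∑[ u ∈ allTuples n j ] 𝟙 (τ u)
    ν̄ = ∑[ u ∈ allTuples n j ] 𝟙 (not (τ u))

    private
      Us = matchings n j

      N≢0 : NonZero N
      N≢0 = >-nonZero (*-mono-≤ (#matchings-pos n j) (#matchings-pos n m))

      average : ∀ c (g : Tuple n j → ℕ) → W * (∑[ U ∈ Us ] c * g (lookup U i₀)) ≡ c * (Nʲ * ∑ (allTuples n j) g)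
      average c g = begin
        W * (∑[ U ∈ Us ] c * g (lookup U i₀)) ≡⟨ cong (W *_) (∑-*ˡ Us c _) ⟩
        W * (c * (∑[ U ∈ Us ] g (lookup U i₀))) ≡⟨ comm W c _ ⟩
        c * (W * (∑[ U ∈ Us ] g (lookup U i₀))) ≡⟨ cong (c *_) (matchings-single j 2≤n i₀ g) ⟩
        c * (Nʲ * ∑ (allTuples n j) g) ∎
        where
        open ≡-Reasoning
        comm : ∀ x y z → x * (y * z) ≡ y * (x * z)
        comm = solve-∀

      ∑b : ∀ c → ∑[ U ∈ Us ] c * (n * (badAt U * L)) ≡ c * (n * (bads * L))
      ∑b c = trans (∑-*ˡ Us c _) (cong (c *_) (trans (∑-*ˡ Us n _) (cong (n *_) (∑-*ʳ Us badAt L))))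

      ∑X : W * (∑[ U ∈ Us ] n * (Nᵐ * D (lookup U i₀))) ≡ n * Nᵐ * (Nʲ * Dsum)
      ∑X = trans (cong (W *_) (∑-cong Us λ U → sym (*-assoc n Nᵐ _))) (average (n * Nᵐ) D)

    module _ (few : 16 * (n * bads) ≤ d * N) where

      -- `Profile.upper` averaged over matchings, row `i₀` being uniform. The error 4p is at most a
      -- quarter of d/n by `few`; in `D-lower` the error 3p becomes 3/16 of d/n.
      D-upper : 4 * (n * Dsum) ≤ 4 * (d * (L * ν)) + d * K
      D-upper = *-cancelˡ-≤ N {{N≢0}} (begin
        N * (4 * (n * Dsum)) ≡⟨ ring₁ Nʲ Nᵐ n Dsum ⟩
        4 * (n * Nᵐ * (Nʲ * Dsum)) ≡⟨ cong (4 *_) (sym ∑X) ⟩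
        4 * (W * (∑[ U ∈ Us ] n * (Nᵐ * D (lookup U i₀)))) ≤⟨ *-monoʳ-≤ 4 (*-monoʳ-≤ W (∑-mono Us λ U → Profile.upper (proj₁ (At.good U) i₀))) ⟩
        4 * (W * (∑[ U ∈ Us ] (d * (Nᵐ * L) * 𝟙 (τ (lookup U i₀)) + 4 * (n * (badAt U * L)))))
          ≡⟨ cong (λ z → 4 * (W * z)) (∑-+ Us _ _) ⟩
        4 * (W * ((∑[ U ∈ Us ] d * (Nᵐ * L) * 𝟙 (τ (lookup U i₀))) + (∑[ U ∈ Us ] 4 * (n * (badAt U * L)))))
          ≡⟨ cong (4 *_) (trans (*-distribˡ-+ W _ _) (cong₂ _+_ (average (d * (Nᵐ * L)) (𝟙 ∘ τ)) (cong (W *_) (∑b 4)))) ⟩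
        4 * (d * (Nᵐ * L) * (Nʲ * ν) + W * (4 * (n * (bads * L)))) ≡⟨ ring₂ d Nᵐ L Nʲ ν W n bads ⟩
        Nʲ * Nᵐ * (4 * (d * (L * ν))) + 16 * (n * bads) * (W * L) ≤⟨ +-monoʳ-≤ _ (*-monoˡ-≤ (W * L) few) ⟩
        Nʲ * Nᵐ * (4 * (d * (L * ν))) + d * (Nʲ * Nᵐ) * (W * L) ≡⟨ ring₃ (Nʲ * Nᵐ) (4 * (d * (L * ν))) d (W * L) ⟩
        N * (4 * (d * (L * ν)) + d * K) ∎)
        where
        open ≤-Reasoning
        ring₁ : ∀ a b n D → a * b * (4 * (n * D)) ≡ 4 * (n * b * (a * D))
        ring₁ = solve-∀
        ring₂ : ∀ d b L a ν W n B → 4 * (d * (b * L) * (a * ν) + W * (4 * (n * (B * L)))) ≡ a * b * (4 * (d * (L * ν))) + 16 * (n * B) * (W * L)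
        ring₂ = solve-∀
        ring₃ : ∀ N x d K → N * x + d * N * K ≡ N * (x + d * K)
        ring₃ = solve-∀

      D-lower : 16 * (d * (L * ν)) ≤ 16 * (n * Dsum) + 3 * (d * K)
      D-lower = *-cancelˡ-≤ N {{N≢0}} (begin
        N * (16 * (d * (L * ν))) ≡⟨ ring₁ Nʲ Nᵐ d L ν ⟩
        16 * (d * (Nᵐ * L) * (Nʲ * ν)) ≡⟨ cong (16 *_) (sym (average (d * (Nᵐ * L)) (𝟙 ∘ τ))) ⟩
        16 * (W * (∑[ U ∈ Us ] d * (Nᵐ * L) * 𝟙 (τ (lookup U i₀)))) ≤⟨ *-monoʳ-≤ 16 (*-monoʳ-≤ W (∑-mono Us λ U → Profile.lower (proj₁ (At.good U) i₀))) ⟩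
        16 * (W * (∑[ U ∈ Us ] (n * (Nᵐ * D (lookup U i₀)) + 3 * (n * (badAt U * L)))))
          ≡⟨ cong (λ z → 16 * (W * z)) (∑-+ Us _ _) ⟩
        16 * (W * ((∑[ U ∈ Us ] n * (Nᵐ * D (lookup U i₀))) + (∑[ U ∈ Us ] 3 * (n * (badAt U * L)))))
          ≡⟨ cong (16 *_) (trans (*-distribˡ-+ W _ _) (cong₂ _+_ ∑X (cong (W *_) (∑b 3)))) ⟩
        16 * (n * Nᵐ * (Nʲ * Dsum) + W * (3 * (n * (bads * L)))) ≡⟨ ring₂ n Nᵐ Nʲ Dsum W bads L ⟩
        Nʲ * Nᵐ * (16 * (n * Dsum)) + 3 * (16 * (n * bads)) * (W * L) ≤⟨ +-monoʳ-≤ _ (*-monoˡ-≤ (W * L) (*-monoʳ-≤ 3 few)) ⟩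
        Nʲ * Nᵐ * (16 * (n * Dsum)) + 3 * (d * (Nʲ * Nᵐ)) * (W * L) ≡⟨ ring₃ (Nʲ * Nᵐ) (16 * (n * Dsum)) d (W * L) ⟩
        N * (16 * (n * Dsum) + 3 * (d * K)) ∎)
        where
        open ≤-Reasoning
        ring₁ : ∀ a b d L ν → a * b * (16 * (d * (L * ν))) ≡ 16 * (d * (b * L) * (a * ν))
        ring₁ = solve-∀
        ring₂ : ∀ n b a D W B L → 16 * (n * b * (a * D) + W * (3 * (n * (B * L)))) ≡ a * b * (16 * (n * D)) + 3 * (16 * (n * B)) * (W * L)
        ring₂ = solve-∀
        ring₃ : ∀ N x d K → N * x + 3 * (d * N) * K ≡ N * (x + 3 * (d * K))
        ring₃ = solve-∀

      private
        crossing : Tuple n j → Tuple n j → ℕ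
        crossing x y = 𝟙 (τ x) * 𝟙 (not (τ y))

        cutSize : Vec (Tuple n j) n → ℕ
        cutSize U = ∑² n λ i i′ → crossing (lookup U i) (lookup U i′)

        e E : ℕ
        e = ∑ᵈ n j crossing
        E = (n ∸ 1) ^ j

        4cutSize≤n² : ∀ U → 4 * cutSize U ≤ n * n
        4cutSize≤n² U = begin
          4 * cutSize U ≤⟨ *-monoʳ-≤ 4 (∑-mono (allFin n) λ i → ∑-mono (allFin n) λ i′ → drop (ne i i′) _) ⟩
          4 * (∑[ i ∈ allFin n ] ∑[ i′ ∈ allFin n ] crossing (lookup U i) (lookup U i′)) ≡⟨ cong (4 *_) (sym (∑-product (allFin n) (allFin n) _ _)) ⟩
          4 * (r * r̄) ≡⟨ ring₁ r r̄ ⟩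
          2 * (r * r̄) + 2 * (r * r̄) ≤⟨ +-monoˡ-≤ _ (2xy≤x²+y² r r̄) ⟩
          r * r + r̄ * r̄ + 2 * (r * r̄) ≡⟨ ring₂ r r̄ ⟩
          (r + r̄) * (r + r̄) ≡⟨ cong (λ z → z * z) total ⟩
          n * n ∎
          where
          open ≤-Reasoning
          r = ∑[ i ∈ allFin n ] 𝟙 (τ (lookup U i))
          r̄ = ∑[ i ∈ allFin n ] 𝟙 (not (τ (lookup U i)))
          total : r + r̄ ≡ n
          total = trans (sym (∑-+ (allFin n) _ _)) (trans (∑-cong (allFin n) λ i → 𝟙-not (τ (lookup U i))) (trans (∑-const-Fin n 1) (*-identityʳ n)))
          drop : ∀ b x → 𝟙 b * x ≤ x
          drop true x = ≤-reflexive (+-identityʳ x)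
          drop false x = z≤n
          ring₁ : ∀ x y → 4 * (x * y) ≡ 2 * (x * y) + 2 * (x * y)
          ring₁ = solve-∀
          ring₂ : ∀ x y → x * x + y * y + 2 * (x * y) ≡ (x + y) * (x + y)
          ring₂ = solve-∀

        -- Only a matching with rows on both sides contributes to the left, and it satisfies
        -- `Y ≤ 6 * b`; it has at most n²/4 crossing ordered pairs of rows.
        cut-bads : ∀ U → 4 * (d * (Nᵐ * L)) * cutSize U ≤ 6 * (n * n) * (n * (badAt U * L))
        cut-bads U = begin
          4 * Y * cutSize U ≡⟨ *-assoc 4 Y (cutSize U) ⟩
          4 * (Y * cutSize U) ≤⟨ *-monoʳ-≤ 4 Y-cut ⟩
          4 * (6 * b * cutSize U) ≡⟨ ring₁ b (cutSize U) ⟩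
          6 * b * (4 * cutSize U) ≤⟨ *-monoʳ-≤ (6 * b) (4cutSize≤n² U) ⟩
          6 * b * (n * n) ≡⟨ ring₂ b (n * n) ⟩
          6 * (n * n) * b ∎
          where
          open ≤-Reasoning
          open At U using (Y; b; good)
          ring₁ : ∀ b c → 4 * (6 * b * c) ≡ 6 * b * (4 * c)
          ring₁ = solve-∀
          ring₂ : ∀ b c → 6 * b * c ≡ 6 * c * b
          ring₂ = solve-∀
          pointwise : ∀ x y → (x ≡ true → y ≡ false → Y ≤ 6 * b) → Y * (𝟙 x * 𝟙 (not y)) ≤ 6 * b * (𝟙 x * 𝟙 (not y))
          pointwise true true h = ≤-reflexive (trans (*-zeroʳ Y) (sym (*-zeroʳ (6 * b))))
          pointwise true false h = *-monoˡ-≤ 1 (h refl refl)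
          pointwise false y h = ≤-reflexive (trans (*-zeroʳ Y) (sym (*-zeroʳ (6 * b))))
          Y-cut : Y * cutSize U ≤ 6 * b * cutSize U
          Y-cut = begin
            Y * cutSize U ≡⟨ sym (∑²-*ˡ n Y _) ⟩
            ∑² n (λ i i′ → Y * crossing (lookup U i) (lookup U i′))
              ≤⟨ ∑²-mono n (λ i i′ → pointwise (τ (lookup U i)) (τ (lookup U i′)) (proj₂ good i i′)) ⟩
            ∑² n (λ i i′ → 6 * b * crossing (lookup U i) (lookup U i′)) ≡⟨ ∑²-*ˡ n (6 * b) _ ⟩
            6 * b * cutSize U ∎

        ∑cutSize : W * E * (∑[ U ∈ Us ] cutSize U) ≡ n * (n ∸ 1) * (Nʲ * e)
        ∑cutSize = begin
          W * E * (∑[ U ∈ Us ] cutSize U) ≡⟨ cong (W * E *_) (sym (∑²-∑ n Us _)) ⟩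
          W * E * ∑² n (λ i i′ → ∑[ U ∈ Us ] crossing (lookup U i) (lookup U i′)) ≡⟨ sym (∑²-*ˡ n (W * E) _) ⟩
          ∑² n (λ i i′ → W * E * (∑[ U ∈ Us ] crossing (lookup U i) (lookup U i′)))
            ≡⟨ ∑-cong (allFin n) (λ i → ∑-cong (allFin n) λ i′ → marginal i i′) ⟩
          ∑² n (λ _ _ → Nʲ * e) ≡⟨ ∑²-const n _ ⟩
          n * (n ∸ 1) * (Nʲ * e) ∎
          where
          open ≡-Reasoning
          marginal : ∀ i i′ → 𝟙 (ne i i′) * (W * E * (∑[ U ∈ Us ] crossing (lookup U i) (lookup U i′))) ≡ 𝟙 (ne i i′) * (Nʲ * e)
          marginal i i′ with i ≟F i′
          ... | yes _ = refl
          ... | no i≢i′ = cong (1 *_) (matchings-pair j i≢i′ crossing)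

        -- A Markov bound. Matchings crossed by the cut have a proportion at least d/6n of bad
        -- completions, so their probability is at most 6np/d ≤ 6/16. Among the n(n-1) ordered pairs
        -- of rows at most n²/4 cross, and each pair of rows is a uniform disjoint pair; this yields
        -- 6/64.
        e-small : 64 * ((n ∸ 1) * e) ≤ 6 * (n * (W * E))
        e-small = *-cancelˡ-≤ (d * N * L * n) {{nz}} (begin
          d * (Nʲ * Nᵐ) * L * n * (64 * ((n ∸ 1) * e)) ≡⟨ ring₁ d Nʲ Nᵐ L n (n ∸ 1) e ⟩
          16 * (4 * (d * (Nᵐ * L)) * (n * (n ∸ 1) * (Nʲ * e))) ≡⟨ cong (λ z → 16 * (4 * (d * (Nᵐ * L)) * z)) (sym ∑cutSize) ⟩
          16 * (4 * (d * (Nᵐ * L)) * (W * E * (∑[ U ∈ Us ] cutSize U))) ≡⟨ ring₂ (4 * (d * (Nᵐ * L))) (W * E) _ ⟩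
          16 * (W * E) * (4 * (d * (Nᵐ * L)) * (∑[ U ∈ Us ] cutSize U)) ≡⟨ cong (16 * (W * E) *_) (sym (∑-*ˡ Us (4 * (d * (Nᵐ * L))) cutSize)) ⟩
          16 * (W * E) * (∑[ U ∈ Us ] 4 * (d * (Nᵐ * L)) * cutSize U) ≤⟨ *-monoʳ-≤ (16 * (W * E)) (∑-mono Us cut-bads) ⟩
          16 * (W * E) * (∑[ U ∈ Us ] 6 * (n * n) * (n * (badAt U * L))) ≡⟨ cong (16 * (W * E) *_) (∑b (6 * (n * n))) ⟩
          16 * (W * E) * (6 * (n * n) * (n * (bads * L))) ≡⟨ ring₃ (W * E) n bads L ⟩
          16 * (n * bads) * (6 * (n * n) * (W * E) * L) ≤⟨ *-monoˡ-≤ _ few ⟩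
          d * (Nʲ * Nᵐ) * (6 * (n * n) * (W * E) * L) ≡⟨ ring₄ (d * (Nʲ * Nᵐ)) n (W * E) L ⟩
          d * (Nʲ * Nᵐ) * L * n * (6 * (n * (W * E))) ∎)
          where
          open ≤-Reasoning
          nz : NonZero (d * N * L * n)
          nz = m*n≢0 (d * N * L) n {{m*n≢0 (d * N) L {{m*n≢0 d N {{>-nonZero 0<d}} {{N≢0}}}} {{>-nonZero L>0}}}} {{n≢0}}
          ring₁ : ∀ d a b L n p e → d * (a * b) * L * n * (64 * (p * e)) ≡ 16 * (4 * (d * (b * L)) * (n * p * (a * e)))
          ring₁ = solve-∀
          ring₂ : ∀ x y z → 16 * (x * (y * z)) ≡ 16 * y * (x * z)
          ring₂ = solve-∀
          ring₃ : ∀ w n B L → 16 * w * (6 * (n * n) * (n * (B * L))) ≡ 16 * (n * B) * (6 * (n * n) * w * L)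
          ring₃ = solve-∀
          ring₄ : ∀ x n w L → x * (6 * (n * n) * w * L) ≡ x * L * n * (6 * (n * w))
          ring₄ = solve-∀

        3n≤4[n-2] : 3 * n ≤ 4 * (n ∸ 2)
        3n≤4[n-2] = go 8≤n
          where
          ring : ∀ r → 3 * (8 + r) + r ≡ 4 * (6 + r)
          ring = solve-∀
          go : ∀ {n} → 8 ≤ n → 3 * n ≤ 4 * (n ∸ 2)
          go {n} h = subst (λ z → 3 * z ≤ 4 * (z ∸ 2)) (m+[n∸m]≡n h) (≤-trans (m≤m+n _ (n ∸ 8)) (≤-reflexive (ring (n ∸ 8))))

      -- Expansion against `e-small`: for n ≥ 8 the factor n/(n-2) is at most 4/3 and turns 6/64
      -- into 1/8.
      ν-cut : 8 * (ν * ν̄) ≤ W * W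
      ν-cut = *-cancelˡ-≤ (8 * ((n ∸ 2) * E)) {{nz}} (begin
        8 * ((n ∸ 2) * E) * (8 * (ν * ν̄)) ≡⟨ ring₁ (n ∸ 2) E (ν * ν̄) ⟩
        64 * ((n ∸ 2) * E * (ν * ν̄)) ≤⟨ *-monoʳ-≤ 64 (disjoint-cut 2≤n j τ) ⟩
        64 * (W * (n ∸ 1) * e) ≡⟨ ring₂ W (n ∸ 1) e ⟩
        W * (64 * ((n ∸ 1) * e)) ≤⟨ *-monoʳ-≤ W e-small ⟩
        W * (6 * (n * (W * E))) ≡⟨ ring₃ W n E ⟩
        2 * (3 * n) * (W * W * E) ≤⟨ *-monoˡ-≤ (W * W * E) (*-monoʳ-≤ 2 3n≤4[n-2]) ⟩
        2 * (4 * (n ∸ 2)) * (W * W * E) ≡⟨ ring₄ (n ∸ 2) W E ⟩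
        8 * ((n ∸ 2) * E) * (W * W) ∎)
        where
        open ≤-Reasoning
        pos : ∀ {n} → 8 ≤ n → NonZero (8 * ((n ∸ 2) * (n ∸ 1) ^ j))
        pos {suc (suc (suc r))} h = m*n≢0 8 _ {{_}} {{m*n≢0 (suc r) _ {{_}} {{m^n≢0 (2 + r) j}}}}
        pos {suc (suc zero)} (s≤s (s≤s ()))
        pos {suc zero} (s≤s ())
        nz = pos 8≤n
        ring₁ : ∀ p E x → 8 * (p * E) * (8 * x) ≡ 64 * (p * E * x)
        ring₁ = solve-∀
        ring₂ : ∀ W p e → 64 * (W * p * e) ≡ W * (64 * (p * e))
        ring₂ = solve-∀
        ring₃ : ∀ W n E → W * (6 * (n * (W * E))) ≡ 2 * (3 * n) * (W * W * E)
        ring₃ = solve-∀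
        ring₄ : ∀ p W E → 2 * (4 * p) * (W * W * E) ≡ 8 * (p * E) * (W * W)
        ring₄ = solve-∀

      -- τ would be a cut of density between 1/4 and 13/16, which has more crossing disjoint pairs than ν-cut allows.
      window-impossible : 4 * (d * K) < 8 * (n * Dsum) → 8 * (n * Dsum) ≤ 5 * (d * K) → ⊥
      window-impossible lo hi = <⇒≱ (m<m+n (64 * (ν * ν̄)) {W * W} (*-mono-≤ W>0 W>0)) (begin
        64 * (ν * ν̄) + W * W ≤⟨ +-monoˡ-≤ (W * W) (≤-trans (≤-reflexive (ring₅ (ν * ν̄))) (*-monoʳ-≤ 8 ν-cut)) ⟩
        8 * (W * W) + W * W ≤⟨ +-cancelʳ-≤ (3 * W * W) _ _ product ⟩
        64 * (ν * ν̄) ∎)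
        where
        open ≤-Reasoning
        total : ν + ν̄ ≡ W
        total = trans (sym (∑-+ (allTuples n j) _ _)) (trans (∑-cong (allTuples n j) λ u → 𝟙-not (τ u)) (trans (∑-const-tuples n j 1) (*-identityʳ W)))
        dL≢0 : NonZero (d * L)
        dL≢0 = m*n≢0 d L {{>-nonZero 0<d}} {{>-nonZero L>0}}
        W≤4ν : W ≤ 4 * ν
        W≤4ν = *-cancelˡ-≤ (d * L) {{dL≢0}} (*-cancelˡ-≤ 2 (+-cancelʳ-≤ (2 * (d * K)) _ _ (begin
          2 * (d * L * W) + 2 * (d * (W * L)) ≡⟨ ring₁ d L W ⟩
          4 * (d * (W * L)) ≤⟨ <⇒≤ lo ⟩
          8 * (n * Dsum) ≡⟨ ring₂ (n * Dsum) ⟩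
          2 * (4 * (n * Dsum)) ≤⟨ *-monoʳ-≤ 2 D-upper ⟩
          2 * (4 * (d * (L * ν)) + d * K) ≡⟨ ring₃ d L ν (d * K) ⟩
          2 * (d * L * (4 * ν)) + 2 * (d * K) ∎)))
          where
          ring₁ : ∀ d L W → 2 * (d * L * W) + 2 * (d * (W * L)) ≡ 4 * (d * (W * L))
          ring₁ = solve-∀
          ring₂ : ∀ x → 8 * x ≡ 2 * (4 * x)
          ring₂ = solve-∀
          ring₃ : ∀ d L ν z → 2 * (4 * (d * (L * ν)) + z) ≡ 2 * (d * L * (4 * ν)) + 2 * z
          ring₃ = solve-∀
        16ν≤13W : 16 * ν ≤ 13 * W
        16ν≤13W = *-cancelˡ-≤ (d * L) {{dL≢0}} (begin
          d * L * (16 * ν) ≡⟨ ring₁ d L ν ⟩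
          16 * (d * (L * ν)) ≤⟨ D-lower ⟩
          16 * (n * Dsum) + 3 * (d * K) ≡⟨ ring₂ (n * Dsum) (d * K) ⟩
          2 * (8 * (n * Dsum)) + 3 * (d * K) ≤⟨ +-monoˡ-≤ _ (*-monoʳ-≤ 2 hi) ⟩
          2 * (5 * (d * K)) + 3 * (d * K) ≡⟨ ring₃ d W L ⟩
          d * L * (13 * W) ∎)
          where
          ring₁ : ∀ d L ν → d * L * (16 * ν) ≡ 16 * (d * (L * ν))
          ring₁ = solve-∀
          ring₂ : ∀ x y → 16 * x + 3 * y ≡ 2 * (8 * x) + 3 * y
          ring₂ = solve-∀
          ring₃ : ∀ d W L → 2 * (5 * (d * (W * L))) + 3 * (d * (W * L)) ≡ d * L * (13 * W)
          ring₃ = solve-∀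
        3W≤16ν̄ : 3 * W ≤ 16 * ν̄
        3W≤16ν̄ = +-cancelˡ-≤ (16 * ν) _ _ (begin
          16 * ν + 3 * W ≤⟨ +-monoˡ-≤ (3 * W) 16ν≤13W ⟩
          13 * W + 3 * W ≡⟨ ring W ⟩
          16 * W ≡⟨ cong (16 *_) (sym total) ⟩
          16 * (ν + ν̄) ≡⟨ *-distribˡ-+ 16 ν ν̄ ⟩
          16 * ν + 16 * ν̄ ∎)
          where
          ring : ∀ W → 13 * W + 3 * W ≡ 16 * W
          ring = solve-∀
        ring₅ : ∀ x → 64 * x ≡ 8 * (8 * x)
        ring₅ = solve-∀
        positive-product : ∀ {a b a′ b′} → a ≤ a′ → b ≤ b′ → a′ * b + a * b′ ≤ a′ * b′ + a * b
        positive-product {a} {b} {a′} {b′} h h′ = begin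
          a′ * b + a * b′ ≡⟨ cong₂ (λ x y → x * b + a * y) (sym (m+[n∸m]≡n h)) (sym (m+[n∸m]≡n h′)) ⟩
          (a + x) * b + a * (b + y) ≤⟨ m≤m+n _ (x * y) ⟩
          (a + x) * b + a * (b + y) + x * y ≡⟨ ring a b x y ⟩
          (a + x) * (b + y) + a * b ≡⟨ cong₂ (λ x y → x * y + a * b) (m+[n∸m]≡n h) (m+[n∸m]≡n h′) ⟩
          a′ * b′ + a * b ∎
          where
          x = a′ ∸ a
          y = b′ ∸ b
          ring : ∀ a b x y → (a + x) * b + a * (b + y) + x * y ≡ (a + x) * (b + y) + a * b
          ring = solve-∀
        -- Multiplying out (4ν - W)(16ν̄ - 3W) ≥ 0 and using ν + ν̄ = W gives 64νν̄ ≥ 9W², just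
        -- above the 8W² that `ν-cut` permits.
        product : 8 * (W * W) + W * W + 3 * W * W ≤ 64 * (ν * ν̄) + 3 * W * W
        product = begin
          8 * (W * W) + W * W + 3 * W * W ≡⟨ ring₆ W ⟩
          12 * (W * W) ≡⟨ cong (λ z → 12 * (W * z)) (sym total) ⟩
          12 * (W * (ν + ν̄)) ≤⟨ m≤m+n _ (4 * (W * ν̄)) ⟩
          12 * (W * (ν + ν̄)) + 4 * (W * ν̄) ≡⟨ ring₇ W ν ν̄ ⟩
          4 * ν * (3 * W) + W * (16 * ν̄) ≤⟨ positive-product W≤4ν 3W≤16ν̄ ⟩
          4 * ν * (16 * ν̄) + W * (3 * W) ≡⟨ ring₈ W ν ν̄ ⟩
          64 * (ν * ν̄) + 3 * W * W ∎
          where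
          ring₆ : ∀ W → 8 * (W * W) + W * W + 3 * W * W ≡ 12 * (W * W)
          ring₆ = solve-∀
          ring₇ : ∀ W x y → 12 * (W * (x + y)) + 4 * (W * y) ≡ 4 * x * (3 * W) + W * (16 * y)
          ring₇ = solve-∀
          ring₈ : ∀ W x y → 4 * x * (16 * y) + W * (3 * W) ≡ 64 * (x * y) + 3 * W * W
          ring₈ = solve-∀

  move : ∀ {j m} → (Tuple n j → Tuple n (suc m) → Bool) → Tuple n (suc j) → Tuple n m → Bool
  move G (c ∷ u) w = G u (c ∷ w)

  -- An influence with prescribed new value `b`. It refers to both arguments of `G` together, so it
  -- survives moving the other coordinates.
  flips : ∀ {j m} → (Tuple n j → Tuple n m → Bool) → Fin m → Fin n → ℕ
  flips {j} {m} G i b = ∑[ u ∈ allTuples n j ] ∑[ v ∈ allTuples n m ] 𝟙 (xor (G u v) (G u (v [ i ]≔ b)))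

  module Move {j m : ℕ} (G : Tuple n j → Tuple n (suc m) → Bool) where

    private
      module S = Split G
      module S′ = Split (move G)

    -- A pair of matchings is a list of independent columns, and badness depends only on the joined
    -- rows; so it does not matter to which side a column is counted.
    move-bads : S′.bads ≡ S.bads
    move-bads = begin
      S′.bads ≡⟨ ∑-matchings n j _ ⟩
      (∑[ π ∈ perms n ] ∑[ U ∈ matchings n j ] ∑[ W ∈ matchings n m ] bad (λ i → move G (lookup (zipWith Vec._∷_ π U) i) (lookup W i)))
        ≡⟨ ∑-cong (perms n) (λ π → ∑-cong (matchings n j) λ U → ∑-cong (matchings n m) λ W → bad-cong λ i →
             trans (cong (λ v → move G v (lookup W i)) (lookup-zip∷ π U i)) (cong (G (lookup U i)) (sym (lookup-zip∷ π W i)))) ⟩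
      (∑[ π ∈ perms n ] ∑[ U ∈ matchings n j ] ∑[ W ∈ matchings n m ] bad (λ i → G (lookup U i) (lookup (zipWith Vec._∷_ π W) i)))
        ≡⟨ ∑-swap (perms n) (matchings n j) _ ⟩
      (∑[ U ∈ matchings n j ] ∑[ π ∈ perms n ] ∑[ W ∈ matchings n m ] bad (λ i → G (lookup U i) (lookup (zipWith Vec._∷_ π W) i)))
        ≡⟨ ∑-cong (matchings n j) (λ U → sym (∑-matchings n m _)) ⟩
      S.bads ∎
      where
      open ≡-Reasoning
      bad : (Fin n → Bool) → ℕ
      bad x = 𝟙 (not ((∑[ i ∈ allFin n ] 𝟙 (x i)) ≡ᵇ t))
      bad-cong : ∀ {x y : Fin n → Bool} → (∀ i → x i ≡ y i) → bad x ≡ bad y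
      bad-cong e = cong (λ z → 𝟙 (not (z ≡ᵇ t))) (∑-cong (allFin n) λ i → cong 𝟙 (e i))

    move-N : S′.N ≡ S.N
    move-N = begin
      #matchings n (suc j) * #matchings n m ≡⟨ cong (_* #matchings n m) (#matchings-suc n j) ⟩
      length (perms n) * #matchings n j * #matchings n m ≡⟨ ring (length (perms n)) (#matchings n j) (#matchings n m) ⟩
      #matchings n j * (length (perms n) * #matchings n m) ≡⟨ cong (#matchings n j *_) (sym (#matchings-suc n m)) ⟩
      #matchings n j * #matchings n (suc m) ∎
      where
      open ≡-Reasoning
      ring : ∀ p a b → p * a * b ≡ a * (p * b)
      ring = solve-∀

    move-K : S′.K ≡ S.K
    move-K = ring n (n ^ j) (n ^ m)
      where
      ring : ∀ n a b → n * a * b ≡ a * (n * b)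
      ring = solve-∀

    move-flips : ∀ i b → flips (move G) i b ≡ flips G (suc i) b
    move-flips i b = begin
      flips (move G) i b ≡⟨ ∑-tuples n j _ ⟩
      (∑[ c ∈ allFin n ] ∑[ u ∈ allTuples n j ] ∑[ w ∈ allTuples n m ] 𝟙 (xor (G u (c ∷ w)) (G u (c ∷ (w [ i ]≔ b)))))
        ≡⟨ ∑-swap (allFin n) (allTuples n j) _ ⟩
      (∑[ u ∈ allTuples n j ] ∑[ c ∈ allFin n ] ∑[ w ∈ allTuples n m ] 𝟙 (xor (G u (c ∷ w)) (G u (c ∷ (w [ i ]≔ b)))))
        ≡⟨ ∑-cong (allTuples n j) (λ u → sym (∑-tuples n m _)) ⟩
      flips G (suc i) b ∎
      where open ≡-Reasoning

    -- Only the loss has to be controlled. The smaller of the two counts in the finer fibre at `b`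
    -- is carried back to the coarser fibre by forcing the moved coordinate to be `b`, at the cost
    -- of the flips; summing over `b` averages this.
    move-D : n * S.Dsum ≤ n * S′.Dsum + (∑[ b ∈ allFin n ] flips G zero b)
    move-D = begin
      n * S.Dsum ≡⟨ sym (∑-const-Fin n S.Dsum) ⟩
      (∑[ b ∈ allFin n ] S.Dsum) ≤⟨ ∑-mono (allFin n) (λ b → ∑-mono (allTuples n j) λ u → at u b) ⟩
      (∑[ b ∈ allFin n ] ∑[ u ∈ allTuples n j ] (n * S′.D (b ∷ u) + flipsAt u b))
        ≡⟨ trans (∑-cong (allFin n) λ b → ∑-+ (allTuples n j) _ _) (∑-+ (allFin n) _ _) ⟩
      (∑[ b ∈ allFin n ] ∑[ u ∈ allTuples n j ] n * S′.D (b ∷ u)) + (∑[ b ∈ allFin n ] flips G zero b)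
        ≡⟨ cong (_+ (∑[ b ∈ allFin n ] flips G zero b)) (trans (sym (∑-tuples n j (λ u → n * S′.D u))) (∑-*ˡ (allTuples n (suc j)) n S′.D)) ⟩
      n * S′.Dsum + (∑[ b ∈ allFin n ] flips G zero b) ∎
      where
      open ≤-Reasoning
      flipsAt : Tuple n j → Fin n → ℕ
      flipsAt u b = ∑[ v ∈ allTuples n (suc m) ] 𝟙 (xor (G u v) (G u (v [ zero ]≔ b)))
      step : ∀ x y → 𝟙 x ≤ 𝟙 y + 𝟙 (xor x y)
      step true true = ≤-refl
      step true false = ≤-refl
      step false _ = z≤n
      step-not : ∀ x y → 𝟙 (not x) ≤ 𝟙 (not y) + 𝟙 (xor x y)
      step-not true _ = z≤n
      step-not false true = ≤-refl
      step-not false false = ≤-refl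
      bound : ∀ (g : Bool → ℕ) → (∀ x y → g x ≤ g y + 𝟙 (xor x y)) → ∀ u b →
        ∑[ v ∈ allTuples n (suc m) ] g (G u v) ≤ n * (∑[ w ∈ allTuples n m ] g (G u (b ∷ w))) + flipsAt u b
      bound g h u b = begin
        (∑[ v ∈ allTuples n (suc m) ] g (G u v)) ≤⟨ ∑-mono (allTuples n (suc m)) (λ v → h (G u v) (G u (v [ zero ]≔ b))) ⟩
        (∑[ v ∈ allTuples n (suc m) ] (g (G u (v [ zero ]≔ b)) + 𝟙 (xor (G u v) (G u (v [ zero ]≔ b))))) ≡⟨ ∑-+ (allTuples n (suc m)) _ _ ⟩
        (∑[ v ∈ allTuples n (suc m) ] g (G u (v [ zero ]≔ b))) + flipsAt u b
          ≡⟨ cong (_+ flipsAt u b) (trans (∑-tuples n m _) (∑-const-Fin n _)) ⟩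
        n * (∑[ w ∈ allTuples n m ] g (G u (b ∷ w))) + flipsAt u b ∎
      at : ∀ u b → S.D u ≤ n * S′.D (b ∷ u) + flipsAt u b
      at u b with ≤-total (S′.q (b ∷ u)) (S′.q̄ (b ∷ u))
      ... | inj₁ h rewrite m≤n⇒m⊓n≡m h = ≤-trans (m⊓n≤m (S.q u) _) (bound 𝟙 step u b)
      ... | inj₂ h rewrite m≥n⇒m⊓n≡n h = ≤-trans (m⊓n≤n (S.q u) _) (bound (𝟙 ∘ not) step-not u b)

  -- Dsum goes to 0 as the coordinates are moved one by one to the left, in steps too small to jump over the window.
  influential-coordinate : ∀ m {j} (G : Tuple n j → Tuple n m → Bool) → let open Split G in
    16 * (n * bads) ≤ d * N → (∀ i b → N * flips G i b ≤ 2 * (bads * K)) → 5 * (d * K) < 8 * (n * Dsum) → ⊥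
  influential-coordinate zero {j} G few small large = <⇒≱ large (≤-trans (≤-reflexive (trans (cong (λ z → 8 * (n * z)) Dsum≡0) (trans (cong (8 *_) (*-zeroʳ n)) refl))) z≤n)
    where
    open Split G
    D≡0 : ∀ u → D u ≡ 0
    D≡0 u with G u []
    ... | true = refl
    ... | false = refl
    Dsum≡0 : Dsum ≡ 0
    Dsum≡0 = trans (∑-cong (allTuples n j) D≡0) (∑-0 (allTuples n j))
  influential-coordinate (suc m) {j} G few small large =
    case 8 * (n * S′.Dsum) ≤? 5 * (d * S′.K) of λ
      { (yes h) → S′.window-impossible few′ in-window h
      ; (no h) → influential-coordinate m (move G) few′ small′ (≰⇒> h) }
    where
    module S = Split G
    module S′ = Split (move G)
    open Move G
    few′ : 16 * (n * S′.bads) ≤ d * S′.N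
    few′ = subst₂ (λ x y → 16 * (n * x) ≤ d * y) (sym move-bads) (sym move-N) few
    small′ : ∀ i b → S′.N * flips (move G) i b ≤ 2 * (S′.bads * S′.K)
    small′ i b = ≤-trans (≤-reflexive (cong₂ _*_ move-N (move-flips i b))) (≤-trans (small (suc i) b)
      (≤-reflexive (cong₂ (λ x y → 2 * (x * y)) (sym move-bads) (sym move-K))))
    N≢0 : NonZero S.N
    N≢0 = >-nonZero (*-mono-≤ (#matchings-pos n j) (#matchings-pos n (suc m)))
    Φ = ∑[ b ∈ allFin n ] flips G zero b
    -- The influence 2p is at most d/8n by `few`, which is exactly the width of the window between
    -- 4/8 and 5/8 of d/n.
    8Φ≤dK : 8 * Φ ≤ d * S.K
    8Φ≤dK = *-cancelˡ-≤ S.N {{N≢0}} (begin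
      S.N * (8 * Φ) ≡⟨ comm S.N 8 Φ ⟩
      8 * (S.N * Φ) ≡⟨ cong (8 *_) (sym (∑-*ˡ (allFin n) S.N _)) ⟩
      8 * (∑[ b ∈ allFin n ] S.N * flips G zero b) ≤⟨ *-monoʳ-≤ 8 (∑-mono (allFin n) (small zero)) ⟩
      8 * (∑[ _ ∈ allFin n ] 2 * (S.bads * S.K)) ≡⟨ cong (8 *_) (∑-const-Fin n _) ⟩
      8 * (n * (2 * (S.bads * S.K))) ≡⟨ ring₁ n S.bads S.K ⟩
      16 * (n * S.bads) * S.K ≤⟨ *-monoˡ-≤ S.K few ⟩
      d * S.N * S.K ≡⟨ ring₂ d S.N S.K ⟩
      S.N * (d * S.K) ∎)
      where
      open ≤-Reasoning
      comm : ∀ x y z → x * (y * z) ≡ y * (x * z)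
      comm = solve-∀
      ring₁ : ∀ n B K → 8 * (n * (2 * (B * K))) ≡ 16 * (n * B) * K
      ring₁ = solve-∀
      ring₂ : ∀ d N K → d * N * K ≡ N * (d * K)
      ring₂ = solve-∀
    in-window : 4 * (d * S′.K) < 8 * (n * S′.Dsum)
    in-window = subst (λ z → 4 * (d * z) < 8 * (n * S′.Dsum)) (sym move-K) (+-cancelʳ-< (d * S.K) _ _ (begin-strict
      4 * (d * S.K) + d * S.K ≡⟨ ring (d * S.K) ⟩
      5 * (d * S.K) <⟨ large ⟩
      8 * (n * S.Dsum) ≤⟨ *-monoʳ-≤ 8 move-D ⟩
      8 * (n * S′.Dsum + Φ) ≡⟨ *-distribˡ-+ 8 (n * S′.Dsum) Φ ⟩
      8 * (n * S′.Dsum) + 8 * Φ ≤⟨ +-monoʳ-≤ _ 8Φ≤dK ⟩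
      8 * (n * S′.Dsum) + d * S.K ∎))
      where
      open ≤-Reasoning
      ring : ∀ x → 4 * x + x ≡ 5 * x
      ring = solve-∀

-- Hyperplanes

length-filter : {P : 𝒳 → Set} (P? : ∀ x → Dec (P x)) (xs : List 𝒳) → length (filter P? xs) ≡ ∑[ x ∈ xs ] 𝟙 (does (P? x))
length-filter P? [] = refl
length-filter P? (x ∷ xs) with does (P? x)
... | true = cong suc (length-filter P? xs)
... | false = length-filter P? xs

all-or-some : ∀ {k} {P Q : Fin k → Set} → (∀ i → P i ⊎ Q i) → (∀ i → P i) ⊎ ∃ Q
all-or-some {zero} h = inj₁ λ ()
all-or-some {suc k} h with h zero | all-or-some (h ∘ suc)
... | inj₂ q | _ = inj₂ (zero , q)
... | inj₁ _ | inj₂ (i , q) = inj₂ (suc i , q)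
... | inj₁ p | inj₁ ps = inj₁ λ { zero → p ; (suc i) → ps i }

insertAt-update : ∀ {n m} (w : Tuple n m) (i : Fin (suc m)) a b → insertAt w i a [ i ]≔ b ≡ insertAt w i b
insertAt-update w zero a b = refl
insertAt-update (c ∷ w) (suc i) a b = cong (c ∷_) (insertAt-update w i a b)

module Directions {n m : ℕ} (F : Family n (suc m)) (t : ℕ) where

  layer : Fin (suc m) → Fin n → Tuple n m → Bool
  layer i a w = F (insertAt w i a)

  layerSize : Fin (suc m) → Fin n → ℕ
  layerSize i a = ∑[ w ∈ allTuples n m ] 𝟙 (layer i a w)

  ∑-layerSize : ∀ i → ∑ (allFin n) (layerSize i) ≡ size F
  ∑-layerSize i = sym (trans (count-∑ F (allTuples n (suc m))) (∑-tuples-insertAt n m i (𝟙 ∘ F)))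

  hyperCount-layerSize : ∀ i a → hyperCount F i a ≡ layerSize i a
  hyperCount-layerSize i a = begin
    hyperCount F i a ≡⟨ count-∑ _ (allTuples n (suc m)) ⟩
    (∑[ v ∈ allTuples n (suc m) ] 𝟙 (does (lookup v i ≟F a) ∧ F v)) ≡⟨ ∑-tuples-insertAt n m i _ ⟩
    (∑[ b ∈ allFin n ] ∑[ w ∈ allTuples n m ] 𝟙 (does (lookup (insertAt w i b) i ≟F a) ∧ layer i b w))
      ≡⟨ ∑-cong (allFin n) (λ b → trans (∑-cong (allTuples n m) λ w → trans (cong (λ c → 𝟙 (does (c ≟F a) ∧ layer i b w)) (insertAt-lookup w i b))
           (trans (𝟙-∧ (does (b ≟F a)) _) (cong (λ x → 𝟙 x * 𝟙 (layer i b w)) (≟F-sym b a)))) (∑-*ˡ (allTuples n m) (𝟙 (does (a ≟F b))) (𝟙 ∘ layer i b))) ⟩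
    (∑[ b ∈ allFin n ] 𝟙 (does (a ≟F b)) * layerSize i b) ≡⟨ ∑-Fin-≡ a (layerSize i) ⟩
    layerSize i a ∎
    where
    open ≡-Reasoning
    ≟F-sym : ∀ (a b : Fin n) → does (a ≟F b) ≡ does (b ≟F a)
    ≟F-sym a b with a ≟F b
    ... | yes refl = sym (dec-true (a ≟F a) refl)
    ... | no a≢b = sym (dec-false (b ≟F a) (a≢b ∘ sym))

  badMatchings : ℕ
  badMatchings = ∑[ V ∈ matchings n (suc m) ] 𝟙 (not ((∑[ a ∈ allFin n ] 𝟙 (F (lookup V a))) ≡ᵇ t))

  badInDirection : Fin (suc m) → ℕ
  badInDirection i = ∑[ W ∈ matchings n m ] 𝟙 (not (hits F i W ≡ᵇ t))

  -- Every ordered matching has a unique reordering whose i-th coordinates are in order.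
  badMatchings-direction : ∀ i → badMatchings ≡ length (perms n) * badInDirection i
  badMatchings-direction i = trans (∑-matchings-insertAt n m i _)
    (trans (∑-cong-∈ (perms n) λ π π∈ → reorder π (perms-Inj π∈)) (∑-const (perms n) _))
    where
    open ≡-Reasoning
    bad : (Fin n → ℕ) → ℕ
    bad g = 𝟙 (not (∑ (allFin n) g ≡ᵇ t))
    bad-cong : ∀ {g h : Fin n → ℕ} → (∀ a → g a ≡ h a) → bad g ≡ bad h
    bad-cong e = cong (λ z → 𝟙 (not (z ≡ᵇ t))) (∑-cong (allFin n) e)
    reorder : ∀ π → Inj π → ∑[ W ∈ matchings n m ] bad (λ a → 𝟙 (F (lookup (zipWith (insertRow i) π W) a))) ≡ badInDirection i
    reorder π π-inj = begin
      (∑[ W ∈ matchings n m ] bad (λ a → 𝟙 (F (lookup (zipWith (insertRow i) π W) a))))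
        ≡⟨ ∑-cong (matchings n m) (λ W → bad-cong λ a → cong (𝟙 ∘ F) (lookup-zipWith (insertRow i) a π W)) ⟩
      (∑[ W ∈ matchings n m ] bad (λ a → 𝟙 (layer i (lookup π a) (lookup W a))))
        ≡⟨ sym (∑-matchings-∘ᵥ m π-inj (λ W → bad λ a → 𝟙 (layer i (lookup π a) (lookup W a)))) ⟩
      (∑[ W ∈ matchings n m ] bad (λ a → 𝟙 (layer i (lookup π a) (lookup (W ∘ᵥ π) a))))
        ≡⟨ ∑-cong (matchings n m) (λ W → bad-cong λ a → cong (λ v → 𝟙 (layer i (lookup π a) v)) (lookup-∘ᵥ W π a)) ⟩
      (∑[ W ∈ matchings n m ] bad (λ a → 𝟙 (layer i (lookup π a) (lookup W (lookup π a)))))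
        ≡⟨ ∑-cong (matchings n m) (λ W → cong (λ z → 𝟙 (not (z ≡ᵇ t))) (∑-perm π-inj (λ b → 𝟙 (layer i b (lookup W b))))) ⟩
      badInDirection i ∎

  badInDirection-const : ∀ i j → badInDirection i ≡ badInDirection j
  badInDirection-const i j = *-cancelˡ-≡ _ _ (length (perms n)) {{>-nonZero (perms-nonempty n)}}
    (trans (sym (badMatchings-direction i)) (badMatchings-direction j))

  size≤ : size F ≤ n * n ^ m
  size≤ = begin
    size F ≡⟨ count-∑ F (allTuples n (suc m)) ⟩
    (∑[ v ∈ allTuples n (suc m) ] 𝟙 (F v)) ≤⟨ ∑-mono (allTuples n (suc m)) (λ v → 𝟙≤1 (F v)) ⟩
    (∑[ v ∈ allTuples n (suc m) ] 1) ≡⟨ trans (∑-const-tuples n (suc m) 1) (*-identityʳ _) ⟩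
    n * n ^ m ∎
    where open ≤-Reasoning

  layerSize-≤ : ∀ i a → layerSize i a ≤ n ^ m
  layerSize-≤ i a = ≤-trans (∑-mono (allTuples n m) λ w → 𝟙≤1 (layer i a w)) (≤-reflexive (trans (∑-const-tuples n m 1) (*-identityʳ _)))

module Intersection {n m : ℕ} (F : Family n (suc m)) {i j : Fin (suc m)} (i≢j : i ≢ j) (a : Fin n) where

  open Directions F 0 using (layer; layerSize)

  j′ : Fin m
  j′ = punchOut i≢j

  -- The part of F in the intersection of the hyperplanes H_i(c) and H_j(a).
  meet : Fin n → ℕ
  meet c = ∑[ w ∈ allTuples n m ] 𝟙 (does (lookup w j′ ≟F a)) * 𝟙 (layer i c w)

  ∑-meet : hyperCount F j a ≡ ∑ (allFin n) meet
  ∑-meet = trans (count-∑ _ (allTuples n (suc m))) (trans (∑-tuples-insertAt n m i _)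
    (∑-cong (allFin n) λ c → ∑-cong (allTuples n m) λ w → trans (𝟙-∧ (does (lookup (insertAt w i c) j ≟F a)) _)
      (cong (λ b → 𝟙 (does (b ≟F a)) * 𝟙 (layer i c w)) (trans (cong (lookup (insertAt w i c)) (sym (punchIn-punchOut i≢j))) (insertAt-punchIn w i c j′)))))

  meet-≤ : ∀ c → meet c ≤ layerSize i c
  meet-≤ c = ∑-mono (allTuples n m) λ w → ≤-trans (*-monoˡ-≤ _ (𝟙≤1 (does (lookup w j′ ≟F a)))) (≤-reflexive (*-identityˡ _))

  -- Two hyperplanes in different directions share n^(m-1) tuples; the factor `n` avoids the
  -- predecessor in the exponent.
  n*meet-≤ : ∀ c → n * meet c ≤ n ^ m
  n*meet-≤ c = ≤-trans (*-monoʳ-≤ n (∑-mono (allTuples n m) λ w → ≤-trans (*-monoʳ-≤ (𝟙 (does (lookup w j′ ≟F a))) (𝟙≤1 (layer i c w))) (≤-reflexive (*-identityʳ _))))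
    (≤-reflexive (slice j′))
    where
    slice : ∀ {m} (j : Fin m) → n * (∑[ w ∈ allTuples n m ] 𝟙 (does (lookup w j ≟F a))) ≡ n ^ m
    slice {suc m} j = cong (n *_) (begin
      (∑[ w ∈ allTuples n (suc m) ] 𝟙 (does (lookup w j ≟F a)))
        ≡⟨ sym (trans (count-∑ _ (allTuples n (suc m))) (∑-cong (allTuples n (suc m)) λ w → cong 𝟙 (∧-identityʳ _))) ⟩
      hyperCount (λ (_ : Tuple n (suc m)) → true) j a ≡⟨ Directions.hyperCount-layerSize (λ _ → true) 0 j a ⟩
      (∑[ w ∈ allTuples n m ] 1) ≡⟨ trans (∑-const-tuples n m 1) (*-identityʳ (n ^ m)) ⟩
      n ^ m ∎)
      where open ≡-Reasoning

module Hyperplanes {n m : ℕ} (4≤n : 4 ≤ n) (F : Family n (suc m)) (s : ℕ) (|F| : size F ≡ (s ∸ 1) * n ^ m + 1) where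

  t N B L : ℕ
  t = s ∸ 1
  N = numPM n (suc m)
  B = numBad F s
  L = n ^ m

  open Directions F t

  module Dir (i : Fin (suc m)) = Layers 4≤n m (layer i) t

  N-Dir : #matchings n m ≡ N
  N-Dir = sym (numPM-matchings n m)

  B-Dir : ∀ i → badInDirection i ≡ B
  B-Dir i = trans (badInDirection-const i zero) (sym (numBad-matchings F s))

  total : ∀ i → ∑ (allFin n) (layerSize i) ≡ t * L + 1
  total i = trans (∑-layerSize i) |F|

  Close : Fin (suc m) → Set
  Close i = ∀ a b → N * Dir.diff i a b ≤ 2 * B * L

  Extreme : Fin (suc m) → Set
  Extreme i = ∀ a → Fat F s i a ⊎ Thin F s i a

  fat-layer : ∀ {i a} → Fat F s i a → N * L ≤ N * layerSize i a + 2 * B * L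
  fat-layer {i} {a} = subst (λ q → N * L ≤ N * q + 2 * B * L) (hyperCount-layerSize i a)

  thin-layer : ∀ {i a} → Thin F s i a → N * layerSize i a ≤ 2 * B * L
  thin-layer {i} {a} = subst (λ q → N * q ≤ 2 * B * L) (hyperCount-layerSize i a)

  close-or-extreme : 8 * B < N → ∀ i → Close i ⊎ Extreme i
  close-or-extreme small i = subst₂ Statement N-Dir (B-Dir i) dichotomy small
    where
    -- `Dir i` counts matchings numbered by direction `i`, `numPM` and `numBad` count unordered
    -- ones. Abstracting both counts allows the whole implication to be transported at once.
    Statement : ℕ → ℕ → Set
    Statement N B = 8 * B < N → (∀ a b → N * Dir.diff i a b ≤ 2 * B * L) ⊎
      (∀ a → (N * L ≤ N * hyperCount F i a + 2 * B * L) ⊎ (N * hyperCount F i a ≤ 2 * B * L))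
    dichotomy : Statement (#matchings n m) (badInDirection i)
    dichotomy small = case Dir.layers-dichotomy i small of λ
      { (inj₁ close) → inj₁ close
      ; (inj₂ extreme) → inj₂ λ a → subst (λ q → (#matchings n m * L ≤ #matchings n m * q + 2 * badInDirection i * L) ⊎ (#matchings n m * q ≤ 2 * badInDirection i * L))
          (sym (hyperCount-layerSize i a)) (extreme a) }

  close-layers : ∀ {i} → Close i → ∀ a b → N * layerSize i a ≤ N * layerSize i b + 2 * B * L
  close-layers {i} close a b = subst₂ (λ N B → N * Dir.diff i a b ≤ 2 * B * L → N * layerSize i a ≤ N * layerSize i b + 2 * B * L)
    N-Dir (B-Dir i) (Dir.close-q i) (close a b)

  N>0 : 0 < N
  N>0 = subst (0 <_) N-Dir (#matchings-pos n m)

  -- The expected number of tuples of F in a matching exceeds t by 1 / L, and a matching has at most n tuples.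
  N≤nBL : N ≤ n * (B * L)
  N≤nBL = +-cancelˡ-≤ (N * (t * L)) _ _ (begin
    N * (t * L) + N ≡⟨ ring N (t * L) ⟩
    N * (t * L + 1) ≡⟨ cong (N *_) (sym (total zero)) ⟩
    N * ∑ (allFin n) (layerSize zero) ≤⟨ subst₂ (λ N B → N * ∑ (allFin n) (layerSize zero) ≤ N * (t * L) + n * (B * L)) N-Dir (B-Dir zero) (Dir.∑q-≤ zero) ⟩
    N * (t * L) + n * (B * L) ∎)
    where
    open ≤-Reasoning
    ring : ∀ N x → N * x + N ≡ N * (x + 1)
    ring = solve-∀

  -- The extra tuple in `t * L + 1` must be absorbed without loss. Averaging closeness only over the
  -- layers other than `a` saves one error term `2 * B * L`, which pays for it if `N ≤ 2 * B * L`.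
  -- Otherwise the error is less than one tuple, all layers in direction `i` have equal size, and
  -- `N≤nBL` pays.
  close-bound : ∀ {i} → Close i → ∀ a → n * (N * hyperCount F i a) ≤ n * (2 * B * L) + N * (t * L)
  close-bound {i} close a = subst (λ h → n * (N * h) ≤ n * (2 * B * L) + N * (t * L)) (sym (hyperCount-layerSize i a))
    (case N ≤? 2 * B * L of λ { (yes h) → spread h ; (no h) → equal (≰⇒> h) })
    where
    open ≤-Reasoning
    q = layerSize i
    spread : N ≤ 2 * B * L → n * (N * q a) ≤ n * (2 * B * L) + N * (t * L)
    spread h = begin
      n * (N * q a) ≡⟨ sym (trans (∑-Fin-ne a (λ _ → N * q a)) (∑-const-Fin n (N * q a))) ⟩
      (∑[ b ∈ allFin n ] 𝟙 (ne a b) * (N * q a)) + N * q a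
        ≤⟨ +-monoˡ-≤ _ (∑-mono (allFin n) λ b → *-monoʳ-≤ (𝟙 (ne a b)) (close-layers close a b)) ⟩
      (∑[ b ∈ allFin n ] 𝟙 (ne a b) * (N * q b + 2 * B * L)) + N * q a
        ≡⟨ cong (_+ N * q a) (trans (∑-cong (allFin n) λ b → *-distribˡ-+ (𝟙 (ne a b)) _ _) (trans (∑-+ (allFin n) _ _) (cong ((∑[ b ∈ allFin n ] 𝟙 (ne a b) * (N * q b)) +_) (∑-ne-const a _)))) ⟩
      (∑[ b ∈ allFin n ] 𝟙 (ne a b) * (N * q b)) + (n ∸ 1) * (2 * B * L) + N * q a ≡⟨ ring₁ (∑[ b ∈ allFin n ] 𝟙 (ne a b) * (N * q b)) ((n ∸ 1) * (2 * B * L)) (N * q a) ⟩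
      (∑[ b ∈ allFin n ] 𝟙 (ne a b) * (N * q b)) + N * q a + (n ∸ 1) * (2 * B * L)
        ≡⟨ cong (_+ (n ∸ 1) * (2 * B * L)) (trans (∑-Fin-ne a (λ b → N * q b)) (trans (∑-*ˡ (allFin n) N q) (cong (N *_) (total i)))) ⟩
      N * (t * L + 1) + (n ∸ 1) * (2 * B * L) ≡⟨ ring₂ N (t * L) _ ⟩
      N + (n ∸ 1) * (2 * B * L) + N * (t * L) ≤⟨ +-monoˡ-≤ _ (+-monoˡ-≤ _ h) ⟩
      2 * B * L + (n ∸ 1) * (2 * B * L) + N * (t * L) ≡⟨ cong (_+ N * (t * L)) (cong (_* (2 * B * L)) (m+[n∸m]≡n {1} {n} (≤-trans (s≤s z≤n) 4≤n))) ⟩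
      n * (2 * B * L) + N * (t * L) ∎
      where
      ring₁ : ∀ x y z → x + y + z ≡ x + z + y
      ring₁ = solve-∀
      ring₂ : ∀ N x y → N * (x + 1) + y ≡ N + y + N * x
      ring₂ = solve-∀
    equal : 2 * B * L < N → n * (N * q a) ≤ n * (2 * B * L) + N * (t * L)
    equal h = begin
      n * (N * q a) ≡⟨ ring₁ n N (q a) ⟩
      N * (n * q a) ≡⟨ cong (N *_) (sym (∑-const-Fin n (q a))) ⟩
      N * (∑[ _ ∈ allFin n ] q a) ≤⟨ *-monoʳ-≤ N (∑-mono (allFin n) q-≤) ⟩
      N * ∑ (allFin n) q ≡⟨ cong (N *_) (total i) ⟩
      N * (t * L + 1) ≡⟨ ring₂ N (t * L) ⟩
      N + N * (t * L) ≤⟨ +-monoˡ-≤ _ (≤-trans N≤nBL (*-monoʳ-≤ n (≤-trans (m≤m+n (B * L) (B * L)) (≤-reflexive (ring₃ B L))))) ⟩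
      n * (2 * B * L) + N * (t * L) ∎
      where
      ring₁ : ∀ n N x → n * (N * x) ≡ N * (n * x)
      ring₁ = solve-∀
      ring₂ : ∀ N x → N * (x + 1) ≡ N + N * x
      ring₂ = solve-∀
      ring₃ : ∀ B L → B * L + B * L ≡ 2 * B * L
      ring₃ = solve-∀
      q-≤ : ∀ b → q a ≤ q b
      q-≤ b = ≮⇒≥ λ q< → <⇒≱ h (+-cancelˡ-≤ (N * q b) _ _ (begin
        N * q b + N ≡⟨ trans (+-comm (N * q b) N) (sym (*-suc N (q b))) ⟩
        N * suc (q b) ≤⟨ *-monoʳ-≤ N q< ⟩
        N * q a ≤⟨ close-layers close a b ⟩
        N * q b + 2 * B * L ∎))

  extreme-partition : ∀ {i} → Extreme i → Σ (Fin n → Bool) λ inF → ∀ a → (inF a ≡ true → Fat F s i a) × (inF a ≡ false → Thin F s i a)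
  extreme-partition {i} extreme = (λ a → does (Fat? F s i a)) , λ a → does-true⁻ (Fat? F s i a) , λ e → thin (extreme a) (does-false⁻ (Fat? F s i a) e)
    where
    thin : ∀ {a} → Fat F s i a ⊎ Thin F s i a → ¬ Fat F s i a → Thin F s i a
    thin (inj₁ f) ¬f = ⊥-elim (¬f f)
    thin (inj₂ h) _ = h

  module Concentrated (8≤n : 8 ≤ n) (2≤t : 2 ≤ t) (few : 4 * n * t * B ≤ N) where

    L>0 : 0 < L
    L>0 = m^n>0 n {{>-nonZero (≤-trans (s≤s z≤n) 4≤n)}} m

    NL≢0 : NonZero (N * L)
    NL≢0 = >-nonZero (*-mono-≤ N>0 L>0)

    small : 8 * B < N
    small = go B few
      where
      open ≤-Reasoning
      ring : ∀ b → 1 + 8 * (1 + b) + (55 + 56 * b) ≡ 4 * 8 * 2 * (1 + b)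
      ring = solve-∀
      go : ∀ b → 4 * n * t * b ≤ N → 8 * b < N
      go zero _ = N>0
      go (suc b) h = begin
        1 + 8 * suc b ≤⟨ m≤m+n _ (55 + 56 * b) ⟩
        1 + 8 * suc b + (55 + 56 * b) ≡⟨ ring b ⟩
        4 * 8 * 2 * suc b ≤⟨ *-monoˡ-≤ (suc b) (*-mono-≤ (*-monoʳ-≤ 4 8≤n) 2≤t) ⟩
        4 * n * t * suc b ≤⟨ h ⟩
        N ∎

    t<n : t < n
    t<n = *-cancelʳ-< L t n (begin-strict
      t * L <⟨ m<m+n (t * L) {1} (s≤s z≤n) ⟩
      t * L + 1 ≡⟨ sym |F| ⟩
      size F ≤⟨ size≤ ⟩
      n * L ∎)
      where open ≤-Reasoning

    8nB≤N : 8 * (n * B) ≤ N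
    8nB≤N = begin
      8 * (n * B) ≡⟨ ring n B ⟩
      4 * n * 2 * B ≤⟨ *-monoˡ-≤ B (*-monoʳ-≤ (4 * n) 2≤t) ⟩
      4 * n * t * B ≤⟨ few ⟩
      N ∎
      where
      open ≤-Reasoning
      ring : ∀ n B → 8 * (n * B) ≡ 4 * n * 2 * B
      ring = solve-∀

    8nBL≤NL : 8 * (n * (B * L)) ≤ N * L
    8nBL≤NL = ≤-trans (≤-reflexive (ring n B L)) (*-monoˡ-≤ L 8nB≤N)
      where
      ring : ∀ n B L → 8 * (n * (B * L)) ≡ 8 * (n * B) * L
      ring = solve-∀

    -- The extra tuple of F forces p ≥ 1/nL, while p ≤ 1/8n. Hence this tuple is at most 1/8 of a
    -- layer and cannot disturb the counts below.
    8≤L : 8 ≤ L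
    8≤L = *-cancelˡ-≤ N {{>-nonZero N>0}} (begin
      N * 8 ≡⟨ *-comm N 8 ⟩
      8 * N ≤⟨ *-monoʳ-≤ 8 N≤nBL ⟩
      8 * (n * (B * L)) ≤⟨ 8nBL≤NL ⟩
      N * L ∎)
      where open ≤-Reasoning

    -- In units of `N * L` this is 2np, the error accumulated over all layers of one direction; it
    -- is at most 1/4.
    2nBL : ℕ
    2nBL = n * (2 * B * L)

    4[2nBL]≤NL : 4 * 2nBL ≤ N * L
    4[2nBL]≤NL = ≤-trans (≤-reflexive (ring n B L)) 8nBL≤NL
      where
      ring : ∀ n B L → 4 * (n * (2 * B * L)) ≡ 8 * (n * (B * L))
      ring = solve-∀

    module _ {i : Fin (suc m)} (extreme : Extreme i) where

      private
        fat : Fin n → Bool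
        fat a = does (Fat? F s i a)

        thin-if-not-fat : ∀ a → fat a ≡ false → Thin F s i a
        thin-if-not-fat a e = proj₂ (proj₂ (extreme-partition extreme) a) e

      #fat : ℕ
      #fat = ∑[ a ∈ allFin n ] 𝟙 (fat a)

      private
        lower : #fat * (N * L) ≤ N * (t * L + 1) + 2nBL
        lower = begin
          #fat * (N * L) ≡⟨ sym (∑-*ʳ (allFin n) (𝟙 ∘ fat) (N * L)) ⟩
          (∑[ a ∈ allFin n ] 𝟙 (fat a) * (N * L)) ≤⟨ ∑-mono (allFin n) (λ a → at a) ⟩
          (∑[ a ∈ allFin n ] (N * layerSize i a + 2 * B * L)) ≡⟨ trans (∑-+ (allFin n) _ _) (cong₂ _+_ (∑-*ˡ (allFin n) N _) (∑-const-Fin n _)) ⟩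
          N * ∑ (allFin n) (layerSize i) + 2nBL ≡⟨ cong (λ z → N * z + 2nBL) (total i) ⟩
          N * (t * L + 1) + 2nBL ∎
          where
          open ≤-Reasoning
          at : ∀ a → 𝟙 (fat a) * (N * L) ≤ N * layerSize i a + 2 * B * L
          at a with fat a in e
          ... | true = ≤-trans (≤-reflexive (*-identityˡ _)) (fat-layer (does-true⁻ (Fat? F s i a) e))
          ... | false = z≤n

        upper : N * (t * L + 1) ≤ #fat * (N * L) + 2nBL
        upper = begin
          N * (t * L + 1) ≡⟨ cong (N *_) (sym (total i)) ⟩
          N * ∑ (allFin n) (layerSize i) ≡⟨ sym (∑-*ˡ (allFin n) N _) ⟩
          (∑[ a ∈ allFin n ] N * layerSize i a) ≤⟨ ∑-mono (allFin n) (λ a → at a) ⟩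
          (∑[ a ∈ allFin n ] (𝟙 (fat a) * (N * L) + 2 * B * L)) ≡⟨ trans (∑-+ (allFin n) _ _) (cong₂ _+_ (∑-*ʳ (allFin n) (𝟙 ∘ fat) _) (∑-const-Fin n _)) ⟩
          #fat * (N * L) + 2nBL ∎
          where
          open ≤-Reasoning
          at : ∀ a → N * layerSize i a ≤ 𝟙 (fat a) * (N * L) + 2 * B * L
          at a with fat a in e
          ... | true = ≤-trans (*-monoʳ-≤ N (layerSize-≤ i a)) (≤-trans (≤-reflexive (sym (*-identityˡ _))) (m≤m+n _ _))
          ... | false = thin-layer (thin-if-not-fat a e)

      -- Counting F by layers puts the number of fat ones within 2np ≤ 1/4 of t + 1/L, where 1/L ≤
      -- 1/8; an integer that close to `t` is `t`.
      #fat≡t : #fat ≡ t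
      #fat≡t = ≤-antisym (≮⇒≥ not-more) (≮⇒≥ not-fewer)
        where
        open ≤-Reasoning
        not-more : ¬ t < #fat
        not-more h = <⇒≱ (≤-trans (m≤m+n 5 19) (*-monoʳ-≤ 3 8≤L)) (*-cancelˡ-≤ N {{>-nonZero N>0}} (+-cancelʳ-≤ (N * L + 4 * (t * (N * L))) _ _ (begin
          N * (3 * L) + (N * L + 4 * (t * (N * L))) ≡⟨ ring₁ N L t ⟩
          4 * (suc t * (N * L)) ≤⟨ *-monoʳ-≤ 4 (≤-trans (*-monoˡ-≤ (N * L) h) lower) ⟩
          4 * (N * (t * L + 1) + 2nBL) ≡⟨ *-distribˡ-+ 4 (N * (t * L + 1)) 2nBL ⟩
          4 * (N * (t * L + 1)) + 4 * 2nBL ≤⟨ +-monoʳ-≤ _ 4[2nBL]≤NL ⟩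
          4 * (N * (t * L + 1)) + N * L ≡⟨ ring₂ N L t ⟩
          N * 4 + (N * L + 4 * (t * (N * L))) ∎)))
          where
          ring₁ : ∀ N L t → N * (3 * L) + (N * L + 4 * (t * (N * L))) ≡ 4 * ((1 + t) * (N * L))
          ring₁ = solve-∀
          ring₂ : ∀ N L t → 4 * (N * (t * L + 1)) + N * L ≡ N * 4 + (N * L + 4 * (t * (N * L)))
          ring₂ = solve-∀
        not-fewer : ¬ #fat < t
        not-fewer h = <⇒≱ (m<m+n (N * L + 3 * (N * L)) {4 * N} (*-mono-≤ {1} {4} (s≤s z≤n) N>0)) (+-cancelʳ-≤ (4 * (#fat * (N * L))) _ _ (begin
          N * L + 3 * (N * L) + 4 * N + 4 * (#fat * (N * L)) ≡⟨ ring₁ N L #fat ⟩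
          4 * (suc #fat * (N * L)) + 4 * N ≤⟨ +-monoˡ-≤ _ (*-monoʳ-≤ 4 (*-monoˡ-≤ (N * L) h)) ⟩
          4 * (t * (N * L)) + 4 * N ≡⟨ ring₂ N L t ⟩
          4 * (N * (t * L + 1)) ≤⟨ *-monoʳ-≤ 4 upper ⟩
          4 * (#fat * (N * L) + 2nBL) ≡⟨ *-distribˡ-+ 4 (#fat * (N * L)) 2nBL ⟩
          4 * (#fat * (N * L)) + 4 * 2nBL ≤⟨ +-monoʳ-≤ _ 4[2nBL]≤NL ⟩
          4 * (#fat * (N * L)) + N * L ≤⟨ m≤m+n _ (3 * (N * L)) ⟩
          4 * (#fat * (N * L)) + N * L + 3 * (N * L) ≡⟨ ring₃ (4 * (#fat * (N * L))) (N * L) ⟩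
          N * L + 3 * (N * L) + 4 * (#fat * (N * L)) ∎))
          where
          ring₁ : ∀ N L c → N * L + 3 * (N * L) + 4 * N + 4 * (c * (N * L)) ≡ 4 * ((1 + c) * (N * L)) + 4 * N
          ring₁ = solve-∀
          ring₂ : ∀ N L t → 4 * (t * (N * L)) + 4 * N ≡ 4 * (N * (t * L + 1))
          ring₂ = solve-∀
          ring₃ : ∀ x y → x + y + 3 * y ≡ y + 3 * y + x
          ring₃ = solve-∀

      -- In another direction a hyperplane meets each of the `t` fat layers in at most n^(m-1)
      -- tuples and gains at most the thin content of the `r` others. Being fat would require r ≤ (r
      -- + 1) * 2np ≤ (r + 1)/4, impossible for r ≥ 1.
      fat-parallel : ∀ j a → Fat F s j a → j ≡ i
      fat-parallel j a fat-j = case i ≟F j of λ { (yes i≡j) → sym i≡j ; (no i≢j) → ⊥-elim (absurd i≢j) }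
        where
        module _ (i≢j : i ≢ j) where
          open Intersection F i≢j a
          open ≤-Reasoning
          r = n ∸ t
          at : ∀ c → n * (N * meet c) ≤ 𝟙 (fat c) * (N * L) + 𝟙 (not (fat c)) * 2nBL
          at c with fat c in e
          ... | true = begin
            n * (N * meet c) ≡⟨ comm n N (meet c) ⟩
            N * (n * meet c) ≤⟨ *-monoʳ-≤ N (n*meet-≤ c) ⟩
            N * L ≡⟨ ring (N * L) ⟩
            1 * (N * L) + 0 ∎
            where
            comm : ∀ x y z → x * (y * z) ≡ y * (x * z)
            comm = solve-∀
            ring : ∀ x → x ≡ 1 * x + 0
            ring = solve-∀
          ... | false = begin
            n * (N * meet c) ≤⟨ *-monoʳ-≤ n (≤-trans (*-monoʳ-≤ N (meet-≤ c)) (thin-layer (thin-if-not-fat c e))) ⟩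
            2nBL ≡⟨ sym (*-identityˡ 2nBL) ⟩
            1 * 2nBL ∎
          #thin≡r : ∑[ c ∈ allFin n ] 𝟙 (not (fat c)) ≡ r
          #thin≡r = +-cancelˡ-≡ #fat _ _ (begin-equality
            #fat + (∑[ c ∈ allFin n ] 𝟙 (not (fat c))) ≡⟨ sym (∑-+ (allFin n) _ _) ⟩
            (∑[ c ∈ allFin n ] (𝟙 (fat c) + 𝟙 (not (fat c)))) ≡⟨ ∑-cong (allFin n) (λ c → 𝟙-not (fat c)) ⟩
            (∑[ c ∈ allFin n ] 1) ≡⟨ trans (∑-const-Fin n 1) (*-identityʳ n) ⟩
            n ≡⟨ sym (m+[n∸m]≡n (<⇒≤ t<n)) ⟩
            t + r ≡⟨ cong (_+ r) (sym #fat≡t) ⟩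
            #fat + r ∎)
          meets : n * (N * hyperCount F j a) ≤ t * (N * L) + r * 2nBL
          meets = begin
            n * (N * hyperCount F j a) ≡⟨ cong (λ z → n * (N * z)) ∑-meet ⟩
            n * (N * ∑ (allFin n) meet) ≡⟨ sym (trans (∑-*ˡ (allFin n) n _) (cong (n *_) (∑-*ˡ (allFin n) N meet))) ⟩
            (∑[ c ∈ allFin n ] n * (N * meet c)) ≤⟨ ∑-mono (allFin n) at ⟩
            (∑[ c ∈ allFin n ] (𝟙 (fat c) * (N * L) + 𝟙 (not (fat c)) * 2nBL))
              ≡⟨ trans (∑-+ (allFin n) _ _) (cong₂ _+_ (∑-*ʳ (allFin n) (𝟙 ∘ fat) _) (∑-*ʳ (allFin n) (𝟙 ∘ not ∘ fat) _)) ⟩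
            #fat * (N * L) + (∑[ c ∈ allFin n ] 𝟙 (not (fat c))) * 2nBL ≡⟨ cong₂ (λ x y → x * (N * L) + y * 2nBL) #fat≡t #thin≡r ⟩
            t * (N * L) + r * 2nBL ∎
          bound : n * (N * L) ≤ t * (N * L) + r * 2nBL + 2nBL
          bound = begin
            n * (N * L) ≤⟨ *-monoʳ-≤ n fat-j ⟩
            n * (N * hyperCount F j a + 2 * B * L) ≡⟨ *-distribˡ-+ n _ _ ⟩
            n * (N * hyperCount F j a) + 2nBL ≤⟨ +-monoˡ-≤ 2nBL meets ⟩
            t * (N * L) + r * 2nBL + 2nBL ∎
          r-bound : r * (N * L) ≤ r * 2nBL + 2nBL
          r-bound = +-cancelˡ-≤ (t * (N * L)) _ _ (begin
            t * (N * L) + r * (N * L) ≡⟨ sym (*-distribʳ-+ (N * L) t r) ⟩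
            (t + r) * (N * L) ≡⟨ cong (_* (N * L)) (m+[n∸m]≡n (<⇒≤ t<n)) ⟩
            n * (N * L) ≤⟨ bound ⟩
            t * (N * L) + r * 2nBL + 2nBL ≡⟨ +-assoc (t * (N * L)) _ _ ⟩
            t * (N * L) + (r * 2nBL + 2nBL) ∎)
          4r≤r+1 : 4 * r ≤ r + 1
          4r≤r+1 = *-cancelʳ-≤ (4 * r) (r + 1) (N * L) {{NL≢0}} (begin
            4 * r * (N * L) ≡⟨ *-assoc 4 r (N * L) ⟩
            4 * (r * (N * L)) ≤⟨ *-monoʳ-≤ 4 r-bound ⟩
            4 * (r * 2nBL + 2nBL) ≡⟨ ring r 2nBL ⟩
            (r + 1) * (4 * 2nBL) ≤⟨ *-monoʳ-≤ (r + 1) 4[2nBL]≤NL ⟩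
            (r + 1) * (N * L) ∎)
            where
            ring : ∀ r x → 4 * (r * x + x) ≡ (r + 1) * (4 * x)
            ring = solve-∀
          absurd : ⊥
          absurd = go r (m<n⇒0<n∸m t<n) 4r≤r+1
            where
            go : ∀ r → 0 < r → 4 * r ≤ r + 1 → ⊥
            go (suc r) _ h = <⇒≱ (≤-trans (≤-reflexive (cong (2 +_) (+-comm r 1))) h₂) h
              where
              h₂ : suc (suc (suc r)) ≤ 4 * suc r
              h₂ = ≤-trans (m≤m+n (3 + r) (1 + 3 * r)) (≤-reflexive (ring r))
                where
                ring : ∀ r → 3 + r + (1 + 3 * r) ≡ 4 * (1 + r)
                ring = solve-∀

    not-all-close : ¬ (∀ i → Close i)
    not-all-close close = influential-coordinate (suc m) G few′ flips-small Dsum-large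
      where
      open ≤-Reasoning
      r d p : ℕ
      r = n ∸ t
      d = t ⊓ r
      p = length (perms n)
      0<r : 0 < r
      0<r = m<n⇒0<n∸m t<n
      0<d : 0 < d
      0<d = ⊓-glb (≤-trans (s≤s z≤n) 2≤t) 0<r
      d-min : d ≡ t ⊎ d ≡ r
      d-min with ≤-total t r
      ... | inj₁ h = inj₁ (m≤n⇒m⊓n≡m h)
      ... | inj₂ h = inj₂ (m≥n⇒m⊓n≡n h)
      open Chain 8≤n t d (<⇒≤ t<n) 0<d (m⊓n≤m t r) (m⊓n≤n t r) d-min hiding (4≤n)
      G : Tuple n 0 → Tuple n (suc m) → Bool
      G _ v = F v
      module S = Split G
      bads≡ : S.bads ≡ p * B
      bads≡ = trans (+-identityʳ _) (trans (badMatchings-direction zero) (cong (p *_) (B-Dir zero)))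
      N≡ : S.N ≡ p * N
      N≡ = trans (+-identityʳ _) (trans (#matchings-suc n m) (cong (p *_) N-Dir))
      -- This turns p ≤ 1/4nt into p ≤ d/16n, as needed for the descent. If `t` is 2 or 3, then n -
      -- t ≥ 5 and so d ≥ 2; this is where t ≥ 2 is essential.
      4≤td : 4 ≤ t * d
      4≤td with 4 ≤? t
      ... | yes 4≤t = *-mono-≤ 4≤t 0<d
      ... | no ¬4≤t = *-mono-≤ 2≤t (⊓-glb 2≤t (≤-trans (≤-trans (m≤m+n 2 3) (∸-monoˡ-≤ 3 8≤n)) (∸-monoʳ-≤ n (≤-pred (≰⇒> ¬4≤t)))))
      16nB≤dN : 16 * (n * B) ≤ d * N
      16nB≤dN = begin
        16 * (n * B) ≡⟨ ring₁ n B ⟩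
        4 * n * B * 4 ≤⟨ *-monoʳ-≤ (4 * n * B) 4≤td ⟩
        4 * n * B * (t * d) ≡⟨ ring₂ n B t d ⟩
        d * (4 * n * t * B) ≤⟨ *-monoʳ-≤ d few ⟩
        d * N ∎
        where
        ring₁ : ∀ n B → 16 * (n * B) ≡ 4 * n * B * 4
        ring₁ = solve-∀
        ring₂ : ∀ n B t d → 4 * n * B * (t * d) ≡ d * (4 * n * t * B)
        ring₂ = solve-∀
      few′ : 16 * (n * S.bads) ≤ d * S.N
      few′ = begin
        16 * (n * S.bads) ≡⟨ cong (λ z → 16 * (n * z)) bads≡ ⟩
        16 * (n * (p * B)) ≡⟨ ring₁ n p B ⟩
        p * (16 * (n * B)) ≤⟨ *-monoʳ-≤ p 16nB≤dN ⟩
        p * (d * N) ≡⟨ ring₂ p d N ⟩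
        d * (p * N) ≡⟨ cong (d *_) (sym N≡) ⟩
        d * S.N ∎
        where
        ring₁ : ∀ n p B → 16 * (n * (p * B)) ≡ p * (16 * (n * B))
        ring₁ = solve-∀
        ring₂ : ∀ p d N → p * (d * N) ≡ d * (p * N)
        ring₂ = solve-∀
      flips≡ : ∀ i b → flips G i b ≡ ∑[ a ∈ allFin n ] Dir.diff i a b
      flips≡ i b = trans (+-identityʳ _) (trans (∑-tuples-insertAt n m i _) (∑-cong (allFin n) λ a → ∑-cong (allTuples n m) λ w →
        cong (λ v → 𝟙 (xor (layer i a w) (F v))) (insertAt-update w i a b)))
      flips-small : ∀ i b → S.N * flips G i b ≤ 2 * (S.bads * S.K)
      flips-small i b = begin
        S.N * flips G i b ≡⟨ cong₂ _*_ N≡ (flips≡ i b) ⟩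
        p * N * (∑[ a ∈ allFin n ] Dir.diff i a b) ≡⟨ *-assoc p N _ ⟩
        p * (N * (∑[ a ∈ allFin n ] Dir.diff i a b)) ≡⟨ cong (p *_) (sym (∑-*ˡ (allFin n) N _)) ⟩
        p * (∑[ a ∈ allFin n ] N * Dir.diff i a b) ≤⟨ *-monoʳ-≤ p (∑-mono (allFin n) λ a → close i a b) ⟩
        p * (∑[ _ ∈ allFin n ] 2 * B * L) ≡⟨ cong (p *_) (∑-const-Fin n _) ⟩
        p * (n * (2 * B * L)) ≡⟨ ring p n B L ⟩
        2 * (p * B * (1 * (n * L))) ≡⟨ cong (λ z → 2 * (z * (1 * (n * L)))) (sym bads≡) ⟩
        2 * (S.bads * S.K) ∎
        where
        ring : ∀ p n B L → p * (n * (2 * B * L)) ≡ 2 * (p * B * (1 * (n * L)))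
        ring = solve-∀
      q≡ : S.q [] ≡ t * L + 1
      q≡ = trans (sym (count-∑ F (allTuples n (suc m)))) |F|
      -- Before any coordinate is moved, `D` is d/n of the whole up to the one extra tuple, which
      -- matters only on the complement side; there 3dL ≥ 24 leaves room for the resulting loss of
      -- 8.
      5dL<8D : 5 * (d * L) < 8 * S.D []
      5dL<8D = case ≤-total (S.q []) (S.q̄ []) of λ
        { (inj₁ h) → subst (λ z → 5 * (d * L) < 8 * z) (sym (trans (m≤n⇒m⊓n≡m h) q≡)) in-F
        ; (inj₂ h) → subst (λ z → 5 * (d * L) < 8 * z) (sym (m≥n⇒m⊓n≡n h)) outside }
        where
        in-F : 5 * (d * L) < 8 * (t * L + 1)
        in-F = begin-strict
          5 * (d * L) ≤⟨ *-mono-≤ (m≤m+n 5 3) (*-monoˡ-≤ L (m⊓n≤m t r)) ⟩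
          8 * (t * L) <⟨ *-monoʳ-< 8 (m<m+n (t * L) {1} (s≤s z≤n)) ⟩
          8 * (t * L + 1) ∎
        dL≤q̄+1 : d * L ≤ S.q̄ [] + 1
        dL≤q̄+1 = +-cancelˡ-≤ (t * L) _ _ (begin
          t * L + d * L ≤⟨ +-monoʳ-≤ (t * L) (*-monoˡ-≤ L (m⊓n≤n t r)) ⟩
          t * L + r * L ≡⟨ sym (*-distribʳ-+ L t r) ⟩
          (t + r) * L ≡⟨ cong (_* L) (m+[n∸m]≡n (<⇒≤ t<n)) ⟩
          n * L ≡⟨ sym (S.q+q̄ []) ⟩
          S.q [] + S.q̄ [] ≡⟨ cong (_+ S.q̄ []) q≡ ⟩
          t * L + 1 + S.q̄ [] ≡⟨ ring (t * L) (S.q̄ []) ⟩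
          t * L + (S.q̄ [] + 1) ∎)
          where
          ring : ∀ x y → x + 1 + y ≡ x + (y + 1)
          ring = solve-∀
        outside : 5 * (d * L) < 8 * S.q̄ []
        outside = +-cancelʳ-< 8 _ _ (begin-strict
          5 * (d * L) + 8 <⟨ +-monoʳ-< (5 * (d * L)) (≤-trans (m≤m+n 9 15) (*-monoʳ-≤ 3 (*-mono-≤ 0<d 8≤L))) ⟩
          5 * (d * L) + 3 * (d * L) ≡⟨ ring₁ (d * L) ⟩
          8 * (d * L) ≤⟨ *-monoʳ-≤ 8 dL≤q̄+1 ⟩
          8 * (S.q̄ [] + 1) ≡⟨ *-distribˡ-+ 8 (S.q̄ []) 1 ⟩
          8 * S.q̄ [] + 8 ∎)
          where
          ring₁ : ∀ x → 5 * x + 3 * x ≡ 8 * x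
          ring₁ = solve-∀
      Dsum-large : 5 * (d * S.K) < 8 * (n * S.Dsum)
      Dsum-large = begin-strict
        5 * (d * (1 * (n * L))) ≡⟨ ring₁ d n L ⟩
        n * (5 * (d * L)) <⟨ *-monoʳ-< n {{>-nonZero (≤-trans (s≤s z≤n) 8≤n)}} 5dL<8D ⟩
        n * (8 * S.D []) ≡⟨ ring₂ n (S.D []) ⟩
        8 * (n * (S.D [] + 0)) ∎
        where
        ring₁ : ∀ d n L → 5 * (d * (1 * (n * L))) ≡ n * (5 * (d * L))
        ring₁ = solve-∀
        ring₂ : ∀ n D → n * (8 * D) ≡ 8 * (n * (D + 0))
        ring₂ = solve-∀

    extreme-direction : ∃ Extreme
    extreme-direction = case all-or-some (close-or-extreme small) of λ
      { (inj₁ close) → ⊥-elim (not-all-close close)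
      ; (inj₂ e) → e }

    numFat≡t : numFat F s ≡ t
    numFat≡t = begin
      numFat F s ≡⟨ length-filter _ (allHyperplanes n (suc m)) ⟩
      (∑[ ia ∈ allHyperplanes n (suc m) ] 𝟙 (does (Fat? F s (proj₁ ia) (proj₂ ia))))
        ≡⟨ trans (∑-concatMap (λ j → map (j ,_) (allFin n)) (allFin (suc m)) fatᵇ) (∑-cong (allFin (suc m)) λ j → ∑-map (j ,_) (allFin n) fatᵇ) ⟩
      (∑[ j ∈ allFin (suc m) ] ∑[ a ∈ allFin n ] 𝟙 (does (Fat? F s j a))) ≡⟨ ∑-cong (allFin (suc m)) in-direction ⟩
      (∑[ j ∈ allFin (suc m) ] 𝟙 (does (i ≟F j)) * t) ≡⟨ ∑-Fin-≡ i (λ _ → t) ⟩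
      t ∎
      where
      open ≡-Reasoning
      i = proj₁ extreme-direction
      fatᵇ : Fin (suc m) × Fin n → ℕ
      fatᵇ (j , a) = 𝟙 (does (Fat? F s j a))
      extreme = proj₂ extreme-direction
      in-direction : ∀ j → ∑[ a ∈ allFin n ] 𝟙 (does (Fat? F s j a)) ≡ 𝟙 (does (i ≟F j)) * t
      in-direction j with i ≟F j
      ... | yes refl = trans (#fat≡t extreme) (sym (+-identityʳ t))
      ... | no i≢j = trans (∑-cong (allFin n) λ a → cong 𝟙 (dec-false (Fat? F s j a) λ fat → i≢j (sym (fat-parallel extreme j a fat)))) (∑-0 (allFin n))

theorem6 : (n k s : ℕ) → 1 ≤ n → 1 ≤ k → 1 ≤ s →
    (F : Family n k) → size F ≡ (s ∸ 1) * n ^ (k ∸ 1) + 1 →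
    (4 ≤ n → 8 * numBad F s < numPM n k → (i : Fin k) →
    ((a : Fin n) →
    n * (numPM n k * hyperCount F i a)
    ≤ n * (2 * numBad F s * n ^ (k ∸ 1)) + numPM n k * ((s ∸ 1) * n ^ (k ∸ 1)))
    ⊎ Σ (Fin n → Bool) (λ inF →
    (a : Fin n) → (inF a ≡ true → Fat F s i a) × (inF a ≡ false → Thin F s i a)))
    × (8 ≤ n → 3 ≤ s → 4 * n * (s ∸ 1) * numBad F s ≤ numPM n k →
    ∃ λ (i : Fin k) → (j : Fin k) (a : Fin n) → Fat F s j a → j ≡ i)
    × (8 ≤ n → 3 ≤ s → 4 * n * (s ∸ 1) * numBad F s ≤ numPM n k →
    numFat F s ≡ s ∸ 1)
theorem6 n (suc m) s _ _ _ F |F| = part₁ , part₂ , part₃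
  where
  weaken : 8 ≤ n → 4 ≤ n
  weaken = ≤-trans (m≤m+n 4 4)

  part₁ : 4 ≤ n → 8 * numBad F s < numPM n (suc m) → (i : Fin (suc m)) → _
  part₁ 4≤n small i = case close-or-extreme small i of λ
    { (inj₁ close) → inj₁ (close-bound close)
    ; (inj₂ extreme) → inj₂ (extreme-partition extreme) }
    where open Hyperplanes 4≤n F s |F|

  part₂ : 8 ≤ n → 3 ≤ s → 4 * n * (s ∸ 1) * numBad F s ≤ numPM n (suc m) → _
  part₂ 8≤n 3≤s few = proj₁ extreme-direction , fat-parallel (proj₂ extreme-direction)
    where open Hyperplanes.Concentrated (weaken 8≤n) F s |F| 8≤n (∸-monoˡ-≤ 1 3≤s) few

  part₃ : 8 ≤ n → 3 ≤ s → 4 * n * (s ∸ 1) * numBad F s ≤ numPM n (suc m) → numFat F s ≡ s ∸ 1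
  part₃ 8≤n 3≤s few = numFat≡t
    where open Hyperplanes.Concentrated (weaken 8≤n) F s |F| 8≤n (∸-monoˡ-≤ 1 3≤s) few
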